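{- For every odd prime $p>2$, \[ \sum_{k=0}^{\frac{p-1}{2}}\frac{11k+3}{64^{k}}\binom{2k}{k}^2\binom{3k}{k} \equiv 3p+3p^2q_p(2) \pmod{p^3}. \]
   Context: For an odd prime $p$, the Fermat quotient is $q_p(2)=\frac{2^{p-1}-1}{p}$. Congruences between rational numbers whose denominators are coprime to $p$ are understood in the ring of $p$-integral rationals. -}

module Defs where

open import Data.Nat as ℕ using (ℕ; zero; suc; _∸_; _^_; NonZero)
open import Data.Nat.Combinatorics using (_C_)
open import Data.Nat.Coprimality using (Coprime)
open import Data.Nat.Properties using (m^n≢0)
open import Data.Integer as ℤ using (ℤ; +_)
open import Data.Product using (_×_; ∃-syntax)
open import Data.Rational using (ℚ; ↧ₙ_; _/_; _+_; _-_; _*_)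
open import Relation.Binary.PropositionalEquality using (_≡_)

fromℕ : ℕ → ℚ
fromℕ n = + n / 1

-- Both endpoints are included: sumTo n f = f 0 + ⋯ + f n.
sumTo : ℕ → (ℕ → ℚ) → ℚ
sumTo zero    f = f 0
sumTo (suc n) f = sumTo n f + f (suc n)

-- ↧ₙ is the denominator in lowest terms.
Integral : ℕ → ℚ → Set
Integral p x = Coprime (↧ₙ x) p

-- Congruence modulo the ideal generated by p ^ m in the ring of p-integral
-- rationals; both sides are required to belong to that ring.
infix 4 _≅_[mod_^^_]

_≅_[mod_^^_] : ℚ → ℚ → ℕ → ℕ → Set
x ≅ y [mod p ^^ m ] =
  Integral p x × Integral p y ×
  ∃[ z ] (Integral p z × x - y ≡ fromℕ (p ^ m) * z)

fermatQuotient : (p a : ℕ) → .{{NonZero p}} → ℚ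
fermatQuotient p a = (+ (a ^ (p ∸ 1)) ℤ.- + 1) / p

summand : ℕ → ℚ
summand k =
  (+ (11 ℕ.* k ℕ.+ 3) / (64 ^ k))
    * fromℕ (((2 ℕ.* k) C k) ^ 2) * fromℕ ((3 ℕ.* k) C k)
  where instance _ = m^n≢0 64 k

{-# OPTIONS --safe #-}
module Submission where

-- The right-hand side is 3p·2^(p-1).  Put t(n) = C(2n,n)² C(3n,n) / 64ⁿ and
--   h(N,k) = (3N)! (1/2)_N (1/2)_{N+k} (1/2)_{N-k} / ((2N+k)! (2N-k)! (N+k)! (N-k)!),
-- so that h(N,0) = t(N).  The function k h(N,k) has a WZ companion, which gives the exact identity
--   ∑_{n<N} (11n+3) t(n) = 24 ∑_{1≤k≤N} k h(N,k) - 8 N t(N).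
-- Take N = (p+1)/2.  Modulo p³ only k = 1, N-1, N contribute at order p.  The other terms are
-- p² (3/4) (-1)^k / ((k²-1)(4k²-1)), whose sum against k telescopes up to the alternating harmonic
-- sum A = ∑_{j<p/2} (-1)^j / j.  The products in h(N,1) are expanded to first order in p through
-- H = ∑_{j<p/2} 1/j, and 2^(p-1) ≡ 1 - pH/2 (mod p²), H ≡ 2A (mod p).

open import Defs
open import Data.Nat as ℕ using (ℕ; _∸_; _^_; _<_)
open import Data.Nat.Primality using (Prime; prime⇒nonZero)
open import Data.Rational using (_+_; _*_)

open import Data.Integer as ℤ using (+_)
open import Data.Integer.GCD using (gcd)
import Data.Integer.Properties as ℤ
open import Data.Nat using (zero; suc; _!)
open import Data.Nat.Combinatorics using (_C_; k![n∸k]!∣n!)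
open import Data.Nat.Combinatorics.Specification using (nCk≡n!/k![n-k]!)
open import Data.Nat.Coprimality as Coprime using (coprime?; 1-coprimeTo)
import Data.Nat.DivMod as ℕ
open import Data.Nat.Divisibility as ℕ using (_∣_; divides; ∣-trans)
open import Data.Nat.Primality using (euclidsLemma; prime⇒irreducible; prime⇒nonTrivial)
import Data.Nat.Properties as ℕ
import Data.Nat.Tactic.RingSolver as ℕ
open import Data.Product using (_,_; _×_; proj₁; proj₂; ∃-syntax)
open import Data.Rational using (ℚ; mkℚ; _/_; _-_; -_; ↥_; ↧_; ↧ₙ_)
open import Data.Rational.Properties
open import Data.Rational.Unnormalised using (mkℚᵘ; *≡*)
import Data.Rational.Unnormalised.Properties as ℚᵘ
open import Data.Sum using (inj₁; inj₂; [_,_]′)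
open import Function using (_⟨_⟩_)
open import Level using (0ℓ)
open import Relation.Binary.PropositionalEquality using (_≡_; refl; sym; trans; cong; cong₂; subst; module ≡-Reasoning)
open import Relation.Nullary using (¬_; contradiction)
open import Relation.Nullary.Decidable using (dec⇒maybe; from-yes)
open import Tactic.RingSolver using (solve-∀)
open import Tactic.RingSolver.Core.AlmostCommutativeRing using (AlmostCommutativeRing; fromCommutativeRing)

open ≡-Reasoning

-- The t(n) with n < p/3 are prime to p, so the sum cannot be reduced term by term; the identity
-- trades it for terms that are all divisible by p. For p > 3 and k ≥ 1 the numerator of h(N,k)
-- contains p three times, once in each of (3N)!, (1/2)_N and (1/2)_{N+k}. The denominator takes one
-- p back through (2N+k)!, another through (2N-k)! exactly when k = 1, and another through (N+k)!
-- exactly when k ≥ N-1. Hence the order is 2 in the middle, where quotients of neighbours matter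
-- only modulo p, and 1 at the ends, where the products have to be expanded one order further. At k
-- = 0 the factor (1/2)_{N-k} brings a fourth p, so N t(N) has order 2. For p = 3 the count breaks
-- down: (3N)! = 6! contains p twice, and k = 1 and k = N-1 coincide. That case is a computation.
-- Division is avoided throughout: terms are compared as polynomial multiples of a common product,
-- and congruences are checked after multiplication by a unit.

-- Constants in lowest terms by construction: the ring solver would otherwise have to
-- reduce + n / 1 again at every occurrence.
#_ : ℕ → ℚ
# n = mkℚ (+ n) 0 (Coprime.sym (1-coprimeTo n))

0ℚ 1ℚ ½ -½ ⅛ : ℚ
0ℚ = # 0
1ℚ = # 1
½  = mkℚ (+ 1) 1 (1-coprimeTo 2)
-½ = - ½
⅛  = mkℚ (+ 1) 7 (1-coprimeTo 8)

fromℕ-# : ∀ n → fromℕ n ≡ # n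
fromℕ-# n = normalize-coprime (Coprime.sym (1-coprimeTo n))

ring : AlmostCommutativeRing 0ℓ 0ℓ
ring = fromCommutativeRing +-*-commutativeRing (λ x → dec⇒maybe (0ℚ ≟ x))

-- Natural numbers and reciprocals in ℚ

opaque
  -- Opaque: unfolding casts of open terms makes conversion checking intractable.
  ι : ℕ → ℚ
  ι = fromℕ

  ι-fromℕ : ∀ n → ι n ≡ fromℕ n
  ι-fromℕ n = refl

  ι-# : ∀ n → ι n ≡ # n
  ι-# = fromℕ-#

  ι-homo-+ : ∀ m n → ι (m ℕ.+ n) ≡ ι m + ι n
  ι-homo-+ m n = toℚᵘ-injective (ℚᵘ.≃-trans (toℚᵘ-fromℚᵘ (mkℚᵘ (+ (m ℕ.+ n)) 0))
    (ℚᵘ.≃-trans (*≡* (cong (ℤ._* + 1) eq))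
      (ℚᵘ.≃-sym (ℚᵘ.≃-trans (toℚᵘ-homo-+ (ι m) (ι n))
        (ℚᵘ.+-cong (toℚᵘ-fromℚᵘ (mkℚᵘ (+ m) 0)) (toℚᵘ-fromℚᵘ (mkℚᵘ (+ n) 0)))))))
    where
    eq : + (m ℕ.+ n) ≡ + m ℤ.* + 1 ℤ.+ + n ℤ.* + 1
    eq = cong₂ ℤ._+_ (sym (ℤ.*-identityʳ (+ m))) (sym (ℤ.*-identityʳ (+ n)))

  ι-homo-* : ∀ m n → ι (m ℕ.* n) ≡ ι m * ι n
  ι-homo-* m n = toℚᵘ-injective (ℚᵘ.≃-trans (toℚᵘ-fromℚᵘ (mkℚᵘ (+ (m ℕ.* n)) 0))
    (ℚᵘ.≃-trans (*≡* (cong (ℤ._* + 1) (ℤ.pos-* m n)))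
      (ℚᵘ.≃-sym (ℚᵘ.≃-trans (toℚᵘ-homo-* (ι m) (ι n))
        (ℚᵘ.*-cong (toℚᵘ-fromℚᵘ (mkℚᵘ (+ m) 0)) (toℚᵘ-fromℚᵘ (mkℚᵘ (+ n) 0)))))))

ι-suc : ∀ n → ι (suc n) ≡ 1ℚ + ι n
ι-suc n = trans (ι-homo-+ 1 n) (cong (_+ ι n) (ι-# 1))

opaque
  unfolding ι

  /-*-cancel : ∀ z n .{{_ : ℕ.NonZero n}} → z / n * ι n ≡ z / 1
  /-*-cancel z n@(suc n-1) = toℚᵘ-injective (ℚᵘ.≃-trans (toℚᵘ-homo-* (z / n) (ι n))
    (ℚᵘ.≃-trans (ℚᵘ.*-cong (toℚᵘ-fromℚᵘ (mkℚᵘ z n-1)) (toℚᵘ-fromℚᵘ (mkℚᵘ (+ n) 0)))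
      (ℚᵘ.≃-trans (*≡* eq) (ℚᵘ.≃-sym (toℚᵘ-fromℚᵘ (mkℚᵘ z 0))))))
    where
    eq : z ℤ.* + n ℤ.* + 1 ≡ z ℤ.* + (n ℕ.* 1)
    eq = trans (ℤ.*-assoc z (+ n) (+ 1)) (cong (z ℤ.*_) (sym (ℤ.pos-* n 1)))

opaque
  -- The junk value is recip 0 = 0.
  recip : ℕ → ℚ
  recip zero      = 0ℚ
  recip n@(suc _) = + 1 / n

  recip-/ : ∀ n .{{_ : ℕ.NonZero n}} → recip n ≡ + 1 / n
  recip-/ (suc _) = refl

recip-inverse : ∀ n .{{_ : ℕ.NonZero n}} → ι n * recip n ≡ 1ℚ
recip-inverse n = trans (*-comm (ι n) (recip n)) (trans (cong (_* ι n) (recip-/ n)) (/-*-cancel (+ 1) n))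

ι-*-cancelˡ : ∀ n .{{_ : ℕ.NonZero n}} {x y} → ι n * x ≡ ι n * y → x ≡ y
ι-*-cancelˡ n {x} {y} eq = begin
  x                     ≡⟨ expand x ⟩
  recip n * (ι n * x)   ≡⟨ cong (recip n *_) eq ⟩
  recip n * (ι n * y)   ≡⟨ expand y ⟨
  y                     ∎
  where
  shuffle : ∀ a b x → a * b * x ≡ b * (a * x)
  shuffle = solve-∀ ring
  expand : ∀ x → x ≡ recip n * (ι n * x)
  expand x = trans (sym (*-identityˡ x)) (trans (cong (_* x) (sym (recip-inverse n))) (shuffle (ι n) (recip n) x))

-- Rising factorials

sgn : ℕ → ℚ
sgn zero    = 1ℚ
sgn (suc n) = - sgn n

sgn² : ∀ n → sgn n * sgn n ≡ 1ℚ
sgn² zero    = refl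
sgn² (suc n) = trans (neg² (sgn n)) (sgn² n)
  where
  neg² : ∀ x → - x * - x ≡ x * x
  neg² = solve-∀ ring

opaque
  poch : ℚ → ℕ → ℚ
  poch a zero    = 1ℚ
  poch a (suc n) = (a + ι n) * poch a n

  poch-zero : ∀ a → poch a 0 ≡ 1ℚ
  poch-zero a = refl

  poch-suc : ∀ a n → poch a (suc n) ≡ (a + ι n) * poch a n
  poch-suc a n = refl

  poch-+ : ∀ a m n → poch a (m ℕ.+ n) ≡ poch a m * poch (a + ι m) n
  poch-+ a m zero    = trans (cong (poch a) (ℕ.+-identityʳ m)) (sym (*-identityʳ (poch a m)))
  poch-+ a m (suc n) = begin
    poch a (m ℕ.+ suc n)                                ≡⟨ cong (poch a) (ℕ.+-suc m n) ⟩
    (a + ι (m ℕ.+ n)) * poch a (m ℕ.+ n)                ≡⟨ cong₂ (λ u v → (a + u) * v) (ι-homo-+ m n) (poch-+ a m n) ⟩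
    (a + (ι m + ι n)) * (poch a m * poch (a + ι m) n)   ≡⟨ shuffle a (ι m) (ι n) (poch a m) (poch (a + ι m) n) ⟩
    poch a m * ((a + ι m + ι n) * poch (a + ι m) n)     ∎
    where
    shuffle : ∀ a u v x y → (a + (u + v)) * (x * y) ≡ x * ((a + u + v) * y)
    shuffle = solve-∀ ring

  poch-suc-first : ∀ a n → poch a (suc n) ≡ a * poch (a + 1ℚ) n
  poch-suc-first a n = trans (poch-+ a 1 n) (cong₂ (λ u v → (a + u) * 1ℚ * poch (a + v) n) (ι-# 0) (ι-# 1) ⟨ trans ⟩ cong (_* poch (a + 1ℚ) n) (simp a))
    where
    simp : ∀ a → (a + 0ℚ) * 1ℚ ≡ a
    simp = solve-∀ ring

  -- Reverses the order of the factors and negates each of them. With 2m + 1 = p this turns factors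
  -- running up to a multiple of p/2 into factors of the form j + c p.
  poch-reflect : ∀ a n → poch a n ≡ sgn n * poch (1ℚ - a - ι n) n
  poch-reflect a zero    = refl
  poch-reflect a (suc n) = begin
    (a + ι n) * poch a n                              ≡⟨ cong ((a + ι n) *_) (poch-reflect a n) ⟩
    (a + ι n) * (sgn n * poch (1ℚ - a - ι n) n)       ≡⟨ cong (λ u → (a + ι n) * (sgn n * poch u n)) base ⟩
    (a + ι n) * (sgn n * poch (b + 1ℚ) n)             ≡⟨ shuffle a (ι n) (sgn n) (poch (b + 1ℚ) n) ⟩
    - sgn n * ((1ℚ - a - (1ℚ + ι n)) * poch (b + 1ℚ) n) ≡⟨ cong (λ u → - sgn n * ((1ℚ - a - u) * poch (b + 1ℚ) n)) (ι-suc n) ⟨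
    - sgn n * (b * poch (b + 1ℚ) n)                   ≡⟨ cong (- sgn n *_) (poch-suc-first b n) ⟨
    - sgn n * poch b (suc n)                          ∎
    where
    b : ℚ
    b = 1ℚ - a - ι (suc n)
    base′ : ∀ a u → 1ℚ - a - u ≡ 1ℚ - a - (1ℚ + u) + 1ℚ
    base′ = solve-∀ ring
    base : 1ℚ - a - ι n ≡ b + 1ℚ
    base = trans (base′ a (ι n)) (cong (λ u → 1ℚ - a - u + 1ℚ) (sym (ι-suc n)))
    shuffle : ∀ a u s x → (a + u) * (s * x) ≡ - s * ((1ℚ - a - (1ℚ + u)) * x)
    shuffle = solve-∀ ring

fact : ℕ → ℚ
fact = poch 1ℚ

half : ℕ → ℚ
half = poch ½

opaque
  -- Inverse factorials form a sequence of their own, so that a hypergeometric term is a product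
  -- without division and an index shift in a denominator is again a polynomial factor.
  rfact : ℕ → ℚ
  rfact zero    = 1ℚ
  rfact (suc n) = recip (suc n) * rfact n

  rfact-zero : rfact 0 ≡ 1ℚ
  rfact-zero = refl

  rfact-suc : ∀ n → rfact (suc n) ≡ recip (suc n) * rfact n
  rfact-suc n = refl

rfact-step : ∀ n → rfact n ≡ (1ℚ + ι n) * rfact (suc n)
rfact-step n = begin
  rfact n                                  ≡⟨ *-identityˡ (rfact n) ⟨
  1ℚ * rfact n                             ≡⟨ cong (_* rfact n) (recip-inverse (suc n)) ⟨
  ι (suc n) * recip (suc n) * rfact n      ≡⟨ *-assoc (ι (suc n)) (recip (suc n)) (rfact n) ⟩
  ι (suc n) * (recip (suc n) * rfact n)    ≡⟨ cong (ι (suc n) *_) (rfact-suc n) ⟨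
  ι (suc n) * rfact (suc n)                ≡⟨ cong (_* rfact (suc n)) (ι-suc n) ⟩
  (1ℚ + ι n) * rfact (suc n)               ∎

fact-inverse : ∀ n → fact n * rfact n ≡ 1ℚ
fact-inverse zero    = cong₂ _*_ (poch-zero 1ℚ) rfact-zero
fact-inverse (suc n) = begin
  fact (suc n) * rfact (suc n)             ≡⟨ cong (_* rfact (suc n)) (poch-suc 1ℚ n) ⟩
  (1ℚ + ι n) * fact n * rfact (suc n)      ≡⟨ shuffle (1ℚ + ι n) (fact n) (rfact (suc n)) ⟩
  fact n * ((1ℚ + ι n) * rfact (suc n))    ≡⟨ cong (fact n *_) (rfact-step n) ⟨
  fact n * rfact n                         ≡⟨ fact-inverse n ⟩
  1ℚ                                       ∎
  where
  shuffle : ∀ a b c → a * b * c ≡ b * (a * c)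
  shuffle = solve-∀ ring

-- A WZ pair

prod₈ : (a b c d e f g h : ℚ) → ℚ
prod₈ a b c d e f g h = a * b * c * d * (e * f * g * h)

-- The record keeps `s` and `a′` as separate indices that can be inferred; in a bare equation they
-- would be visible only through the product `s * a′`, which computes.
record Factor (a s a′ : ℚ) : Set where
  constructor factor
  field proof : a ≡ s * a′

factor-one : ∀ x → Factor x 1ℚ x
factor-one x = factor (sym (*-identityˡ x))

factor-trans : ∀ {a b c s t} → Factor a s b → Factor b t c → Factor a (s * t) c
factor-trans {c = c} {s} {t} (factor refl) (factor refl) = factor (sym (*-assoc s t c))

factor-≡ : ∀ {a b c s} → a ≡ b → Factor b s c → Factor a s c
factor-≡ refl f = f

-- Every comparison of two hypergeometric terms goes through this: both become multiples of one
-- common product, and a polynomial identity between the multipliers remains. Treating the factors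
-- in two blocks of four keeps the ring identities small.
prod₈-scale : ∀ {a a′ b b′ c c′ d d′ e e′ f f′ g g′ h h′ s t u v w x y z} →
  Factor a s a′ → Factor b t b′ → Factor c u c′ → Factor d v d′ → Factor e w e′ → Factor f x f′ → Factor g y g′ → Factor h z h′ →
  prod₈ a b c d e f g h ≡ prod₈ a′ b′ c′ d′ e′ f′ g′ h′ * (s * t * u * v * (w * x * y * z))
prod₈-scale {a′ = a} {b′ = b} {c′ = c} {d′ = d} {e′ = e} {f′ = f} {g′ = g} {h′ = h} {s} {t} {u} {v} {w} {x} {y} {z}
  (factor refl) (factor refl) (factor refl) (factor refl) (factor refl) (factor refl) (factor refl) (factor refl) =
  trans (cong₂ _*_ (inter₄ s t u v a b c d) (inter₄ w x y z e f g h))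
    (inter₂ (a * b * c * d) (e * f * g * h) (s * t * u * v) (w * x * y * z))
  where
  inter₄ : ∀ s t u v a b c d → s * a * (t * b) * (u * c) * (v * d) ≡ a * b * c * d * (s * t * u * v)
  inter₄ = solve-∀ ring
  inter₂ : ∀ x y s t → x * s * (y * t) ≡ x * y * (s * t)
  inter₂ = solve-∀ ring

-- With N = i + k this is
-- (3N)! (1/2)_N (1/2)_{N+k} (1/2)_{N-k} / ((2N+k)! (2N-k)! (N+k)! (N-k)!).
term : ℕ → ℕ → ℚ
term i k = prod₈ (fact (3 ℕ.* (i ℕ.+ k))) (half (i ℕ.+ k)) (half (i ℕ.+ 2 ℕ.* k)) (half i)
  (rfact (2 ℕ.* i ℕ.+ 3 ℕ.* k)) (rfact (2 ℕ.* i ℕ.+ k)) (rfact (i ℕ.+ 2 ℕ.* k)) (rfact i)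

ι-scale : ∀ a j → ι (a ℕ.* j) ≡ # a * ι j
ι-scale a j = trans (ι-homo-* a j) (cong (_* ι j) (ι-# a))

ι-lin : ∀ a b j k → ι (a ℕ.* j ℕ.+ b ℕ.* k) ≡ # a * ι j + # b * ι k
ι-lin a b j k = trans (ι-homo-+ (a ℕ.* j) (b ℕ.* k)) (cong₂ _+_ (ι-scale a j) (ι-scale b k))

ι-linˡ : ∀ a j k → ι (a ℕ.* j ℕ.+ k) ≡ # a * ι j + ι k
ι-linˡ a j k = trans (ι-homo-+ (a ℕ.* j) k) (cong (_+ ι k) (ι-scale a j))

ι-linʳ : ∀ b j k → ι (j ℕ.+ b ℕ.* k) ≡ ι j + # b * ι k
ι-linʳ b j k = trans (ι-homo-+ j (b ℕ.* k)) (cong (λ u → ι j + u) (ι-scale b k))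

ι-suc-≡ : ∀ n {x} → ι n ≡ x → ι (suc n) ≡ 1ℚ + x
ι-suc-≡ n refl = ι-suc n

ι-3N : ∀ j k → ι (3 ℕ.* (j ℕ.+ k)) ≡ # 3 * (ι j + ι k)
ι-3N j k = trans (ι-scale 3 (j ℕ.+ k)) (cong (# 3 *_) (ι-homo-+ j k))

poch-factor : ∀ a n {x} → ι n ≡ x → Factor (poch a (1 ℕ.+ n)) (a + x) (poch a n)
poch-factor a n refl = factor (poch-suc a n)

poch-factor₂ : ∀ a n {x} → ι n ≡ x → Factor (poch a (2 ℕ.+ n)) ((a + (1ℚ + x)) * (a + x)) (poch a n)
poch-factor₂ a n eq = factor-trans (poch-factor a (suc n) (ι-suc-≡ n eq)) (poch-factor a n eq)

poch-factor₃ : ∀ a n {x} → ι n ≡ x → Factor (poch a (3 ℕ.+ n)) ((a + (1ℚ + (1ℚ + x))) * ((a + (1ℚ + x)) * (a + x))) (poch a n)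
poch-factor₃ a n eq = factor-trans (poch-factor a (2 ℕ.+ n) (ι-suc-≡ (suc n) (ι-suc-≡ n eq))) (poch-factor₂ a n eq)

rfact-factor : ∀ n {x} → ι n ≡ x → Factor (rfact n) (1ℚ + x) (rfact (1 ℕ.+ n))
rfact-factor n refl = factor (rfact-step n)

rfact-factor₂ : ∀ n {x} → ι n ≡ x → Factor (rfact n) ((1ℚ + x) * (1ℚ + (1ℚ + x))) (rfact (2 ℕ.+ n))
rfact-factor₂ n eq = factor-trans (rfact-factor n eq) (rfact-factor (suc n) (ι-suc-≡ n eq))

-- Numerators of `term j k` over denominators of `term (suc j) k`; both terms, and the companion,
-- are polynomial multiples of it.
wzBase : ℕ → ℕ → ℚ
wzBase j k = prod₈ (fact (3 ℕ.* (j ℕ.+ k))) (half (j ℕ.+ k)) (half (j ℕ.+ 2 ℕ.* k)) (half j)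
  (rfact (2 ℕ.+ (2 ℕ.* j ℕ.+ 3 ℕ.* k))) (rfact (2 ℕ.+ (2 ℕ.* j ℕ.+ k))) (rfact (1 ℕ.+ (j ℕ.+ 2 ℕ.* k))) (rfact (suc j))

term-wzBase : ∀ j k → let J = ι j; K = ι k; x = # 2 * J + # 3 * K; y = # 2 * J + K; z = J + # 2 * K in
  term j k ≡ wzBase j k * (1ℚ * 1ℚ * 1ℚ * 1ℚ * ((1ℚ + x) * (1ℚ + (1ℚ + x)) * ((1ℚ + y) * (1ℚ + (1ℚ + y))) * (1ℚ + z) * (1ℚ + J)))
term-wzBase j k = prod₈-scale (factor-one (fact (3 ℕ.* (j ℕ.+ k)))) (factor-one (half (j ℕ.+ k))) (factor-one (half (j ℕ.+ 2 ℕ.* k))) (factor-one (half j))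
  (rfact-factor₂ (2 ℕ.* j ℕ.+ 3 ℕ.* k) (ι-lin 2 3 j k)) (rfact-factor₂ (2 ℕ.* j ℕ.+ k) (ι-linˡ 2 j k))
  (rfact-factor (j ℕ.+ 2 ℕ.* k) (ι-linʳ 2 j k)) (rfact-factor j refl)

term-suc-wzBase : ∀ j k → let J = ι j; K = ι k; x = # 3 * (J + K) in
  term (suc j) k ≡ wzBase j k * ((1ℚ + (1ℚ + (1ℚ + x))) * ((1ℚ + (1ℚ + x)) * (1ℚ + x)) * (½ + (J + K)) * (½ + (J + # 2 * K)) * (½ + J)
                                 * (1ℚ * 1ℚ * 1ℚ * 1ℚ))
term-suc-wzBase j k = prod₈-scale
  (factor-≡ (cong fact (eq₁ j k)) (poch-factor₃ 1ℚ (3 ℕ.* (j ℕ.+ k)) (ι-3N j k))) (poch-factor ½ (j ℕ.+ k) (ι-homo-+ j k))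
  (poch-factor ½ (j ℕ.+ 2 ℕ.* k) (ι-linʳ 2 j k)) (poch-factor ½ j refl)
  (factor-≡ (cong rfact (eq₂ j k)) (factor-one _)) (factor-≡ (cong rfact (eq₃ j k)) (factor-one _)) (factor-one (rfact (suc j ℕ.+ 2 ℕ.* k))) (factor-one (rfact (suc j)))
  where
  eq₁ : ∀ j k → 3 ℕ.* (suc j ℕ.+ k) ≡ 3 ℕ.+ 3 ℕ.* (j ℕ.+ k)
  eq₁ = ℕ.solve-∀
  eq₂ : ∀ j k → 2 ℕ.* suc j ℕ.+ 3 ℕ.* k ≡ 2 ℕ.+ (2 ℕ.* j ℕ.+ 3 ℕ.* k)
  eq₂ = ℕ.solve-∀
  eq₃ : ∀ j k → 2 ℕ.* suc j ℕ.+ k ≡ 2 ℕ.+ (2 ℕ.* j ℕ.+ k)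
  eq₃ = ℕ.solve-∀

-- Found by Gosper's algorithm applied to the k-dependence of
-- k term(N+1-k, k) - k term(N-k, k), as a polynomial in N and k.
wzPoly : ℚ → ℚ → ℚ
wzPoly N K = # 6 + # 37 * N + # 89 * (N * N) + # 100 * (N * N * N) + # 44 * (N * N * N * N)
  - # 10 * K + # 6 * (K * K) + # 8 * (K * K * K) - # 4 * (K * K * K * K)
  - # 38 * (N * K) + # 38 * (N * K * K) - # 32 * (N * N * K) + # 32 * (N * N * K * K)

wzCert : ℕ → ℕ → ℚ
wzCert j k = wzBase j k * ((½ + J) * (# 2 + (# 2 * J + # 3 * K)) * (1ℚ + (J + # 2 * K)) * (⅛ * wzPoly (J + K) K))
  where J = ι j; K = ι k

-- The companion at (N, k+1) with N = j + k, written over the base at (N, k). A separate form is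
-- needed because at `j = 0`, where k = N, the point (N, N+1) would have first index -1 in `wzCert`.
wzCertNext : ℕ → ℕ → ℚ
wzCertNext j k = wzBase j k * ((½ + (J + # 2 * K)) * (# 2 + (# 2 * J + K)) * (1ℚ + J) * (⅛ * wzPoly (J + K) (1ℚ + K)))
  where J = ι j; K = ι k

-- The WZ equation F(N+1,k) - F(N,k) = G(N,k) - G(N,k+1) for F = k h. Over the common base it is a
-- polynomial identity in j and k.
wzCert-step : ∀ j k → wzCert j k ≡ ι k * term (suc j) k - ι k * term j k + wzCertNext j k
wzCert-step j k = begin
  wzCert j k   ≡⟨ poly (ι j) (ι k) (wzBase j k) ⟩
  _            ≡⟨ cong₂ (λ u v → ι k * u - ι k * v + wzCertNext j k) (term-suc-wzBase j k) (term-wzBase j k) ⟨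
  ι k * term (suc j) k - ι k * term j k + wzCertNext j k ∎
  where
  poly : ∀ J K b →
    b * ((½ + J) * (# 2 + (# 2 * J + # 3 * K)) * (1ℚ + (J + # 2 * K)) * (⅛ *
      (# 6 + # 37 * (J + K) + # 89 * ((J + K) * (J + K)) + # 100 * ((J + K) * (J + K) * (J + K)) + # 44 * ((J + K) * (J + K) * (J + K) * (J + K))
      - # 10 * K + # 6 * (K * K) + # 8 * (K * K * K) - # 4 * (K * K * K * K)
      - # 38 * ((J + K) * K) + # 38 * ((J + K) * K * K) - # 32 * ((J + K) * (J + K) * K) + # 32 * ((J + K) * (J + K) * K * K))))
    ≡ K * (b * ((1ℚ + (1ℚ + (1ℚ + # 3 * (J + K)))) * ((1ℚ + (1ℚ + # 3 * (J + K))) * (1ℚ + # 3 * (J + K))) * (½ + (J + K)) * (½ + (J + # 2 * K)) * (½ + J)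
                * (1ℚ * 1ℚ * 1ℚ * 1ℚ)))
    - K * (b * (1ℚ * 1ℚ * 1ℚ * 1ℚ * ((1ℚ + (# 2 * J + # 3 * K)) * (1ℚ + (1ℚ + (# 2 * J + # 3 * K)))
                * ((1ℚ + (# 2 * J + K)) * (1ℚ + (1ℚ + (# 2 * J + K)))) * (1ℚ + (J + # 2 * K)) * (1ℚ + J))))
    + b * ((½ + (J + # 2 * K)) * (# 2 + (# 2 * J + K)) * (1ℚ + J) * (⅛ *
      (# 6 + # 37 * (J + K) + # 89 * ((J + K) * (J + K)) + # 100 * ((J + K) * (J + K) * (J + K)) + # 44 * ((J + K) * (J + K) * (J + K) * (J + K))
      - # 10 * (1ℚ + K) + # 6 * ((1ℚ + K) * (1ℚ + K)) + # 8 * ((1ℚ + K) * (1ℚ + K) * (1ℚ + K)) - # 4 * ((1ℚ + K) * (1ℚ + K) * (1ℚ + K) * (1ℚ + K))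
      - # 38 * ((J + K) * (1ℚ + K)) + # 38 * ((J + K) * (1ℚ + K) * (1ℚ + K)) - # 32 * ((J + K) * (J + K) * (1ℚ + K)) + # 32 * ((J + K) * (J + K) * (1ℚ + K) * (1ℚ + K)))))
  poly = solve-∀ ring

wzCertNext-suc : ∀ i k → wzCertNext (suc i) k ≡ wzCert i (suc k)
wzCertNext-suc i k = begin
  wzCertNext (suc i) k   ≡⟨ cong₂ next left (ι-suc i) ⟩
  -- Both sides evaluate `wzPoly` at the same point (N, k+1), so its value is passed as one variable
  -- and only the linear factors have to match.
  next (b * _) (1ℚ + ι i) ≡⟨ regroup b (ι i) (ι k) (wzPoly (ι i + (1ℚ + ι k)) (1ℚ + ι k)) _ (cong (λ u → ⅛ * wzPoly u (1ℚ + ι k)) (assoc (ι i) (ι k))) ⟩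
  cert (b * _) (1ℚ + ι k) ≡⟨ cong₂ cert right (ι-suc k) ⟨
  wzCert i (suc k)       ∎
  where
  next cert : ℚ → ℚ → ℚ
  next B J = B * ((½ + (J + # 2 * ι k)) * (# 2 + (# 2 * J + ι k)) * (1ℚ + J) * (⅛ * wzPoly (J + ι k) (1ℚ + ι k)))
  cert B K = B * ((½ + ι i) * (# 2 + (# 2 * ι i + # 3 * K)) * (1ℚ + (ι i + # 2 * K)) * (⅛ * wzPoly (ι i + K) K))
  n₁ n₂ n₃ : ℕ
  n₁ = 4 ℕ.+ (2 ℕ.* i ℕ.+ 3 ℕ.* k)
  n₂ = 3 ℕ.+ (2 ℕ.* i ℕ.+ k)
  n₃ = 2 ℕ.+ (i ℕ.+ 2 ℕ.* k)
  b : ℚ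
  b = prod₈ (fact (3 ℕ.* (suc i ℕ.+ k))) (half (suc i ℕ.+ k)) (half (1 ℕ.+ (i ℕ.+ 2 ℕ.* k))) (half i)
        (rfact (1 ℕ.+ n₁)) (rfact (1 ℕ.+ n₂)) (rfact (1 ℕ.+ n₃)) (rfact (2 ℕ.+ i))
  ιn₁ : ι n₁ ≡ # 4 + (# 2 * ι i + # 3 * ι k)
  ιn₁ = trans (ι-homo-+ 4 (2 ℕ.* i ℕ.+ 3 ℕ.* k)) (cong₂ _+_ (ι-# 4) (ι-lin 2 3 i k))
  ιn₂ : ι n₂ ≡ # 3 + (# 2 * ι i + ι k)
  ιn₂ = trans (ι-homo-+ 3 (2 ℕ.* i ℕ.+ k)) (cong₂ _+_ (ι-# 3) (ι-linˡ 2 i k))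
  ιn₃ : ι n₃ ≡ # 2 + (ι i + # 2 * ι k)
  ιn₃ = trans (ι-homo-+ 2 (i ℕ.+ 2 ℕ.* k)) (cong₂ _+_ (ι-# 2) (ι-linʳ 2 i k))
  e₁ : ∀ i k → 2 ℕ.+ (2 ℕ.* suc i ℕ.+ 3 ℕ.* k) ≡ 4 ℕ.+ (2 ℕ.* i ℕ.+ 3 ℕ.* k)
  e₁ = ℕ.solve-∀
  e₂ : ∀ i k → 2 ℕ.+ (2 ℕ.* suc i ℕ.+ k) ≡ 4 ℕ.+ (2 ℕ.* i ℕ.+ k)
  e₂ = ℕ.solve-∀
  e₃ : ∀ i k → 2 ℕ.+ (2 ℕ.* i ℕ.+ 3 ℕ.* suc k) ≡ 5 ℕ.+ (2 ℕ.* i ℕ.+ 3 ℕ.* k)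
  e₃ = ℕ.solve-∀
  e₄ : ∀ i k → 2 ℕ.+ (2 ℕ.* i ℕ.+ suc k) ≡ 3 ℕ.+ (2 ℕ.* i ℕ.+ k)
  e₄ = ℕ.solve-∀
  e₅ : ∀ i k → 1 ℕ.+ (i ℕ.+ 2 ℕ.* suc k) ≡ 3 ℕ.+ (i ℕ.+ 2 ℕ.* k)
  e₅ = ℕ.solve-∀
  e₆ : ∀ i k → i ℕ.+ 2 ℕ.* suc k ≡ 2 ℕ.+ (i ℕ.+ 2 ℕ.* k)
  e₆ = ℕ.solve-∀
  left : wzBase (suc i) k ≡ b * (1ℚ * 1ℚ * 1ℚ * (½ + ι i) * ((1ℚ + (# 4 + (# 2 * ι i + # 3 * ι k))) * 1ℚ * (1ℚ + (# 2 + (ι i + # 2 * ι k))) * 1ℚ))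
  left = prod₈-scale (factor-one (fact (3 ℕ.* (suc i ℕ.+ k)))) (factor-one (half (suc i ℕ.+ k))) (factor-one (half (suc i ℕ.+ 2 ℕ.* k)))
    (poch-factor ½ i refl) (factor-≡ (cong rfact (e₁ i k)) (rfact-factor n₁ ιn₁)) (factor-≡ (cong rfact (e₂ i k)) (factor-one _))
    (rfact-factor n₃ ιn₃) (factor-one (rfact (2 ℕ.+ i)))
  right : wzBase i (suc k) ≡ b * (1ℚ * 1ℚ * (½ + (1ℚ + (ι i + # 2 * ι k))) * 1ℚ * (1ℚ * (1ℚ + (# 3 + (# 2 * ι i + ι k))) * 1ℚ * (1ℚ + (1ℚ + ι i))))
  right = prod₈-scale (factor-≡ (cong (λ n → fact (3 ℕ.* n)) (ℕ.+-suc i k)) (factor-one _)) (factor-≡ (cong half (ℕ.+-suc i k)) (factor-one _))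
    (factor-≡ (cong half (e₆ i k)) (poch-factor ½ (1 ℕ.+ (i ℕ.+ 2 ℕ.* k)) (ι-suc-≡ (i ℕ.+ 2 ℕ.* k) (ι-linʳ 2 i k)))) (factor-one (half i))
    (factor-≡ (cong rfact (e₃ i k)) (factor-one _)) (factor-≡ (cong rfact (e₄ i k)) (rfact-factor n₂ ιn₂))
    (factor-≡ (cong rfact (e₅ i k)) (factor-one _)) (rfact-factor (suc i) (ι-suc i))
  assoc : ∀ I K → 1ℚ + I + K ≡ I + (1ℚ + K)
  assoc = solve-∀ ring
  regroup : ∀ b I K G G′ → G′ ≡ ⅛ * G →
    b * (1ℚ * 1ℚ * 1ℚ * (½ + I) * ((1ℚ + (# 4 + (# 2 * I + # 3 * K))) * 1ℚ * (1ℚ + (# 2 + (I + # 2 * K))) * 1ℚ))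
      * ((½ + (1ℚ + I + # 2 * K)) * (# 2 + (# 2 * (1ℚ + I) + K)) * (1ℚ + (1ℚ + I)) * G′)
    ≡ b * (1ℚ * 1ℚ * (½ + (1ℚ + (I + # 2 * K))) * 1ℚ * (1ℚ * (1ℚ + (# 3 + (# 2 * I + K))) * 1ℚ * (1ℚ + (1ℚ + I))))
      * ((½ + I) * (# 2 + (# 2 * I + # 3 * (1ℚ + K))) * (1ℚ + (I + # 2 * (1ℚ + K))) * (⅛ * G))
  regroup b I K G _ refl = poly b I K G
    where
    poly : ∀ b I K G →
      b * (1ℚ * 1ℚ * 1ℚ * (½ + I) * ((1ℚ + (# 4 + (# 2 * I + # 3 * K))) * 1ℚ * (1ℚ + (# 2 + (I + # 2 * K))) * 1ℚ))
        * ((½ + (1ℚ + I + # 2 * K)) * (# 2 + (# 2 * (1ℚ + I) + K)) * (1ℚ + (1ℚ + I)) * (⅛ * G))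
      ≡ b * (1ℚ * 1ℚ * (½ + (1ℚ + (I + # 2 * K))) * 1ℚ * (1ℚ * (1ℚ + (# 3 + (# 2 * I + K))) * 1ℚ * (1ℚ + (1ℚ + I))))
        * ((½ + I) * (# 2 + (# 2 * I + # 3 * (1ℚ + K))) * (1ℚ + (I + # 2 * (1ℚ + K))) * (⅛ * G))
    poly = solve-∀ ring

rfact-one : rfact 1 ≡ rfact 0
rfact-one = trans (rfact-suc 0) (trans (cong (_* rfact 0) (recip-/ 1)) (*-identityˡ (rfact 0)))

-- The boundary case of the telescoping: at k = N the companion does not vanish but equals (N+1)
-- h(N+1,N+1), which is exactly the summand that the sum for N+1 has in addition.
wzCertNext-zero : ∀ k → wzCertNext 0 k ≡ ι (suc k) * term 0 (suc k)
wzCertNext-zero k = begin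
  wzCertNext 0 k                 ≡⟨ cong₂ next left (ι-# 0) ⟩
  next (b * _) 0ℚ                ≡⟨ poly b (ι k) ⟩
  (1ℚ + ι k) * (b * _)           ≡⟨ cong₂ _*_ (ι-suc k) right ⟨
  ι (suc k) * term 0 (suc k)     ∎
  where
  next : ℚ → ℚ → ℚ
  next B J = B * ((½ + (J + # 2 * ι k)) * (# 2 + (# 2 * J + ι k)) * (1ℚ + J) * (⅛ * wzPoly (J + ι k) (1ℚ + ι k)))
  b : ℚ
  b = prod₈ (fact (3 ℕ.* k)) (half k) (half (2 ℕ.* k)) (half 0)
        (rfact (3 ℕ.+ 3 ℕ.* k)) (rfact (2 ℕ.+ k)) (rfact (2 ℕ.+ 2 ℕ.* k)) (rfact 0)
  e₁ : ∀ k → 3 ℕ.* suc k ≡ 3 ℕ.+ 3 ℕ.* k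
  e₁ = ℕ.solve-∀
  e₂ : ∀ k → 2 ℕ.* suc k ≡ 2 ℕ.+ 2 ℕ.* k
  e₂ = ℕ.solve-∀
  left : wzBase 0 k ≡ b * (1ℚ * 1ℚ * 1ℚ * 1ℚ * ((1ℚ + (1ℚ + (1ℚ + # 3 * ι k))) * 1ℚ * (1ℚ + (1ℚ + # 2 * ι k)) * 1ℚ))
  left = prod₈-scale (factor-one (fact (3 ℕ.* k))) (factor-one (half k)) (factor-one (half (2 ℕ.* k))) (factor-one (half 0))
    (rfact-factor (2 ℕ.+ 3 ℕ.* k) (ι-suc-≡ (1 ℕ.+ 3 ℕ.* k) (ι-suc-≡ (3 ℕ.* k) (ι-scale 3 k)))) (factor-one (rfact (2 ℕ.+ k)))
    (rfact-factor (1 ℕ.+ 2 ℕ.* k) (ι-suc-≡ (2 ℕ.* k) (ι-scale 2 k))) (factor-≡ rfact-one (factor-one (rfact 0)))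
  right : term 0 (suc k) ≡ b * ((1ℚ + (1ℚ + (1ℚ + # 3 * ι k))) * ((1ℚ + (1ℚ + # 3 * ι k)) * (1ℚ + # 3 * ι k)) * (½ + ι k)
            * ((½ + (1ℚ + # 2 * ι k)) * (½ + # 2 * ι k)) * 1ℚ * (1ℚ * (1ℚ + (1ℚ + ι k)) * 1ℚ * 1ℚ))
  right = prod₈-scale (factor-≡ (cong fact (e₁ k)) (poch-factor₃ 1ℚ (3 ℕ.* k) (ι-scale 3 k))) (poch-factor ½ k refl)
    (factor-≡ (cong half (e₂ k)) (poch-factor₂ ½ (2 ℕ.* k) (ι-scale 2 k))) (factor-one (half 0))
    (factor-≡ (cong rfact (e₁ k)) (factor-one _)) (rfact-factor (suc k) (ι-suc k))
    (factor-≡ (cong rfact (e₂ k)) (factor-one _)) (factor-one (rfact 0))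
  poly : ∀ b K →
    b * (1ℚ * 1ℚ * 1ℚ * 1ℚ * ((1ℚ + (1ℚ + (1ℚ + # 3 * K))) * 1ℚ * (1ℚ + (1ℚ + # 2 * K)) * 1ℚ))
      * ((½ + (0ℚ + # 2 * K)) * (# 2 + (# 2 * 0ℚ + K)) * (1ℚ + 0ℚ) * (⅛ *
      (# 6 + # 37 * (0ℚ + K) + # 89 * ((0ℚ + K) * (0ℚ + K)) + # 100 * ((0ℚ + K) * (0ℚ + K) * (0ℚ + K)) + # 44 * ((0ℚ + K) * (0ℚ + K) * (0ℚ + K) * (0ℚ + K))
      - # 10 * (1ℚ + K) + # 6 * ((1ℚ + K) * (1ℚ + K)) + # 8 * ((1ℚ + K) * (1ℚ + K) * (1ℚ + K)) - # 4 * ((1ℚ + K) * (1ℚ + K) * (1ℚ + K) * (1ℚ + K))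
      - # 38 * ((0ℚ + K) * (1ℚ + K)) + # 38 * ((0ℚ + K) * (1ℚ + K) * (1ℚ + K)) - # 32 * ((0ℚ + K) * (0ℚ + K) * (1ℚ + K)) + # 32 * ((0ℚ + K) * (0ℚ + K) * (1ℚ + K) * (1ℚ + K)))))
    ≡ (1ℚ + K) * (b * ((1ℚ + (1ℚ + (1ℚ + # 3 * K))) * ((1ℚ + (1ℚ + # 3 * K)) * (1ℚ + # 3 * K)) * (½ + K)
            * ((½ + (1ℚ + # 2 * K)) * (½ + # 2 * K)) * 1ℚ * (1ℚ * (1ℚ + (1ℚ + K)) * 1ℚ * 1ℚ)))
  poly = solve-∀ ring

-- diagSum i k = ∑ j * term (i + k - j) j over k ≤ j ≤ i + k.
diagSum : ℕ → ℕ → ℚ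
diagSum zero    k = ι k * term 0 k
diagSum (suc i) k = ι k * term (suc i) k + diagSum i (suc k)

-- The WZ equation summed along the antidiagonal, where the companion telescopes to its value at the
-- lower end. The lower end `k` is general for the sake of the induction; `k = 0` is the case
-- wanted.
diagSum-step : ∀ i k → diagSum (suc i) k ≡ diagSum i k + wzCert i k
diagSum-step zero    k = begin
  ι k * term 1 k + ι (suc k) * term 0 (suc k)
    ≡⟨ cong (λ u → ι k * term 1 k + u) (wzCertNext-zero k) ⟨
  ι k * term 1 k + wzCertNext 0 k
    ≡⟨ shuffle (ι k * term 1 k) (wzCertNext 0 k) (ι k * term 0 k) ⟩
  ι k * term 0 k + (ι k * term 1 k - ι k * term 0 k + wzCertNext 0 k)
    ≡⟨ cong (λ u → ι k * term 0 k + u) (wzCert-step 0 k) ⟨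
  ι k * term 0 k + wzCert 0 k ∎
  where
  shuffle : ∀ x y z → x + y ≡ z + (x - z + y)
  shuffle = solve-∀ ring
diagSum-step (suc i) k = begin
  ι k * term (2 ℕ.+ i) k + diagSum (suc i) (suc k)
    ≡⟨ cong (λ u → ι k * term (2 ℕ.+ i) k + u) (diagSum-step i (suc k)) ⟩
  ι k * term (2 ℕ.+ i) k + (diagSum i (suc k) + wzCert i (suc k))
    ≡⟨ cong (λ u → ι k * term (2 ℕ.+ i) k + (diagSum i (suc k) + u)) (wzCertNext-suc i k) ⟨
  ι k * term (2 ℕ.+ i) k + (diagSum i (suc k) + wzCertNext (suc i) k)
    ≡⟨ shuffle (ι k * term (2 ℕ.+ i) k) (diagSum i (suc k)) (wzCertNext (suc i) k) (ι k * term (suc i) k) ⟩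
  ι k * term (suc i) k + diagSum i (suc k) + (ι k * term (2 ℕ.+ i) k - ι k * term (suc i) k + wzCertNext (suc i) k)
    ≡⟨ cong (λ u → ι k * term (suc i) k + diagSum i (suc k) + u) (wzCert-step (suc i) k) ⟨
  ι k * term (suc i) k + diagSum i (suc k) + wzCert (suc i) k ∎
  where
  shuffle : ∀ x y z w → x + (y + z) ≡ w + y + (x - w + z)
  shuffle = solve-∀ ring

-- The exact identity for the partial sums

seriesTerm : ℕ → ℚ
seriesTerm n = (# 11 * ι n + # 3) * term n 0

-- At k = 0 the companion equals (11n+3) t(n) / 24 up to the forward difference of n t(n) / 3. That
-- difference telescopes as well and becomes the boundary term 8 N t(N).
seriesTerm-wz : ∀ n → # 24 * wzCert n 0 - # 8 * (ι (suc n) * term (suc n) 0) + # 8 * (ι n * term n 0) ≡ seriesTerm n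
seriesTerm-wz n = begin
  # 24 * wzCert n 0 - # 8 * (ι (suc n) * term (suc n) 0) + # 8 * (ι n * term n 0)
    ≡⟨ cong₂ (λ u v → # 24 * wzCert n 0 - # 8 * (u * term (suc n) 0) + # 8 * (ι n * v)) (ι-suc n) (term-wzBase n 0) ⟩
  # 24 * wzCert n 0 - # 8 * ((1ℚ + ι n) * term (suc n) 0) + # 8 * (ι n * (wzBase n 0 * den (ι 0)))
    ≡⟨ cong (λ u → # 24 * wzCert n 0 - # 8 * ((1ℚ + ι n) * u) + # 8 * (ι n * (wzBase n 0 * den (ι 0)))) (term-suc-wzBase n 0) ⟩
  # 24 * cert (ι 0) - # 8 * ((1ℚ + ι n) * (wzBase n 0 * num (ι 0))) + # 8 * (ι n * (wzBase n 0 * den (ι 0)))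
    -- `ι` is opaque, so `ι 0` has to become the literal `0ℚ` before an identity in `ι n` alone is
    -- left.
    ≡⟨ cong (λ K → # 24 * cert K - # 8 * ((1ℚ + ι n) * (wzBase n 0 * num K)) + # 8 * (ι n * (wzBase n 0 * den K))) (ι-# 0) ⟩
  # 24 * cert 0ℚ - # 8 * ((1ℚ + ι n) * (wzBase n 0 * num 0ℚ)) + # 8 * (ι n * (wzBase n 0 * den 0ℚ))
    ≡⟨ poly (wzBase n 0) (ι n) ⟩
  (# 11 * ι n + # 3) * (wzBase n 0 * den 0ℚ)
    ≡⟨ cong (λ K → (# 11 * ι n + # 3) * (wzBase n 0 * den K)) (ι-# 0) ⟨
  (# 11 * ι n + # 3) * (wzBase n 0 * den (ι 0))
    ≡⟨ cong ((# 11 * ι n + # 3) *_) (term-wzBase n 0) ⟨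
  seriesTerm n ∎
  where
  num den cert : ℚ → ℚ
  num K = (1ℚ + (1ℚ + (1ℚ + # 3 * (ι n + K)))) * ((1ℚ + (1ℚ + # 3 * (ι n + K))) * (1ℚ + # 3 * (ι n + K))) * (½ + (ι n + K)) * (½ + (ι n + # 2 * K)) * (½ + ι n)
                * (1ℚ * 1ℚ * 1ℚ * 1ℚ)
  den K = 1ℚ * 1ℚ * 1ℚ * 1ℚ * ((1ℚ + (# 2 * ι n + # 3 * K)) * (1ℚ + (1ℚ + (# 2 * ι n + # 3 * K)))
                * ((1ℚ + (# 2 * ι n + K)) * (1ℚ + (1ℚ + (# 2 * ι n + K)))) * (1ℚ + (ι n + # 2 * K)) * (1ℚ + ι n))
  cert K = wzBase n 0 * ((½ + ι n) * (# 2 + (# 2 * ι n + # 3 * K)) * (1ℚ + (ι n + # 2 * K)) * (⅛ * wzPoly (ι n + K) K))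
  poly : ∀ b N →
    # 24 * (b * ((½ + N) * (# 2 + (# 2 * N + # 3 * 0ℚ)) * (1ℚ + (N + # 2 * 0ℚ)) * (⅛ *
      (# 6 + # 37 * (N + 0ℚ) + # 89 * ((N + 0ℚ) * (N + 0ℚ)) + # 100 * ((N + 0ℚ) * (N + 0ℚ) * (N + 0ℚ)) + # 44 * ((N + 0ℚ) * (N + 0ℚ) * (N + 0ℚ) * (N + 0ℚ))
      - # 10 * 0ℚ + # 6 * (0ℚ * 0ℚ) + # 8 * (0ℚ * 0ℚ * 0ℚ) - # 4 * (0ℚ * 0ℚ * 0ℚ * 0ℚ)
      - # 38 * ((N + 0ℚ) * 0ℚ) + # 38 * ((N + 0ℚ) * 0ℚ * 0ℚ) - # 32 * ((N + 0ℚ) * (N + 0ℚ) * 0ℚ) + # 32 * ((N + 0ℚ) * (N + 0ℚ) * 0ℚ * 0ℚ)))))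
    - # 8 * ((1ℚ + N) * (b * ((1ℚ + (1ℚ + (1ℚ + # 3 * (N + 0ℚ)))) * ((1ℚ + (1ℚ + # 3 * (N + 0ℚ))) * (1ℚ + # 3 * (N + 0ℚ))) * (½ + (N + 0ℚ)) * (½ + (N + # 2 * 0ℚ)) * (½ + N)
                * (1ℚ * 1ℚ * 1ℚ * 1ℚ))))
    + # 8 * (N * (b * (1ℚ * 1ℚ * 1ℚ * 1ℚ * ((1ℚ + (# 2 * N + # 3 * 0ℚ)) * (1ℚ + (1ℚ + (# 2 * N + # 3 * 0ℚ)))
                * ((1ℚ + (# 2 * N + 0ℚ)) * (1ℚ + (1ℚ + (# 2 * N + 0ℚ)))) * (1ℚ + (N + # 2 * 0ℚ)) * (1ℚ + N)))))
    ≡ (# 11 * N + # 3) * (b * (1ℚ * 1ℚ * 1ℚ * 1ℚ * ((1ℚ + (# 2 * N + # 3 * 0ℚ)) * (1ℚ + (1ℚ + (# 2 * N + # 3 * 0ℚ)))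
                * ((1ℚ + (# 2 * N + 0ℚ)) * (1ℚ + (1ℚ + (# 2 * N + 0ℚ)))) * (1ℚ + (N + # 2 * 0ℚ)) * (1ℚ + N))))
  poly = solve-∀ ring

-- `sumTo` includes its upper end, hence the index N = n + 1 on the right.
sumTo-seriesTerm : ∀ n → sumTo n seriesTerm ≡ # 24 * diagSum (suc n) 0 - # 8 * (ι (suc n) * term (suc n) 0)
sumTo-seriesTerm zero = begin
  seriesTerm 0
    ≡⟨ seriesTerm-wz 0 ⟨
  # 24 * wzCert 0 0 - r + # 8 * (ι 0 * term 0 0)
    ≡⟨ cong (λ u → # 24 * wzCert 0 0 - r + # 8 * (u * term 0 0)) (ι-# 0) ⟩
  # 24 * wzCert 0 0 - r + # 8 * (0ℚ * term 0 0)
    ≡⟨ shuffle (wzCert 0 0) r (term 0 0) ⟩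
  # 24 * (0ℚ * term 0 0 + wzCert 0 0) - r
    ≡⟨ cong (λ u → # 24 * (u * term 0 0 + wzCert 0 0) - r) (ι-# 0) ⟨
  # 24 * (ι 0 * term 0 0 + wzCert 0 0) - r
    ≡⟨ cong (λ u → # 24 * u - r) (diagSum-step 0 0) ⟨
  # 24 * diagSum 1 0 - r ∎
  where
  r = # 8 * (ι 1 * term 1 0)
  shuffle : ∀ c r t → # 24 * c - r + # 8 * (0ℚ * t) ≡ # 24 * (0ℚ * t + c) - r
  shuffle = solve-∀ ring
sumTo-seriesTerm (suc n) = begin
  sumTo n seriesTerm + seriesTerm (suc n)
    ≡⟨ cong₂ _+_ (sumTo-seriesTerm n) (sym (seriesTerm-wz (suc n))) ⟩
  # 24 * diagSum (suc n) 0 - x + (# 24 * wzCert (suc n) 0 - y + x)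
    ≡⟨ shuffle (diagSum (suc n) 0) (wzCert (suc n) 0) x y ⟩
  # 24 * (diagSum (suc n) 0 + wzCert (suc n) 0) - y
    ≡⟨ cong (λ u → # 24 * u - y) (diagSum-step (suc n) 0) ⟨
  # 24 * diagSum (2 ℕ.+ n) 0 - y ∎
  where
  x = # 8 * (ι (suc n) * term (suc n) 0)
  y = # 8 * (ι (2 ℕ.+ n) * term (2 ℕ.+ n) 0)
  shuffle : ∀ d c x y → # 24 * d - x + (# 24 * c - y + x) ≡ # 24 * (d + c) - y
  shuffle = solve-∀ ring

-- The binomial summand in terms of rising factorials

ι-! : ∀ n → ι (n !) ≡ fact n
ι-! zero    = trans (ι-# 1) (sym (poch-zero 1ℚ))
ι-! (suc n) = begin
  ι (suc n ℕ.* n !)      ≡⟨ ι-homo-* (suc n) (n !) ⟩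
  ι (suc n) * ι (n !)    ≡⟨ cong₂ _*_ (ι-suc n) (ι-! n) ⟩
  (1ℚ + ι n) * fact n    ≡⟨ poch-suc 1ℚ n ⟨
  fact (suc n)           ∎

C-*-!-*-! : ∀ m n → ((m ℕ.+ n) C m) ℕ.* (m ! ℕ.* n !) ≡ (m ℕ.+ n) !
C-*-!-*-! m n = begin
  ((m ℕ.+ n) C m) ℕ.* (m ! ℕ.* n !)                  ≡⟨ cong (λ l → ((m ℕ.+ n) C m) ℕ.* (m ! ℕ.* l !)) (ℕ.m+n∸m≡n m n) ⟨
  ((m ℕ.+ n) C m) ℕ.* (m ! ℕ.* (m ℕ.+ n ℕ.∸ m) !)    ≡⟨ cong (ℕ._* (m ! ℕ.* (m ℕ.+ n ℕ.∸ m) !)) (nCk≡n!/k![n-k]! (ℕ.m≤m+n m n)) ⟩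
  _                                                ≡⟨ ℕ.m/n*n≡m {{m ℕ.!* (m ℕ.+ n ℕ.∸ m) !≢0}} (k![n∸k]!∣n! (ℕ.m≤m+n m n)) ⟩
  (m ℕ.+ n) !                                      ∎

ι-C : ∀ m n → ι ((m ℕ.+ n) C m) ≡ fact (m ℕ.+ n) * (rfact m * rfact n)
ι-C m n = begin
  c                                              ≡⟨ *-identityʳ c ⟨
  c * (1ℚ * 1ℚ)                                  ≡⟨ cong₂ (λ u v → c * (u * v)) (fact-inverse m) (fact-inverse n) ⟨
  c * (fact m * rfact m * (fact n * rfact n))    ≡⟨ shuffle c (fact m) (rfact m) (fact n) (rfact n) ⟩
  c * (fact m * fact n) * (rfact m * rfact n)    ≡⟨ cong (_* (rfact m * rfact n)) eq ⟩
  fact (m ℕ.+ n) * (rfact m * rfact n)           ∎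
  where
  c = ι ((m ℕ.+ n) C m)
  shuffle : ∀ c a b d e → c * (a * b * (d * e)) ≡ c * (a * d) * (b * e)
  shuffle = solve-∀ ring
  eq : c * (fact m * fact n) ≡ fact (m ℕ.+ n)
  eq = begin
    c * (fact m * fact n)                      ≡⟨ cong₂ (λ u v → c * (u * v)) (ι-! m) (ι-! n) ⟨
    c * (ι (m !) * ι (n !))                    ≡⟨ cong (c *_) (ι-homo-* (m !) (n !)) ⟨
    c * ι (m ! ℕ.* n !)                        ≡⟨ ι-homo-* ((m ℕ.+ n) C m) (m ! ℕ.* n !) ⟨
    ι (((m ℕ.+ n) C m) ℕ.* (m ! ℕ.* n !))        ≡⟨ cong ι (C-*-!-*-! m n) ⟩
    ι ((m ℕ.+ n) !)                            ≡⟨ ι-! (m ℕ.+ n) ⟩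
    fact (m ℕ.+ n)                             ∎

-- The odd factors of (2n)! make up (1/2)_n and the even ones n!, each with a factor 2ⁿ. Besides
-- converting the summand this later relates 2^(p-1) to harmonic sums.
4^n*half*fact : ∀ n → ι (4 ℕ.^ n) * half n * fact n ≡ fact (2 ℕ.* n)
4^n*half*fact zero    = begin
  ι 1 * half 0 * fact 0   ≡⟨ cong₂ (λ u v → ι 1 * u * v) (poch-zero ½) (poch-zero 1ℚ) ⟩
  ι 1 * 1ℚ * 1ℚ           ≡⟨ cong (λ u → u * 1ℚ * 1ℚ) (ι-# 1) ⟩
  1ℚ                      ≡⟨ poch-zero 1ℚ ⟨
  fact 0                  ∎
4^n*half*fact (suc n) = begin
  ι (4 ℕ.* 4 ℕ.^ n) * half (suc n) * fact (suc n)
    ≡⟨ cong₂ (λ u v → u * half (suc n) * v) (ι-scale 4 (4 ℕ.^ n)) (poch-suc 1ℚ n) ⟩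
  # 4 * ι (4 ℕ.^ n) * half (suc n) * ((1ℚ + ι n) * fact n)
    ≡⟨ cong (λ u → # 4 * ι (4 ℕ.^ n) * u * ((1ℚ + ι n) * fact n)) (poch-suc ½ n) ⟩
  # 4 * ι (4 ℕ.^ n) * ((½ + ι n) * half n) * ((1ℚ + ι n) * fact n)
    ≡⟨ shuffle (ι n) (ι (4 ℕ.^ n)) (half n) (fact n) ⟩
  (1ℚ + (1ℚ + # 2 * ι n)) * (1ℚ + # 2 * ι n) * (ι (4 ℕ.^ n) * half n * fact n)
    ≡⟨ cong ((1ℚ + (1ℚ + # 2 * ι n)) * (1ℚ + # 2 * ι n) *_) (4^n*half*fact n) ⟩
  (1ℚ + (1ℚ + # 2 * ι n)) * (1ℚ + # 2 * ι n) * fact (2 ℕ.* n)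
    ≡⟨ Factor.proof (poch-factor₂ 1ℚ (2 ℕ.* n) (ι-scale 2 n)) ⟨
  fact (2 ℕ.+ 2 ℕ.* n)
    ≡⟨ cong fact (eq n) ⟨
  fact (2 ℕ.* suc n) ∎
  where
  eq : ∀ n → 2 ℕ.* suc n ≡ 2 ℕ.+ 2 ℕ.* n
  eq = ℕ.solve-∀
  shuffle : ∀ N c h f → # 4 * c * ((½ + N) * h) * ((1ℚ + N) * f) ≡ (1ℚ + (1ℚ + # 2 * N)) * (1ℚ + # 2 * N) * (c * h * f)
  shuffle = solve-∀ ring

/-recip : ∀ a n .{{_ : ℕ.NonZero n}} → + a / n ≡ ι a * recip n
/-recip a n = ι-*-cancelˡ n (begin
  ι n * (+ a / n)        ≡⟨ *-comm (ι n) (+ a / n) ⟩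
  + a / n * ι n          ≡⟨ /-*-cancel (+ a) n ⟩
  fromℕ a                ≡⟨ ι-fromℕ a ⟨
  ι a                    ≡⟨ *-identityˡ (ι a) ⟨
  1ℚ * ι a               ≡⟨ cong (_* ι a) (recip-inverse n) ⟨
  ι n * recip n * ι a    ≡⟨ shuffle (ι n) (recip n) (ι a) ⟩
  ι n * (ι a * recip n)  ∎)
  where
  shuffle : ∀ x y z → x * y * z ≡ x * (z * y)
  shuffle = solve-∀ ring

-- 64 = 4³: each of the three half-integer products in `term n 0` absorbs one factor 4⁻ⁿ.
recip-64^ : ∀ n → let e = recip (4 ℕ.^ n) in recip (64 ℕ.^ n) ≡ e * e * e
recip-64^ n = ι-*-cancelˡ (64 ℕ.^ n) {{ℕ.m^n≢0 64 n}} (begin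
  ι (64 ℕ.^ n) * recip (64 ℕ.^ n)   ≡⟨ recip-inverse (64 ℕ.^ n) {{ℕ.m^n≢0 64 n}} ⟩
  1ℚ * 1ℚ * 1ℚ                      ≡⟨ cong (λ u → u * u * u) (recip-inverse (4 ℕ.^ n) {{ℕ.m^n≢0 4 n}}) ⟨
  x * e * (x * e) * (x * e)         ≡⟨ shuffle x e ⟩
  x * (x * x) * (e * e * e)         ≡⟨ cong (_* (e * e * e)) eq ⟨
  ι (64 ℕ.^ n) * (e * e * e)        ∎)
  where
  x = ι (4 ℕ.^ n)
  e = recip (4 ℕ.^ n)
  shuffle : ∀ x e → x * e * (x * e) * (x * e) ≡ x * (x * x) * (e * e * e)
  shuffle = solve-∀ ring
  eq : ι (64 ℕ.^ n) ≡ x * (x * x)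
  eq = begin
    ι ((4 ℕ.^ 3) ℕ.^ n)                            ≡⟨ cong ι (ℕ.^-*-assoc 4 3 n) ⟩
    ι (4 ℕ.^ (n ℕ.+ (n ℕ.+ (n ℕ.+ 0))))            ≡⟨ cong (λ u → ι (4 ℕ.^ (n ℕ.+ (n ℕ.+ u)))) (ℕ.+-identityʳ n) ⟩
    ι (4 ℕ.^ (n ℕ.+ (n ℕ.+ n)))                    ≡⟨ cong ι (ℕ.^-distribˡ-+-* 4 n (n ℕ.+ n)) ⟩
    ι (4 ℕ.^ n ℕ.* 4 ℕ.^ (n ℕ.+ n))                ≡⟨ cong (λ u → ι (4 ℕ.^ n ℕ.* u)) (ℕ.^-distribˡ-+-* 4 n n) ⟩
    ι (4 ℕ.^ n ℕ.* (4 ℕ.^ n ℕ.* 4 ℕ.^ n))          ≡⟨ ι-homo-* (4 ℕ.^ n) (4 ℕ.^ n ℕ.* 4 ℕ.^ n) ⟩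
    x * ι (4 ℕ.^ n ℕ.* 4 ℕ.^ n)                    ≡⟨ cong (x *_) (ι-homo-* (4 ℕ.^ n) (4 ℕ.^ n)) ⟩
    x * (x * x)                                    ∎

term-zero : ∀ n → term n 0 ≡ fact (3 ℕ.* n) * (half n * half n * half n) * (rfact (2 ℕ.* n) * rfact (2 ℕ.* n) * rfact n * rfact n)
term-zero n = begin
  term n 0
    ≡⟨ cong₂ (λ u v → prod₈ (fact (3 ℕ.* u)) (half u) (half u) (half n) (rfact v) (rfact v) (rfact u) (rfact n)) (ℕ.+-identityʳ n) (ℕ.+-identityʳ (2 ℕ.* n)) ⟩
  prod₈ (fact (3 ℕ.* n)) (half n) (half n) (half n) (rfact (2 ℕ.* n)) (rfact (2 ℕ.* n)) (rfact n) (rfact n)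
    ≡⟨ shuffle (fact (3 ℕ.* n)) (half n) (rfact (2 ℕ.* n)) (rfact n) ⟩
  _ ∎
  where
  shuffle : ∀ f h r s → f * h * h * h * (r * r * s * s) ≡ f * (h * h * h) * (r * r * s * s)
  shuffle = solve-∀ ring

half-recip : ∀ n → half n ≡ recip (4 ℕ.^ n) * fact (2 ℕ.* n) * rfact n
half-recip n = begin
  half n                                   ≡⟨ trans (cong (_* half n) (*-identityˡ 1ℚ)) (*-identityˡ (half n)) ⟨
  1ℚ * 1ℚ * half n                         ≡⟨ cong₂ (λ u v → u * v * half n) (recip-inverse (4 ℕ.^ n) {{ℕ.m^n≢0 4 n}}) (fact-inverse n) ⟨
  x * e * (fact n * rfact n) * half n      ≡⟨ shuffle x e (fact n) (rfact n) (half n) ⟩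
  e * (x * half n * fact n) * rfact n      ≡⟨ cong (λ u → e * u * rfact n) (4^n*half*fact n) ⟩
  e * fact (2 ℕ.* n) * rfact n             ∎
  where
  x = ι (4 ℕ.^ n)
  e = recip (4 ℕ.^ n)
  shuffle : ∀ x e f r h → x * e * (f * r) * h ≡ e * (x * h * f) * r
  shuffle = solve-∀ ring

summand-seriesTerm : ∀ n → summand n ≡ seriesTerm n
summand-seriesTerm n = begin
  summand n
    ≡⟨ cong₂ _*_ (cong₂ _*_ coeff binom₂²) binom₃ ⟩
  k * (e * e * e) * (f₂ * (r * r) * (f₂ * (r * r))) * (f₃ * (r * s))
    ≡⟨ *-identityʳ _ ⟨
  k * (e * e * e) * (f₂ * (r * r) * (f₂ * (r * r))) * (f₃ * (r * s)) * 1ℚ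
    -- The three half-integer products need (2n)! cubed, whereas the two central binomials supply
    -- only its square; the factor 1 = (2n)! / (2n)! provides the third.
    ≡⟨ cong (k * (e * e * e) * (f₂ * (r * r) * (f₂ * (r * r))) * (f₃ * (r * s)) *_) (fact-inverse (2 ℕ.* n)) ⟨
  k * (e * e * e) * (f₂ * (r * r) * (f₂ * (r * r))) * (f₃ * (r * s)) * (f₂ * s)
    ≡⟨ regroup k e f₂ f₃ r s ⟩
  k * (f₃ * (e * f₂ * r * (e * f₂ * r) * (e * f₂ * r)) * (s * s * r * r))
    ≡⟨ cong (λ h → k * (f₃ * (h * h * h) * (s * s * r * r))) (half-recip n) ⟨
  k * (f₃ * (half n * half n * half n) * (s * s * r * r))
    ≡⟨ cong (k *_) (term-zero n) ⟨
  seriesTerm n ∎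
  where
  instance _ = ℕ.m^n≢0 64 n
  k = # 11 * ι n + # 3
  e = recip (4 ℕ.^ n)
  f₂ = fact (2 ℕ.* n)
  f₃ = fact (3 ℕ.* n)
  r = rfact n
  s = rfact (2 ℕ.* n)
  coeff : + (11 ℕ.* n ℕ.+ 3) / (64 ℕ.^ n) ≡ k * (e * e * e)
  coeff = trans (/-recip (11 ℕ.* n ℕ.+ 3) (64 ℕ.^ n)) (cong₂ _*_
    (trans (ι-linˡ 11 n 3) (cong (λ u → # 11 * ι n + u) (ι-# 3))) (recip-64^ n))
  e₂ : ∀ n → 2 ℕ.* n ≡ n ℕ.+ n
  e₂ = ℕ.solve-∀
  e₃ : ∀ n → 3 ℕ.* n ≡ n ℕ.+ 2 ℕ.* n
  e₃ = ℕ.solve-∀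
  binom₂ : ι ((2 ℕ.* n) C n) ≡ f₂ * (r * r)
  binom₂ = subst (λ l → ι (l C n) ≡ fact l * (r * r)) (sym (e₂ n)) (ι-C n n)
  binom₂² : fromℕ (((2 ℕ.* n) C n) ℕ.^ 2) ≡ f₂ * (r * r) * (f₂ * (r * r))
  binom₂² = begin
    fromℕ (c ℕ.^ 2)      ≡⟨ ι-fromℕ (c ℕ.^ 2) ⟨
    ι (c ℕ.* (c ℕ.* 1))  ≡⟨ cong (λ u → ι (c ℕ.* u)) (ℕ.*-identityʳ c) ⟩
    ι (c ℕ.* c)          ≡⟨ ι-homo-* c c ⟩
    ι c * ι c            ≡⟨ cong (λ u → u * u) binom₂ ⟩
    _                    ∎
    where c = (2 ℕ.* n) C n
  binom₃ : fromℕ ((3 ℕ.* n) C n) ≡ f₃ * (r * s)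
  binom₃ = trans (sym (ι-fromℕ ((3 ℕ.* n) C n)))
    (subst (λ l → ι (l C n) ≡ fact l * (r * s)) (sym (e₃ n)) (ι-C n (2 ℕ.* n)))
  regroup : ∀ k e f₂ f₃ r s → k * (e * e * e) * (f₂ * (r * r) * (f₂ * (r * r))) * (f₃ * (r * s)) * (f₂ * s)
    ≡ k * (f₃ * (e * f₂ * r * (e * f₂ * r) * (e * f₂ * r)) * (s * s * r * r))
  regroup = solve-∀ ring

sumTo-cong : ∀ {f g : ℕ → ℚ} → (∀ n → f n ≡ g n) → ∀ n → sumTo n f ≡ sumTo n g
sumTo-cong eq zero    = eq 0
sumTo-cong eq (suc n) = cong₂ _+_ (sumTo-cong eq n) (eq (suc n))

sumTo-summand : ∀ n → sumTo n summand ≡ # 24 * diagSum (suc n) 0 - # 8 * (ι (suc n) * term (suc n) 0)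
sumTo-summand n = trans (sumTo-cong summand-seriesTerm n) (sumTo-seriesTerm n)

-- The local ring at p

↧ₙ-/-∣ : ∀ i n .{{_ : ℕ.NonZero n}} → ↧ₙ (i / n) ∣ n
↧ₙ-/-∣ i n = divides ℤ.∣ gcd i (+ n) ∣ (sym (begin
  ℤ.∣ gcd i (+ n) ∣ ℕ.* ↧ₙ (i / n)         ≡⟨ ℕ.*-comm ℤ.∣ gcd i (+ n) ∣ (↧ₙ (i / n)) ⟩
  ℤ.∣ ↧ (i / n) ∣ ℕ.* ℤ.∣ gcd i (+ n) ∣    ≡⟨ ℤ.abs-* (↧ (i / n)) (gcd i (+ n)) ⟨
  ℤ.∣ ↧ (i / n) ℤ.* gcd i (+ n) ∣          ≡⟨ cong ℤ.∣_∣ (↧-/ i n) ⟩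
  n                                        ∎))

↧ₙ-+-∣ : ∀ x y → ↧ₙ (x + y) ∣ ↧ₙ x ℕ.* ↧ₙ y
↧ₙ-+-∣ x@record{} y@record{} = ↧ₙ-/-∣ (↥ x ℤ.* ↧ y ℤ.+ ↥ y ℤ.* ↧ x) (↧ₙ x ℕ.* ↧ₙ y)

↧ₙ-*-∣ : ∀ x y → ↧ₙ (x * y) ∣ ↧ₙ x ℕ.* ↧ₙ y
↧ₙ-*-∣ x@record{} y@record{} = ↧ₙ-/-∣ (↥ x ℤ.* ↥ y) (↧ₙ x ℕ.* ↧ₙ y)

module Local (p : ℕ) (pr : Prime p) where

  π : ℚ
  π = ι p

  ∤-* : ∀ {m n} → ¬ p ∣ m → ¬ p ∣ n → ¬ p ∣ m ℕ.* n
  ∤-* {m} {n} ∤m ∤n p∣mn = [ ∤m , ∤n ]′ (euclidsLemma m n pr p∣mn)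

  ∤-1 : ¬ p ∣ 1
  ∤-1 p∣1 = contradiction (ℕ.∣1⇒≡1 p∣1) (ℕ.nonTrivial⇒≢1 {{prime⇒nonTrivial pr}})

  ∤-< : ∀ {n} .{{_ : ℕ.NonZero n}} → n ℕ.< p → ¬ p ∣ n
  ∤-< n<p p∣n = ℕ.<⇒≱ n<p (ℕ.∣⇒≤ p∣n)

  ∤-+ : ∀ {n} → ¬ p ∣ n → ¬ p ∣ p ℕ.+ n
  ∤-+ ∤n p∣p+n = ∤n (ℕ.∣m+n∣m⇒∣n p∣p+n ℕ.∣-refl)

  -- Membership in the local ring, stated as non-divisibility of the denominator: by Euclid's lemma
  -- this form passes to products of denominators. `O⇒Integral` returns to coprimality.
  record O (x : ℚ) : Set where
    constructor mkO
    field ∤↧ : ¬ p ∣ ↧ₙ x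

  infixl 6 _⊕_ _⊖_
  infixl 7 _⊗_

  _⊕_ : ∀ {x y} → O x → O y → O (x + y)
  _⊕_ {x} {y} (mkO a) (mkO b) = mkO (λ d → ∤-* a b (∣-trans d (↧ₙ-+-∣ x y)))

  _⊗_ : ∀ {x y} → O x → O y → O (x * y)
  _⊗_ {x} {y} (mkO a) (mkO b) = mkO (λ d → ∤-* a b (∣-trans d (↧ₙ-*-∣ x y)))

  ⊝_ : ∀ {x} → O x → O (- x)
  ⊝_ {x} (mkO a) = mkO (λ d → a (subst (p ∣_) (cong ℤ.∣_∣ (↧-neg x)) d))

  _⊖_ : ∀ {x y} → O x → O y → O (x - y)
  a ⊖ b = a ⊕ (⊝ b)

  O-/ : ∀ i n .{{_ : ℕ.NonZero n}} → ¬ p ∣ n → O (i / n)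
  O-/ i n ∤n = mkO (λ d → ∤n (∣-trans d (↧ₙ-/-∣ i n)))

  O-# : ∀ n → O (# n)
  O-# n = mkO ∤-1

  O-1 : O 1ℚ
  O-1 = O-# 1

  O-ι : ∀ n → O (ι n)
  O-ι n = subst O (sym (ι-# n)) (O-# n)

  O-recip : ∀ n .{{_ : ℕ.NonZero n}} → ¬ p ∣ n → O (recip n)
  O-recip n ∤n = subst O (sym (recip-/ n)) (O-/ (+ 1) n ∤n)

  O-poch : ∀ {a} n → O a → O (poch a n)
  O-poch {a} zero    oa = subst O (sym (poch-zero a)) O-1
  O-poch {a} (suc n) oa = subst O (sym (poch-suc a n)) ((oa ⊕ O-ι n) ⊗ O-poch n oa)

  O-rfact : ∀ n → n ℕ.< p → O (rfact n)
  O-rfact zero    _   = subst O (sym rfact-zero) O-1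
  O-rfact (suc n) n<p = subst O (sym (rfact-suc n)) (O-recip (suc n) (∤-< n<p) ⊗ O-rfact n (ℕ.<-trans (ℕ.n<1+n n) n<p))

  O-sgn : ∀ n → O (sgn n)
  O-sgn zero    = O-1
  O-sgn (suc n) = ⊝ O-sgn n

  O⇒Integral : ∀ {x} → O x → Integral p x
  O⇒Integral (mkO ∤d) {d} (d∣x , d∣p) with prime⇒irreducible pr d∣p
  ... | inj₁ d≡1  = d≡1
  ... | inj₂ refl = contradiction d∣x ∤d

  π^_ : ℕ → ℚ
  π^ zero  = 1ℚ
  π^ suc j = π * (π^ j)

  ι-^ : ∀ j → fromℕ (p ℕ.^ j) ≡ π^ j
  ι-^ j = trans (sym (ι-fromℕ (p ℕ.^ j))) (go j)
    where
    go : ∀ j → ι (p ℕ.^ j) ≡ π^ j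
    go zero    = ι-# 1
    go (suc j) = trans (ι-homo-* p (p ℕ.^ j)) (cong (π *_) (go j))

  record Div (j : ℕ) (x : ℚ) : Set where
    constructor mkDiv
    field
      {quotient} : ℚ
      integral   : O quotient
      proof      : x ≡ π^ j * quotient

  Div-≡ : ∀ {j x y} → x ≡ y → Div j x → Div j y
  Div-≡ refl d = d

  Div-+ : ∀ {j x y} → Div j x → Div j y → Div j (x + y)
  Div-+ {j} (mkDiv {a} oa refl) (mkDiv {b} ob refl) = mkDiv (oa ⊕ ob) (sym (*-distribˡ-+ (π^ j) a b))

  Div-* : ∀ {j x y} → O x → Div j y → Div j (x * y)
  Div-* {j} {x} ox (mkDiv {b} ob refl) = mkDiv (ox ⊗ ob) (shuffle x (π^ j) b)
    where
    shuffle : ∀ x y z → x * (y * z) ≡ y * (x * z)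
    shuffle = solve-∀ ring

  Div-neg : ∀ {j x} → Div j x → Div j (- x)
  Div-neg {j} (mkDiv {a} oa refl) = mkDiv (⊝ oa) (neg-distribʳ-* (π^ j) a)

  Div-- : ∀ {j x y} → Div j x → Div j y → Div j (x - y)
  Div-- d e = Div-+ d (Div-neg e)

  Div-π* : ∀ {j x} → Div j x → Div (suc j) (π * x)
  Div-π* {j} (mkDiv {a} oa refl) = mkDiv oa (sym (*-assoc π (π^ j) a))

  Div⇒O : ∀ {j x} → Div j x → O x
  Div⇒O {j} (mkDiv oa refl) = O-π^ j ⊗ oa
    where
    O-π^ : ∀ j → O (π^ j)
    O-π^ zero    = O-1
    O-π^ (suc j) = O-ι p ⊗ O-π^ j

  record Unit (v : ℚ) : Set where
    constructor mkUnit
    field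
      {inverse}  : ℚ
      O-inverse  : O inverse
      *-inverse  : v * inverse ≡ 1ℚ

  Unit-ι : ∀ n .{{_ : ℕ.NonZero n}} → ¬ p ∣ n → Unit (ι n)
  Unit-ι n ∤n = mkUnit (O-recip n ∤n) (recip-inverse n)

  Unit-≡ : ∀ {v w} → v ≡ w → Unit v → Unit w
  Unit-≡ refl u = u

  Unit-* : ∀ {v w} → Unit v → Unit w → Unit (v * w)
  Unit-* {v} {w} (mkUnit {a} oa va≡1) (mkUnit {b} ob wb≡1) = mkUnit (oa ⊗ ob)
    (trans (shuffle v w a b) (cong₂ _*_ va≡1 wb≡1))
    where
    shuffle : ∀ v w a b → v * w * (a * b) ≡ v * a * (w * b)
    shuffle = solve-∀ ring

  -- Denominators are cleared this way: after multiplication by a unit a congruence is a polynomial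
  -- identity with an explicit cofactor.
  Div-cancel : ∀ {j v x} → Unit v → Div j (v * x) → Div j x
  Div-cancel {j} {v} {x} (mkUnit {u} ou vu≡1) d = Div-≡ (begin
    u * (v * x)   ≡⟨ shuffle u v x ⟩
    v * u * x     ≡⟨ cong (_* x) vu≡1 ⟩
    1ℚ * x        ≡⟨ *-identityˡ x ⟩
    x             ∎) (Div-* ou d)
    where
    shuffle : ∀ u v x → u * (v * x) ≡ v * u * x
    shuffle = solve-∀ ring

  -- The congruence x ≡ 1 + p a (mod p²), with the remainder kept as a witness so that x can be
  -- replaced by an exact expression inside polynomial identities.
  record Expand (x a : ℚ) : Set where
    constructor mkExpand
    field
      {rest}   : ℚ
      O-coeff  : O a
      O-rest   : O rest
      expand   : x ≡ 1ℚ + π * a + π * (π * rest)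

  Expand⇒O : ∀ {x a} → Expand x a → O x
  Expand⇒O (mkExpand oa or refl) = O-1 ⊕ O-ι p ⊗ oa ⊕ O-ι p ⊗ (O-ι p ⊗ or)

  Expand-linear : ∀ {a} → O a → Expand (1ℚ + π * a) a
  Expand-linear {a} oa = mkExpand oa (O-# 0) (pad π a)
    where
    pad : ∀ π a → 1ℚ + π * a ≡ 1ℚ + π * a + π * (π * 0ℚ)
    pad = solve-∀ ring

  Expand-≡ : ∀ {x a b} → a ≡ b → Expand x a → Expand x b
  Expand-≡ refl e = e

  Expand-* : ∀ {x y a b} → Expand x a → Expand y b → Expand (x * y) (a + b)
  Expand-* {a = a} {b} (mkExpand {r} oa or refl) (mkExpand {s} ob os refl) = mkExpand (oa ⊕ ob)
    (or ⊕ os ⊕ oa ⊗ ob ⊕ O-ι p ⊗ (oa ⊗ os ⊕ ob ⊗ or ⊕ O-ι p ⊗ (or ⊗ os)))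
    (product π a b r s)
    where
    product : ∀ π a b r s → (1ℚ + π * a + π * (π * r)) * (1ℚ + π * b + π * (π * s))
      ≡ 1ℚ + π * (a + b) + π * (π * (r + s + a * b + π * (a * s + b * r + π * (r * s))))
    product = solve-∀ ring

  -- Multiplication by 1 - π a inverts y up to order π². The quotient x itself may occur in the
  -- remainder, so its integrality suffices and y is never inverted.
  Expand-÷ : ∀ {x y z a b} → O x → x * y ≡ z → Expand y a → Expand z b → Expand x (b - a)
  Expand-÷ {x} {a = a} {b} ox xy≡z (mkExpand {r} oa or refl) (mkExpand {s} ob os refl) =
    mkExpand (ob ⊖ oa)
      (os ⊖ ob ⊗ oa ⊖ O-ι p ⊗ (os ⊗ oa) ⊖ ox ⊗ (or ⊖ oa ⊗ oa ⊖ O-ι p ⊗ (or ⊗ oa)))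
      (begin
      x ≡⟨ split π x a r ⟩
      x * (1ℚ + π * a + π * (π * r)) * (1ℚ - π * a) - π * (π * (x * (r - a * a - π * (r * a))))
        ≡⟨ cong (λ u → u * (1ℚ - π * a) - π * (π * (x * (r - a * a - π * (r * a))))) xy≡z ⟩
      (1ℚ + π * b + π * (π * s)) * (1ℚ - π * a) - π * (π * (x * (r - a * a - π * (r * a))))
        ≡⟨ collect π x a b r s ⟩
      _ ∎)
    where
    split : ∀ π x a r → x ≡ x * (1ℚ + π * a + π * (π * r)) * (1ℚ - π * a) - π * (π * (x * (r - a * a - π * (r * a))))
    split = solve-∀ ring
    collect : ∀ π x a b r s → (1ℚ + π * b + π * (π * s)) * (1ℚ - π * a) - π * (π * (x * (r - a * a - π * (r * a))))
      ≡ 1ℚ + π * (b - a) + π * (π * (s - b * a - π * (s * a) - x * (r - a * a - π * (r * a))))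
    collect = solve-∀ ring

-- Products (1 + c)_r / r!, harmonic sums, and quotients of neighbouring terms

ratio : ℚ → ℕ → ℚ
ratio c r = poch (1ℚ + c) r * rfact r

ratio-zero : ∀ c → ratio c 0 ≡ 1ℚ
ratio-zero c = cong₂ _*_ (poch-zero (1ℚ + c)) rfact-zero

-- Hence `ratio c r` is the product of the 1 + c/j for 1 ≤ j ≤ r, whose part linear in c is c times
-- the harmonic sum.
ratio-suc : ∀ c r → ratio c (suc r) ≡ (1ℚ + c * recip (suc r)) * ratio c r
ratio-suc c r = begin
  poch (1ℚ + c) (suc r) * rfact (suc r)
    ≡⟨ cong₂ _*_ (poch-suc (1ℚ + c) r) (rfact-suc r) ⟩
  (1ℚ + c + ι r) * x * (recip (suc r) * y)
    ≡⟨ shuffle c (ι r) x (recip (suc r)) y ⟩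
  ((1ℚ + ι r) * recip (suc r) + c * recip (suc r)) * (x * y)
    ≡⟨ cong (λ u → (u * recip (suc r) + c * recip (suc r)) * (x * y)) (ι-suc r) ⟨
  (ι (suc r) * recip (suc r) + c * recip (suc r)) * (x * y)
    ≡⟨ cong (λ u → (u + c * recip (suc r)) * (x * y)) (recip-inverse (suc r)) ⟩
  (1ℚ + c * recip (suc r)) * (x * y) ∎
  where
  x = poch (1ℚ + c) r
  y = rfact r
  shuffle : ∀ c R x k y → (1ℚ + c + R) * x * (k * y) ≡ ((1ℚ + R) * k + c * k) * (x * y)
  shuffle = solve-∀ ring

poch-ratio : ∀ c r → poch (1ℚ + c) r ≡ ratio c r * fact r
poch-ratio c r = begin
  x                           ≡⟨ *-identityʳ x ⟨
  x * 1ℚ                      ≡⟨ cong (x *_) (fact-inverse r) ⟨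
  x * (fact r * rfact r)      ≡⟨ shuffle x (fact r) (rfact r) ⟩
  ratio c r * fact r          ∎
  where
  x = poch (1ℚ + c) r
  shuffle : ∀ x f y → x * (f * y) ≡ x * y * f
  shuffle = solve-∀ ring

harmonic : ℕ → ℚ
harmonic zero    = 0ℚ
harmonic (suc r) = harmonic r + recip (suc r)

altHarmonic : ℕ → ℚ
altHarmonic zero    = 0ℚ
altHarmonic (suc r) = altHarmonic r + sgn (suc r) * recip (suc r)

-- The quotient of neighbours with the same N = i + k + 1, denominators cleared. It spares closed
-- forms for the middle terms and also reaches the central term k = 0 from k = 1.
term-shift : ∀ i k → let I = ι i; K = ι k in
  (1ℚ + # 2 * I) * (# 3 + (# 2 * I + # 3 * K)) * (# 2 + (I + # 2 * K)) * term i (suc k)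
  ≡ (# 3 + (# 2 * I + # 4 * K)) * (# 2 + (# 2 * I + K)) * (1ℚ + I) * term (suc i) k
term-shift i k = begin
  _ ≡⟨ cong ((1ℚ + # 2 * ι i) * (# 3 + (# 2 * ι i + # 3 * ι k)) * (# 2 + (ι i + # 2 * ι k)) *_) right ⟩
  _ ≡⟨ poly b (ι i) (ι k) ⟩
  _ ≡⟨ cong ((# 3 + (# 2 * ι i + # 4 * ι k)) * (# 2 + (# 2 * ι i + ι k)) * (1ℚ + ι i) *_) left ⟨
  _ ∎
  where
  n₁ n₂ n₃ : ℕ
  n₁ = 2 ℕ.+ (2 ℕ.* i ℕ.+ 3 ℕ.* k)
  n₂ = 1 ℕ.+ (2 ℕ.* i ℕ.+ k)
  n₃ = 1 ℕ.+ (i ℕ.+ 2 ℕ.* k)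
  b : ℚ
  b = prod₈ (fact (3 ℕ.* (suc i ℕ.+ k))) (half (suc i ℕ.+ k)) (half n₃) (half i)
        (rfact (1 ℕ.+ n₁)) (rfact (1 ℕ.+ n₂)) (rfact (1 ℕ.+ n₃)) (rfact (suc i))
  ιn₁ : ι n₁ ≡ # 2 + (# 2 * ι i + # 3 * ι k)
  ιn₁ = trans (ι-homo-+ 2 (2 ℕ.* i ℕ.+ 3 ℕ.* k)) (cong₂ _+_ (ι-# 2) (ι-lin 2 3 i k))
  ιn₂ : ι n₂ ≡ 1ℚ + (# 2 * ι i + ι k)
  ιn₂ = ι-suc-≡ (2 ℕ.* i ℕ.+ k) (ι-linˡ 2 i k)
  ιn₃ : ι n₃ ≡ 1ℚ + (ι i + # 2 * ι k)
  ιn₃ = ι-suc-≡ (i ℕ.+ 2 ℕ.* k) (ι-linʳ 2 i k)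
  e₁ : ∀ i k → 2 ℕ.* suc i ℕ.+ 3 ℕ.* k ≡ 2 ℕ.+ (2 ℕ.* i ℕ.+ 3 ℕ.* k)
  e₁ = ℕ.solve-∀
  e₂ : ∀ i k → 2 ℕ.* suc i ℕ.+ k ≡ 2 ℕ.+ (2 ℕ.* i ℕ.+ k)
  e₂ = ℕ.solve-∀
  e₃ : ∀ i k → 2 ℕ.* i ℕ.+ 3 ℕ.* suc k ≡ 3 ℕ.+ (2 ℕ.* i ℕ.+ 3 ℕ.* k)
  e₃ = ℕ.solve-∀
  e₄ : ∀ i k → 2 ℕ.* i ℕ.+ suc k ≡ 1 ℕ.+ (2 ℕ.* i ℕ.+ k)
  e₄ = ℕ.solve-∀
  e₅ : ∀ i k → i ℕ.+ 2 ℕ.* suc k ≡ 2 ℕ.+ (i ℕ.+ 2 ℕ.* k)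
  e₅ = ℕ.solve-∀
  left : term (suc i) k ≡ b * (1ℚ * 1ℚ * 1ℚ * (½ + ι i) * ((1ℚ + (# 2 + (# 2 * ι i + # 3 * ι k))) * 1ℚ * (1ℚ + (1ℚ + (ι i + # 2 * ι k))) * 1ℚ))
  left = prod₈-scale (factor-one (fact (3 ℕ.* (suc i ℕ.+ k)))) (factor-one (half (suc i ℕ.+ k))) (factor-one (half n₃))
    (poch-factor ½ i refl) (factor-≡ (cong rfact (e₁ i k)) (rfact-factor n₁ ιn₁)) (factor-≡ (cong rfact (e₂ i k)) (factor-one _))
    (rfact-factor n₃ ιn₃) (factor-one (rfact (suc i)))
  right : term i (suc k) ≡ b * (1ℚ * 1ℚ * (½ + (1ℚ + (ι i + # 2 * ι k))) * 1ℚ * (1ℚ * (1ℚ + (1ℚ + (# 2 * ι i + ι k))) * 1ℚ * (1ℚ + ι i)))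
  right = prod₈-scale (factor-≡ (cong (λ n → fact (3 ℕ.* n)) (ℕ.+-suc i k)) (factor-one _)) (factor-≡ (cong half (ℕ.+-suc i k)) (factor-one _))
    (factor-≡ (cong half (e₅ i k)) (poch-factor ½ n₃ ιn₃)) (factor-one (half i))
    (factor-≡ (cong rfact (e₃ i k)) (factor-one _)) (factor-≡ (cong rfact (e₄ i k)) (rfact-factor n₂ ιn₂))
    (factor-≡ (cong rfact (e₅ i k)) (factor-one _)) (rfact-factor i refl)
  poly : ∀ b I K →
    (1ℚ + # 2 * I) * (# 3 + (# 2 * I + # 3 * K)) * (# 2 + (I + # 2 * K))
      * (b * (1ℚ * 1ℚ * (½ + (1ℚ + (I + # 2 * K))) * 1ℚ * (1ℚ * (1ℚ + (1ℚ + (# 2 * I + K))) * 1ℚ * (1ℚ + I))))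
    ≡ (# 3 + (# 2 * I + # 4 * K)) * (# 2 + (# 2 * I + K)) * (1ℚ + I)
      * (b * (1ℚ * 1ℚ * 1ℚ * (½ + I) * ((1ℚ + (# 2 + (# 2 * I + # 3 * K))) * 1ℚ * (1ℚ + (1ℚ + (I + # 2 * K))) * 1ℚ)))
  poly = solve-∀ ring

-- The extreme terms of the antidiagonal i + k = m + 1, where p = 2 m + 1

module Evaluation (m : ℕ) where

  p : ℕ
  p = 1 ℕ.+ 2 ℕ.* m

  -- `Y`, `Z`, `W`, `V` are the products of 1 + c p / j over 1 ≤ j ≤ m for c = -1/2, -1, 1, 1/2.
  -- They come from (1/2)_m, from the upper half of (2m)!, from the last m factors of (3m+1)! and
  -- from the last m factors of (1/2)_p, the former two by reflection. `Z⁻¹` is given by factorials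
  -- of numbers below p, which makes its integrality evident.
  π M Y Z W V Z⁻¹ : ℚ
  π = ι p
  M = ι m
  Y = ratio (π * -½) m
  Z = ratio (π * - 1ℚ) m
  W = ratio (π * 1ℚ) m
  V = ratio (π * ½) m
  Z⁻¹ = sgn m * fact m * fact m * rfact (2 ℕ.* m)

  π≡ : π ≡ 1ℚ + # 2 * M
  π≡ = ι-suc-≡ (2 ℕ.* m) (ι-scale 2 m)

  half-m : half m ≡ sgn m * (Y * fact m)
  half-m = begin
    half m                                ≡⟨ poch-reflect ½ m ⟩
    sgn m * poch (1ℚ - ½ - M) m           ≡⟨ cong (λ u → sgn m * poch u m) (trans (arg M) (cong (λ u → 1ℚ + u * -½) (sym π≡))) ⟩
    sgn m * poch (1ℚ + π * -½) m          ≡⟨ cong (sgn m *_) (poch-ratio (π * -½) m) ⟩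
    sgn m * (Y * fact m)                  ∎
    where
    arg : ∀ M → 1ℚ - ½ - M ≡ 1ℚ + (1ℚ + # 2 * M) * -½
    arg = solve-∀ ring

  fact-2m : fact (2 ℕ.* m) ≡ fact m * (sgn m * (Z * fact m))
  fact-2m = begin
    fact (2 ℕ.* m)                                ≡⟨ cong (λ u → fact (m ℕ.+ u)) (ℕ.+-identityʳ m) ⟩
    fact (m ℕ.+ m)                                ≡⟨ poch-+ 1ℚ m m ⟩
    fact m * poch (1ℚ + M) m                      ≡⟨ cong (fact m *_) (poch-reflect (1ℚ + M) m) ⟩
    fact m * (sgn m * poch (1ℚ - (1ℚ + M) - M) m) ≡⟨ cong (λ u → fact m * (sgn m * poch u m)) (trans (arg M) (cong (λ u → 1ℚ + u * - 1ℚ) (sym π≡))) ⟩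
    fact m * (sgn m * poch (1ℚ + π * - 1ℚ) m)     ≡⟨ cong (λ u → fact m * (sgn m * u)) (poch-ratio (π * - 1ℚ) m) ⟩
    fact m * (sgn m * (Z * fact m))               ∎
    where
    arg : ∀ M → 1ℚ - (1ℚ + M) - M ≡ 1ℚ + (1ℚ + # 2 * M) * - 1ℚ
    arg = solve-∀ ring

  fact-p : fact p ≡ π * fact (2 ℕ.* m)
  fact-p = trans (poch-suc 1ℚ (2 ℕ.* m)) (cong (_* fact (2 ℕ.* m)) (sym (ι-suc (2 ℕ.* m))))

  fact-3m+1 : fact (1 ℕ.+ 3 ℕ.* m) ≡ π * fact (2 ℕ.* m) * (W * fact m)
  fact-3m+1 = begin
    fact (1 ℕ.+ 3 ℕ.* m)                       ≡⟨ cong fact (arg m) ⟩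
    fact (p ℕ.+ m)                             ≡⟨ poch-+ 1ℚ p m ⟩
    fact p * poch (1ℚ + π) m                   ≡⟨ cong₂ (λ u v → u * poch (1ℚ + v) m) fact-p (sym (*-identityʳ π)) ⟩
    π * fact (2 ℕ.* m) * poch (1ℚ + π * 1ℚ) m  ≡⟨ cong (π * fact (2 ℕ.* m) *_) (poch-ratio (π * 1ℚ) m) ⟩
    π * fact (2 ℕ.* m) * (W * fact m)          ∎
    where
    arg : ∀ m → 1 ℕ.+ 3 ℕ.* m ≡ 1 ℕ.+ 2 ℕ.* m ℕ.+ m
    arg = ℕ.solve-∀

  half-p : half p ≡ (½ + M) * half m * (V * fact m)
  half-p = begin
    half p                                        ≡⟨ cong half (eq m) ⟩
    half (suc m ℕ.+ m)                            ≡⟨ poch-+ ½ (suc m) m ⟩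
    half (suc m) * poch (½ + ι (suc m)) m         ≡⟨ cong₂ (λ u v → u * poch (½ + v) m) (poch-suc ½ m) (ι-suc m) ⟩
    (½ + M) * half m * poch (½ + (1ℚ + M)) m      ≡⟨ cong (λ u → (½ + M) * half m * poch u m) (trans (arg M) (cong (λ u → 1ℚ + u * ½) (sym π≡))) ⟩
    (½ + M) * half m * poch (1ℚ + π * ½) m        ≡⟨ cong ((½ + M) * half m *_) (poch-ratio (π * ½) m) ⟩
    (½ + M) * half m * (V * fact m)               ∎
    where
    arg : ∀ M → ½ + (1ℚ + M) ≡ 1ℚ + (1ℚ + # 2 * M) * ½
    arg = solve-∀ ring
    eq : ∀ m → 1 ℕ.+ 2 ℕ.* m ≡ suc m ℕ.+ m
    eq = ℕ.solve-∀

  Z-inverse : Z⁻¹ * Z ≡ 1ℚ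
  Z-inverse = begin
    Z⁻¹ * Z                                                       ≡⟨ shuffle (sgn m) (fact m) (rfact (2 ℕ.* m)) Z ⟩
    fact m * (sgn m * (Z * fact m)) * rfact (2 ℕ.* m)             ≡⟨ cong (_* rfact (2 ℕ.* m)) fact-2m ⟨
    fact (2 ℕ.* m) * rfact (2 ℕ.* m)                              ≡⟨ fact-inverse (2 ℕ.* m) ⟩
    1ℚ ∎
    where
    shuffle : ∀ s f g z → s * f * f * g * z ≡ f * (s * (z * f)) * g
    shuffle = solve-∀ ring

  -- Both sides are (-1)^m C(2m, m). As 4^m = 2^(p-1), this is the entrance of the Fermat quotient.
  4^m*Y≡Z : ι (4 ℕ.^ m) * Y ≡ Z
  4^m*Y≡Z = begin
    c * Y                                           ≡⟨ pad (c * Y) ⟩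
    c * Y * (1ℚ * 1ℚ * 1ℚ)                          ≡⟨ cong₂ (λ u v → c * Y * (u * u * v)) (fact-inverse m) (sgn² m) ⟨
    c * Y * (f * r * (f * r) * (s * s))             ≡⟨ shuffle₁ c Y f r s ⟩
    s * (r * r) * (c * (s * (Y * f)) * f)           ≡⟨ cong (λ u → s * (r * r) * (c * u * f)) half-m ⟨
    s * (r * r) * (c * half m * f)                  ≡⟨ cong (s * (r * r) *_) (4^n*half*fact m) ⟩
    s * (r * r) * fact (2 ℕ.* m)                    ≡⟨ cong (s * (r * r) *_) fact-2m ⟩
    s * (r * r) * (f * (s * (Z * f)))               ≡⟨ shuffle₂ Z f r s ⟩
    Z * (f * r * (f * r) * (s * s))                 ≡⟨ cong₂ (λ u v → Z * (u * u * v)) (fact-inverse m) (sgn² m) ⟩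
    Z * (1ℚ * 1ℚ * 1ℚ)                              ≡⟨ pad Z ⟨
    Z                                               ∎
    where
    c = ι (4 ℕ.^ m)
    f = fact m
    r = rfact m
    s = sgn m
    pad : ∀ x → x ≡ x * (1ℚ * 1ℚ * 1ℚ)
    pad = solve-∀ ring
    shuffle₁ : ∀ c Y f r s → c * Y * (f * r * (f * r) * (s * s)) ≡ s * (r * r) * (c * (s * (Y * f)) * f)
    shuffle₁ = solve-∀ ring
    shuffle₂ : ∀ Z f r s → s * (r * r) * (f * (s * (Z * f))) ≡ Z * (f * r * (f * r) * (s * s))
    shuffle₂ = solve-∀ ring

  M≡ : M ≡ ½ * (π - 1ℚ)
  M≡ = trans (arg M) (cong (λ u → ½ * (u - 1ℚ)) (sym π≡))
    where
    arg : ∀ M → M ≡ ½ * (1ℚ + # 2 * M - 1ℚ)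
    arg = solve-∀ ring

  -- What remains of h(N,1), and of h(N,N-1) and h(N,N), once rational functions of m and signs are
  -- split off.
  Θ₁ Θ₂ : ℚ
  Θ₁ = W * (Y * Y * Y) * Z⁻¹
  Θ₂ = Y * Y * V * Z⁻¹

  private
    f r s F g : ℚ
    f = fact m
    r = rfact m
    s = sgn m
    F = fact (2 ℕ.* m)
    g = rfact (2 ℕ.* m)

  first-term : # 16 * (1ℚ + M) * (# 2 + M) * term m 1 ≡ # 3 * (# 2 + # 3 * M) * (π * Θ₁)
  first-term = begin
    # 16 * (1ℚ + M) * (# 2 + M) * term m 1
      ≡⟨ cong (# 16 * (1ℚ + M) * (# 2 + M) *_) scaled ⟩
    # 16 * (1ℚ + M) * (# 2 + M) * (prod₈ (fact (1 ℕ.+ 3 ℕ.* m)) (half m) (half m) (half m) τ τ σ r * co)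
      ≡⟨ cong₂ (λ u v → # 16 * (1ℚ + M) * (# 2 + M) * (prod₈ u v v v τ τ σ r * co)) fact-3m+1 half-m ⟩
    # 16 * (1ℚ + M) * (# 2 + M) * (prod₈ (π * F * (W * f)) (s * (Y * f)) (s * (Y * f)) (s * (Y * f)) τ τ σ r * co)
      -- `π` stems from (3m+1)! and stays a variable independent of `M`; the two factors 1 + 2M from
      -- the half-integer products cancel those hidden in the two copies of `g′`.
      ≡⟨ poly M π F W f s Y τ σ r ⟩
    # 3 * (# 2 + # 3 * M) * (π * (W * (Y * Y * Y) * (s * f * f * g′))) * (F * g′ * ((f * r) * (f * r′)) * (s * s))
      ≡⟨ cong₂ (λ u v → # 3 * (# 2 + # 3 * M) * (π * (W * (Y * Y * Y) * (s * f * f * u))) * (F * u * ((f * r) * (f * v)) * (s * s))) g≡ r≡ ⟨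
    # 3 * (# 2 + # 3 * M) * (π * Θ₁) * (F * g * ((f * r) * (f * r)) * (s * s))
      ≡⟨ cong₂ (λ u v → # 3 * (# 2 + # 3 * M) * (π * Θ₁) * (u * (v * v) * (s * s))) (fact-inverse (2 ℕ.* m)) (fact-inverse m) ⟩
    # 3 * (# 2 + # 3 * M) * (π * Θ₁) * (1ℚ * (1ℚ * 1ℚ) * (s * s))
      ≡⟨ cong (λ u → # 3 * (# 2 + # 3 * M) * (π * Θ₁) * (1ℚ * (1ℚ * 1ℚ) * u)) (sgn² m) ⟩
    # 3 * (# 2 + # 3 * M) * (π * Θ₁) * 1ℚ
      ≡⟨ *-identityʳ _ ⟩
    # 3 * (# 2 + # 3 * M) * (π * Θ₁) ∎
    where
    τ σ g′ r′ co : ℚ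
    co = (1ℚ + (1ℚ + (1ℚ + # 3 * M))) * (1ℚ + (1ℚ + # 3 * M)) * (½ + M) * ((½ + (1ℚ + M)) * (½ + M)) * 1ℚ
         * (1ℚ * ((1ℚ + (1ℚ + # 2 * M)) * (1ℚ + (1ℚ + (1ℚ + # 2 * M)))) * 1ℚ * 1ℚ)
    τ = rfact (3 ℕ.+ 2 ℕ.* m)
    σ = rfact (2 ℕ.+ m)
    g′ = (1ℚ + # 2 * M) * ((1ℚ + (1ℚ + # 2 * M)) * (1ℚ + (1ℚ + (1ℚ + # 2 * M)))) * τ
    r′ = (1ℚ + M) * (1ℚ + (1ℚ + M)) * σ
    ι2m : ι (1 ℕ.+ 2 ℕ.* m) ≡ 1ℚ + # 2 * M
    ι2m = ι-suc-≡ (2 ℕ.* m) (ι-scale 2 m)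
    g≡ : g ≡ g′
    g≡ = Factor.proof (factor-trans (rfact-factor (2 ℕ.* m) (ι-scale 2 m)) (rfact-factor₂ (1 ℕ.+ 2 ℕ.* m) ι2m))
    r≡ : r ≡ r′
    r≡ = Factor.proof (rfact-factor₂ m refl)
    e₁ : ∀ m → 3 ℕ.* (m ℕ.+ 1) ≡ 3 ℕ.+ 3 ℕ.* m
    e₁ = ℕ.solve-∀
    e₂ : ∀ m → 2 ℕ.* m ℕ.+ 3 ℕ.* 1 ≡ 3 ℕ.+ 2 ℕ.* m
    e₂ = ℕ.solve-∀
    scaled : term m 1 ≡ prod₈ (fact (1 ℕ.+ 3 ℕ.* m)) (half m) (half m) (half m) τ τ σ r
      * co
    scaled = prod₈-scale
      (factor-≡ (cong fact (e₁ m)) (poch-factor₂ 1ℚ (1 ℕ.+ 3 ℕ.* m) (ι-suc-≡ (3 ℕ.* m) (ι-scale 3 m))))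
      (factor-≡ (cong half (ℕ.+-comm m 1)) (poch-factor ½ m refl)) (factor-≡ (cong half (ℕ.+-comm m 2)) (poch-factor₂ ½ m refl)) (factor-one (half m))
      (factor-≡ (cong rfact (e₂ m)) (factor-one _)) (factor-≡ (cong rfact (ℕ.+-comm (2 ℕ.* m) 1)) (rfact-factor₂ (1 ℕ.+ 2 ℕ.* m) ι2m))
      (factor-≡ (cong rfact (ℕ.+-comm m 2)) (factor-one _)) (factor-one (rfact m))
    poly : ∀ M π F W f s Y τ σ r →
      # 16 * (1ℚ + M) * (# 2 + M) * (π * F * (W * f) * (s * (Y * f)) * (s * (Y * f)) * (s * (Y * f)) * (τ * τ * σ * r)
      * ((1ℚ + (1ℚ + (1ℚ + # 3 * M))) * (1ℚ + (1ℚ + # 3 * M)) * (½ + M) * ((½ + (1ℚ + M)) * (½ + M)) * 1ℚ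
        * (1ℚ * ((1ℚ + (1ℚ + # 2 * M)) * (1ℚ + (1ℚ + (1ℚ + # 2 * M)))) * 1ℚ * 1ℚ)))
      ≡ # 3 * (# 2 + # 3 * M) * (π * (W * (Y * Y * Y) * (s * f * f * ((1ℚ + # 2 * M) * ((1ℚ + (1ℚ + # 2 * M)) * (1ℚ + (1ℚ + (1ℚ + # 2 * M)))) * τ))))
        * (F * ((1ℚ + # 2 * M) * ((1ℚ + (1ℚ + # 2 * M)) * (1ℚ + (1ℚ + (1ℚ + # 2 * M)))) * τ)
          * ((f * r) * (f * ((1ℚ + M) * (1ℚ + (1ℚ + M)) * σ))) * (s * s))
    poly = solve-∀ ring

  -- At `i = 0` the factorials (3N)! and (2N+k)! are the same and cancel, so `W` does not enter
  -- `Θ₂`. For the penultimate term their quotient is just 3N.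
  last-term : # 8 * (# 2 + # 2 * M) * ((1ℚ + M) * term 0 (suc m)) ≡ s * ((1ℚ + # 2 * M) * (# 3 + # 4 * M)) * Θ₂
  last-term = begin
    # 8 * (# 2 + # 2 * M) * ((1ℚ + M) * term 0 (suc m))
      ≡⟨ cong (λ u → # 8 * (# 2 + # 2 * M) * ((1ℚ + M) * u)) scaled ⟩
    # 8 * (# 2 + # 2 * M) * ((1ℚ + M) * (prod₈ F₃ (half m) (half p) (half 0) R₃ κ ω (rfact 0) * co))
      ≡⟨ cong₂ (λ u v → # 8 * (# 2 + # 2 * M) * ((1ℚ + M) * (prod₈ F₃ (half m) (half p) u R₃ κ ω v * co))) (poch-zero ½) rfact-zero ⟩
    # 8 * (# 2 + # 2 * M) * ((1ℚ + M) * (prod₈ F₃ (half m) (half p) 1ℚ R₃ κ ω 1ℚ * co))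
      ≡⟨ cong (λ u → # 8 * (# 2 + # 2 * M) * ((1ℚ + M) * (prod₈ F₃ (half m) u 1ℚ R₃ κ ω 1ℚ * co))) half-p ⟩
    # 8 * (# 2 + # 2 * M) * ((1ℚ + M) * (prod₈ F₃ (half m) ((½ + M) * half m * (V * f)) 1ℚ R₃ κ ω 1ℚ * co))
      ≡⟨ cong (λ u → # 8 * (# 2 + # 2 * M) * ((1ℚ + M) * (prod₈ F₃ u ((½ + M) * u * (V * f)) 1ℚ R₃ κ ω 1ℚ * co))) half-m ⟩
    # 8 * (# 2 + # 2 * M) * ((1ℚ + M) * (prod₈ F₃ (s * (Y * f)) ((½ + M) * (s * (Y * f)) * (V * f)) 1ℚ R₃ κ ω 1ℚ * co))
      ≡⟨ poly M F₃ R₃ V f s Y κ ω ⟩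
    s * ((1ℚ + # 2 * M) * (# 3 + # 4 * M)) * (Y * Y * V * (s * f * f * g′)) * (F₃ * R₃ * (f * r′))
      ≡⟨ cong₂ (λ u v → s * ((1ℚ + # 2 * M) * (# 3 + # 4 * M)) * (Y * Y * V * (s * f * f * u)) * (F₃ * R₃ * (f * v))) g≡ r≡ ⟨
    s * ((1ℚ + # 2 * M) * (# 3 + # 4 * M)) * Θ₂ * (F₃ * R₃ * (f * r))
      ≡⟨ cong₂ (λ u v → s * ((1ℚ + # 2 * M) * (# 3 + # 4 * M)) * Θ₂ * (u * v)) (fact-inverse (3 ℕ.* suc m)) (fact-inverse m) ⟩
    s * ((1ℚ + # 2 * M) * (# 3 + # 4 * M)) * Θ₂ * 1ℚ
      ≡⟨ *-identityʳ _ ⟩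
    s * ((1ℚ + # 2 * M) * (# 3 + # 4 * M)) * Θ₂ ∎
    where
    F₃ R₃ κ ω g′ r′ co : ℚ
    co = 1ℚ * (½ + M) * (½ + (1ℚ + # 2 * M)) * 1ℚ * (1ℚ * 1ℚ * 1ℚ * 1ℚ)
    F₃ = fact (3 ℕ.* suc m)
    R₃ = rfact (3 ℕ.* suc m)
    κ = rfact (suc m)
    ω = rfact (2 ℕ.+ 2 ℕ.* m)
    g′ = (1ℚ + # 2 * M) * (1ℚ + (1ℚ + # 2 * M)) * ω
    r′ = (1ℚ + M) * κ
    g≡ : g ≡ g′
    g≡ = Factor.proof (rfact-factor₂ (2 ℕ.* m) (ι-scale 2 m))
    r≡ : r ≡ r′
    r≡ = rfact-step m
    e₁ : ∀ m → 2 ℕ.* suc m ≡ 2 ℕ.+ 2 ℕ.* m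
    e₁ = ℕ.solve-∀
    scaled : term 0 (suc m) ≡ prod₈ F₃ (half m) (half p) (half 0) R₃ κ ω (rfact 0)
      * co
    scaled = prod₈-scale (factor-one F₃) (poch-factor ½ m refl)
      (factor-≡ (cong half (e₁ m)) (poch-factor ½ p π≡)) (factor-one (half 0))
      (factor-one R₃) (factor-one κ) (factor-≡ (cong rfact (e₁ m)) (factor-one _)) (factor-one (rfact 0))
    poly : ∀ M F₃ R₃ V f s Y κ ω →
      # 8 * (# 2 + # 2 * M) * ((1ℚ + M) * (F₃ * (s * (Y * f)) * ((½ + M) * (s * (Y * f)) * (V * f)) * 1ℚ * (R₃ * κ * ω * 1ℚ)
        * (1ℚ * (½ + M) * (½ + (1ℚ + # 2 * M)) * 1ℚ * (1ℚ * 1ℚ * 1ℚ * 1ℚ))))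
      ≡ s * ((1ℚ + # 2 * M) * (# 3 + # 4 * M)) * (Y * Y * V * (s * f * f * ((1ℚ + # 2 * M) * (1ℚ + (1ℚ + # 2 * M)) * ω)))
        * (F₃ * R₃ * (f * ((1ℚ + M) * κ)))
    poly = solve-∀ ring

  penultimate-term : # 8 * (# 2 + M) * (M * term 1 m) ≡ s * (# 3 * M * (1ℚ + # 2 * M)) * Θ₂
  penultimate-term = begin
    # 8 * (# 2 + M) * (M * term 1 m)
      ≡⟨ cong (λ u → # 8 * (# 2 + M) * (M * u)) scaled ⟩
    # 8 * (# 2 + M) * (M * (prod₈ F₃ (half m) (half p) (half 0) R₃ σ θ (rfact 0) * co (ι 0)))
      ≡⟨ cong₂ (λ u v → # 8 * (# 2 + M) * (M * (prod₈ F₃ (half m) (half p) u R₃ σ θ v * co (ι 0)))) (poch-zero ½) rfact-zero ⟩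
    # 8 * (# 2 + M) * (M * (prod₈ F₃ (half m) (half p) 1ℚ R₃ σ θ 1ℚ * co (ι 0)))
      ≡⟨ cong₂ (λ u v → # 8 * (# 2 + M) * (M * (prod₈ F₃ (half m) u 1ℚ R₃ σ θ 1ℚ * co v))) half-p (ι-# 0) ⟩
    # 8 * (# 2 + M) * (M * (prod₈ F₃ (half m) ((½ + M) * half m * (V * f)) 1ℚ R₃ σ θ 1ℚ * co 0ℚ))
      ≡⟨ cong (λ u → # 8 * (# 2 + M) * (M * (prod₈ F₃ u ((½ + M) * u * (V * f)) 1ℚ R₃ σ θ 1ℚ * co 0ℚ))) half-m ⟩
    # 8 * (# 2 + M) * (M * (prod₈ F₃ (s * (Y * f)) ((½ + M) * (s * (Y * f)) * (V * f)) 1ℚ R₃ σ θ 1ℚ * co 0ℚ))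
      ≡⟨ poly M F₃ R₃ V f s Y σ θ ⟩
    s * (# 3 * M * (1ℚ + # 2 * M)) * (Y * Y * V * (s * f * f * g′)) * (F₃ * R₃ * (f * r′))
      ≡⟨ cong₂ (λ u v → s * (# 3 * M * (1ℚ + # 2 * M)) * (Y * Y * V * (s * f * f * u)) * (F₃ * R₃ * (f * v))) g≡ r≡ ⟨
    s * (# 3 * M * (1ℚ + # 2 * M)) * Θ₂ * (F₃ * R₃ * (f * r))
      ≡⟨ cong₂ (λ u v → s * (# 3 * M * (1ℚ + # 2 * M)) * Θ₂ * (u * v)) (fact-inverse (2 ℕ.+ 3 ℕ.* m)) (fact-inverse m) ⟩
    s * (# 3 * M * (1ℚ + # 2 * M)) * Θ₂ * 1ℚ
      ≡⟨ *-identityʳ _ ⟩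
    s * (# 3 * M * (1ℚ + # 2 * M)) * Θ₂ ∎
    where
    F₃ R₃ σ θ g′ r′ : ℚ
    F₃ = fact (2 ℕ.+ 3 ℕ.* m)
    R₃ = rfact (2 ℕ.+ 3 ℕ.* m)
    σ = rfact (2 ℕ.+ m)
    θ = rfact p
    g′ = (1ℚ + # 2 * M) * θ
    r′ = (1ℚ + M) * (1ℚ + (1ℚ + M)) * σ
    co : ℚ → ℚ
    co z = (1ℚ + (1ℚ + (1ℚ + # 3 * M))) * (½ + M) * 1ℚ * (½ + z) * (1ℚ * 1ℚ * 1ℚ * 1ℚ)
    g≡ : g ≡ g′
    g≡ = Factor.proof (rfact-factor (2 ℕ.* m) (ι-scale 2 m))
    r≡ : r ≡ r′
    r≡ = Factor.proof (rfact-factor₂ m refl)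
    e₁ : ∀ m → 3 ℕ.* (1 ℕ.+ m) ≡ 3 ℕ.+ 3 ℕ.* m
    e₁ = ℕ.solve-∀
    scaled : term 1 m ≡ prod₈ F₃ (half m) (half p) (half 0) R₃ σ θ (rfact 0) * co (ι 0)
    scaled = prod₈-scale
      (factor-≡ (cong fact (e₁ m)) (poch-factor 1ℚ (2 ℕ.+ 3 ℕ.* m) (ι-suc-≡ (1 ℕ.+ 3 ℕ.* m) (ι-suc-≡ (3 ℕ.* m) (ι-scale 3 m)))))
      (poch-factor ½ m refl) (factor-one (half p)) (poch-factor ½ 0 refl)
      (factor-one R₃) (factor-one σ) (factor-one θ) (factor-≡ rfact-one (factor-one (rfact 0)))
    poly : ∀ M F₃ R₃ V f s Y σ θ →
      # 8 * (# 2 + M) * (M * (F₃ * (s * (Y * f)) * ((½ + M) * (s * (Y * f)) * (V * f)) * 1ℚ * (R₃ * σ * θ * 1ℚ)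
        * ((1ℚ + (1ℚ + (1ℚ + # 3 * M))) * (½ + M) * 1ℚ * (½ + 0ℚ) * (1ℚ * 1ℚ * 1ℚ * 1ℚ))))
      ≡ s * (# 3 * M * (1ℚ + # 2 * M)) * (Y * Y * V * (s * f * f * ((1ℚ + # 2 * M) * θ)))
        * (F₃ * R₃ * (f * ((1ℚ + M) * (1ℚ + (1ℚ + M)) * σ)))
    poly = solve-∀ ring

  -- Each of the two terms has order p only, but modulo p² they are opposite, about ∓ (-1)^m p / 8;
  -- their sum gains the second factor p. This is why they are never expanded separately.
  last-terms : # 8 * ((1ℚ + π) * (# 3 + π)) * diagSum 1 m ≡ s * (π * (π * ((# 5 * π + # 7) * Θ₂)))
  last-terms = begin
    # 8 * ((1ℚ + π) * (# 3 + π)) * (M * term 1 m + ι (suc m) * term 0 (suc m))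
      ≡⟨ cong₂ (λ u v → # 8 * ((1ℚ + u) * (# 3 + u)) * (M * term 1 m + v * term 0 (suc m))) π≡ (ι-suc m) ⟩
    # 8 * ((1ℚ + (1ℚ + # 2 * M)) * (# 3 + (1ℚ + # 2 * M))) * (M * term 1 m + (1ℚ + M) * term 0 (suc m))
      ≡⟨ split M (M * term 1 m) ((1ℚ + M) * term 0 (suc m)) ⟩
    # 2 * (# 2 + # 2 * M) * (# 8 * (# 2 + M) * (M * term 1 m)) + (# 4 + # 2 * M) * (# 8 * (# 2 + # 2 * M) * ((1ℚ + M) * term 0 (suc m)))
      ≡⟨ cong₂ (λ u v → # 2 * (# 2 + # 2 * M) * u + (# 4 + # 2 * M) * v) penultimate-term last-term ⟩
    # 2 * (# 2 + # 2 * M) * (s * (# 3 * M * (1ℚ + # 2 * M)) * Θ₂) + (# 4 + # 2 * M) * (s * ((1ℚ + # 2 * M) * (# 3 + # 4 * M)) * Θ₂)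
      ≡⟨ collect M s Θ₂ ⟩
    s * ((1ℚ + # 2 * M) * ((1ℚ + # 2 * M) * ((# 5 * (1ℚ + # 2 * M) + # 7) * Θ₂)))
      ≡⟨ cong (λ u → s * (u * (u * ((# 5 * u + # 7) * Θ₂)))) π≡ ⟨
    s * (π * (π * ((# 5 * π + # 7) * Θ₂))) ∎
    where
    split : ∀ M a b → # 8 * ((1ℚ + (1ℚ + # 2 * M)) * (# 3 + (1ℚ + # 2 * M))) * (a + b)
      ≡ # 2 * (# 2 + # 2 * M) * (# 8 * (# 2 + M) * a) + (# 4 + # 2 * M) * (# 8 * (# 2 + # 2 * M) * b)
    split = solve-∀ ring
    collect : ∀ M s t → # 2 * (# 2 + # 2 * M) * (s * (# 3 * M * (1ℚ + # 2 * M)) * t) + (# 4 + # 2 * M) * (s * ((1ℚ + # 2 * M) * (# 3 + # 4 * M)) * t)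
      ≡ s * ((1ℚ + # 2 * M) * ((1ℚ + # 2 * M) * ((# 5 * (1ℚ + # 2 * M) + # 7) * t)))
    collect = solve-∀ ring

-- Alternating harmonic sums and parity

harmonic-cancel : ∀ m → sgn (2 ℕ.* m) ≡ 1ℚ × altHarmonic (2 ℕ.* m) ≡ harmonic m - harmonic (2 ℕ.* m)
harmonic-cancel zero    = refl , refl
harmonic-cancel (suc m) = trans (cong sgn (double m)) (trans (neg-neg (sgn (2 ℕ.* m))) s≡) , (begin
  altHarmonic (2 ℕ.* suc m)
    ≡⟨ cong altHarmonic (double m) ⟩
  altHarmonic (2 ℕ.* m) + - sgn (2 ℕ.* m) * a + - - sgn (2 ℕ.* m) * b
    ≡⟨ cong₂ (λ u v → u + - v * a + - - v * b) h≡ s≡ ⟩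
  harmonic m - harmonic (2 ℕ.* m) + - 1ℚ * a + - - 1ℚ * b
    ≡⟨ shuffle (harmonic m) (harmonic (2 ℕ.* m)) a b ⟩
  harmonic m + # 2 * b - (harmonic (2 ℕ.* m) + a + b)
    -- The alternating sum is twice its even part minus the full harmonic sum, and 2 / (2m+2) = 1 /
    -- (m+1).
    ≡⟨ cong (λ u → harmonic m + u - (harmonic (2 ℕ.* m) + a + b)) recip-double ⟨
  harmonic m + recip (suc m) - (harmonic (2 ℕ.* m) + a + b)
    ≡⟨ cong (λ u → harmonic (suc m) - harmonic u) (double m) ⟨
  harmonic (suc m) - harmonic (2 ℕ.* suc m) ∎)
  where
  s≡ = proj₁ (harmonic-cancel m)
  h≡ = proj₂ (harmonic-cancel m)
  a = recip (1 ℕ.+ 2 ℕ.* m)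
  b = recip (2 ℕ.+ 2 ℕ.* m)
  double : ∀ m → 2 ℕ.* suc m ≡ 2 ℕ.+ 2 ℕ.* m
  double = ℕ.solve-∀
  neg-neg : ∀ x → - - x ≡ x
  neg-neg = solve-∀ ring
  shuffle : ∀ h k a b → h - k + - 1ℚ * a + - - 1ℚ * b ≡ h + # 2 * b - (k + a + b)
  shuffle = solve-∀ ring
  assoc : ∀ x y → x * (# 2 * y) ≡ # 2 * x * y
  assoc = solve-∀ ring
  recip-double : recip (suc m) ≡ # 2 * b
  recip-double = ι-*-cancelˡ (suc m) (begin
    ι (suc m) * recip (suc m)    ≡⟨ recip-inverse (suc m) ⟩
    1ℚ                           ≡⟨ recip-inverse (2 ℕ.+ 2 ℕ.* m) ⟨
    ι (2 ℕ.+ 2 ℕ.* m) * b        ≡⟨ cong (λ u → ι u * b) (double m) ⟨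
    ι (2 ℕ.* suc m) * b          ≡⟨ cong (_* b) (ι-scale 2 (suc m)) ⟩
    # 2 * ι (suc m) * b          ≡⟨ assoc (ι (suc m)) b ⟨
    ι (suc m) * (# 2 * b)        ∎)

sgn-+ : ∀ a b → sgn (a ℕ.+ b) ≡ sgn a * sgn b
sgn-+ zero    b = sym (*-identityˡ (sgn b))
sgn-+ (suc a) b = trans (cong -_ (sgn-+ a b)) (neg-distribˡ-* (sgn a) (sgn b))

sgn-complement : ∀ m r t → r ℕ.+ t ≡ 2 ℕ.* m → sgn t ≡ sgn r
sgn-complement m r t eq = begin
  sgn t                      ≡⟨ *-identityˡ (sgn t) ⟨
  1ℚ * sgn t                 ≡⟨ cong (_* sgn t) (sgn² r) ⟨
  sgn r * sgn r * sgn t      ≡⟨ *-assoc (sgn r) (sgn r) (sgn t) ⟩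
  sgn r * (sgn r * sgn t)    ≡⟨ cong (sgn r *_) (sgn-+ r t) ⟨
  sgn r * sgn (r ℕ.+ t)      ≡⟨ cong (sgn r *_) (trans (cong sgn eq) (proj₁ (harmonic-cancel m))) ⟩
  sgn r * 1ℚ                 ≡⟨ *-identityʳ (sgn r) ⟩
  sgn r                      ∎

-- Units and first-order expansions for p = 2n + 5

module Congruence (n : ℕ) (pr : Prime (1 ℕ.+ 2 ℕ.* (2 ℕ.+ n))) where

  m : ℕ
  m = 2 ℕ.+ n

  open Evaluation m
  open Local p pr hiding (π)

  <p : ∀ k l → k ℕ.+ l ≡ 2 ℕ.* m → k ℕ.< p
  <p k l eq = ℕ.s≤s (subst (k ℕ.≤_) eq (ℕ.m≤m+n k l))

  Oπ : O π
  Oπ = O-ι p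

  Unit-< : ∀ k l → suc k ℕ.+ l ≡ 2 ℕ.* m → Unit (ι (suc k))
  Unit-< k l eq = Unit-ι (suc k) (∤-< (<p (suc k) l eq))

  Unit-π+ : ∀ k l → suc k ℕ.+ l ≡ 2 ℕ.* m → Unit (π + ι (suc k))
  Unit-π+ k l eq = Unit-≡ (ι-homo-+ p (suc k)) (Unit-ι (p ℕ.+ suc k) (∤-+ (∤-< (<p (suc k) l eq))))

  4+2n≡2m : 4 ℕ.+ 2 ℕ.* n ≡ 2 ℕ.* m
  4+2n≡2m = eq n
    where
    eq : ∀ n → 4 ℕ.+ 2 ℕ.* n ≡ 2 ℕ.* (2 ℕ.+ n)
    eq = ℕ.solve-∀

  O½ : O ½
  O½ = O-/ (+ 1) 2 (∤-< (<p 2 (2 ℕ.+ 2 ℕ.* n) 4+2n≡2m))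

  Unit-1+π : Unit (1ℚ + π)
  Unit-1+π = Unit-≡ (ι-suc p) (Unit-ι (suc p) (subst (λ u → ¬ p ∣ u) (ℕ.+-comm p 1) (∤-+ ∤-1)))

  Unit-2+π : Unit (# 2 + π)
  Unit-2+π = Unit-≡ (trans (+-comm π (ι 2)) (cong (_+ π) (ι-# 2))) (Unit-π+ 1 (2 ℕ.+ 2 ℕ.* n) 4+2n≡2m)

  -- False for p = 3; this denominator of h(N,1) is one reason to start the family at p = 5.
  Unit-3+π : Unit (# 3 + π)
  Unit-3+π = Unit-≡ (trans (+-comm π (ι 3)) (cong (_+ π) (ι-# 3))) (Unit-π+ 2 (1 ℕ.+ 2 ℕ.* n) 4+2n≡2m)

  Unit-2 : Unit (# 2)
  Unit-2 = Unit-≡ (ι-# 2) (Unit-< 1 (2 ℕ.+ 2 ℕ.* n) 4+2n≡2m)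

  Unit-8 : Unit (# 8)
  Unit-8 = Unit-* Unit-2 (Unit-* Unit-2 Unit-2)

  Expand-one : Expand 1ℚ 0ℚ
  Expand-one = mkExpand (O-# 0) (O-# 0) (pad π)
    where
    pad : ∀ π → 1ℚ ≡ 1ℚ + π * 0ℚ + π * (π * 0ℚ)
    pad = solve-∀ ring

  Expand-subst : ∀ {x y a b} → x ≡ y → a ≡ b → Expand x a → Expand y b
  Expand-subst refl refl e = e

  Expand-ratio : ∀ {c} r → r ℕ.< p → O c → Expand (ratio (π * c) r) (c * harmonic r)
  Expand-ratio {c} zero    _   oc = Expand-subst (sym (ratio-zero (π * c))) (sym (*-zeroʳ c)) Expand-one
  Expand-ratio {c} (suc r) r<p oc = Expand-subst
    (trans (cong (_* ratio (π * c) r) (assoc π c (recip (suc r)))) (sym (ratio-suc (π * c) r)))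
    (collect c (recip (suc r)) (harmonic r))
    (Expand-* (Expand-linear (oc ⊗ O-recip (suc r) (∤-< r<p))) (Expand-ratio r (ℕ.<-trans (ℕ.n<1+n r) r<p) oc))
    where
    assoc : ∀ π c k → 1ℚ + π * (c * k) ≡ 1ℚ + π * c * k
    assoc = solve-∀ ring
    collect : ∀ c k h → c * k + c * h ≡ c * (h + k)
    collect = solve-∀ ring

  m<p : m ℕ.< p
  m<p = <p m (m ℕ.+ 0) refl

  H A s : ℚ
  H = harmonic m
  A = altHarmonic m
  s = sgn m

  eY : Expand Y (-½ * H)
  eY = Expand-ratio m m<p (⊝ O½)

  eZ : Expand Z (- 1ℚ * H)
  eZ = Expand-ratio m m<p (⊝ O-1)

  eW : Expand W (1ℚ * H)
  eW = Expand-ratio m m<p O-1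

  eV : Expand V (½ * H)
  eV = Expand-ratio m m<p O½

  eZ⁻¹ : Expand Z⁻¹ (0ℚ - - 1ℚ * H)
  eZ⁻¹ = Expand-÷ (O-sgn m ⊗ O-poch m O-1 ⊗ O-poch m O-1 ⊗ O-rfact (2 ℕ.* m) (ℕ.n<1+n (2 ℕ.* m))) Z-inverse eZ Expand-one

  eΘ₁ : Expand Θ₁ (½ * H)
  eΘ₁ = Expand-≡ (collect H) (Expand-* (Expand-* eW (Expand-* (Expand-* eY eY) eY)) eZ⁻¹)
    where
    collect : ∀ H → 1ℚ * H + (-½ * H + -½ * H + -½ * H) + (0ℚ - - 1ℚ * H) ≡ ½ * H
    collect = solve-∀ ring

  eΘ₂ : Expand Θ₂ (½ * H)
  eΘ₂ = Expand-≡ (collect H) (Expand-* (Expand-* (Expand-* eY eY) eV) eZ⁻¹)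
    where
    collect : ∀ H → -½ * H + -½ * H + ½ * H + (0ℚ - - 1ℚ * H) ≡ ½ * H
    collect = solve-∀ ring

  e4^m : Expand (ι (4 ℕ.^ m)) (-½ * H)
  e4^m = Expand-≡ (collect H) (Expand-÷ (O-ι (4 ℕ.^ m)) 4^m*Y≡Z eY eZ)
    where
    collect : ∀ H → - 1ℚ * H - -½ * H ≡ -½ * H
    collect = solve-∀ ring

  -- Harmonic sums modulo p

  recip-pair : ∀ r t → suc r ℕ.+ t ≡ 2 ℕ.* m → Div 1 (recip (suc r) + recip (suc t))
  recip-pair r t eq = Div-cancel (Unit-* (Unit-< r t eq) (Unit-< t r (trans (comm t r) eq)))
    (mkDiv O-1 (begin
      a * b * (x + y)              ≡⟨ shuffle a b x y ⟩
      a * x * b + b * y * a        ≡⟨ cong₂ (λ u v → u * b + v * a) (recip-inverse (suc r)) (recip-inverse (suc t)) ⟩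
      1ℚ * b + 1ℚ * a              ≡⟨ cong₂ _+_ (*-identityˡ b) (*-identityˡ a) ⟩
      b + a                        ≡⟨ ι-homo-+ (suc t) (suc r) ⟨
      ι (suc t ℕ.+ suc r)          ≡⟨ cong ι (trans (total t r) (cong suc eq)) ⟩
      π                            ≡⟨ pad π ⟩
      π * 1ℚ * 1ℚ                  ∎))
    where
    a = ι (suc r)
    b = ι (suc t)
    x = recip (suc r)
    y = recip (suc t)
    comm : ∀ t r → suc t ℕ.+ r ≡ suc r ℕ.+ t
    comm = ℕ.solve-∀
    total : ∀ t r → suc t ℕ.+ suc r ≡ suc (suc r ℕ.+ t)
    total = ℕ.solve-∀
    shuffle : ∀ a b x y → a * b * (x + y) ≡ a * x * b + b * y * a
    shuffle = solve-∀ ring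
    pad : ∀ π → π ≡ π * 1ℚ * 1ℚ
    pad = solve-∀ ring

  Div-zero : ∀ {j x} → x ≡ 0ℚ → Div j x
  Div-zero {j} refl = mkDiv (O-# 0) (sym (*-zeroʳ (π^ j)))

  -- The last r terms pair off with the first r under j ↦ p - j and cancel.
  harmonic-reflect : ∀ r t → r ℕ.+ t ≡ 2 ℕ.* m → Div 1 (harmonic (2 ℕ.* m) - harmonic t + harmonic r)
  harmonic-reflect zero    t eq = Div-zero (trans (cong (λ u → harmonic (2 ℕ.* m) - harmonic u + 0ℚ) eq) (cancel (harmonic (2 ℕ.* m))))
    where
    cancel : ∀ x → x - x + 0ℚ ≡ 0ℚ
    cancel = solve-∀ ring
  harmonic-reflect (suc r) t eq = Div-≡ (shuffle (harmonic (2 ℕ.* m)) (harmonic t) (harmonic r) (recip (suc r)) (recip (suc t)))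
    (Div-+ (harmonic-reflect r (suc t) (trans (ℕ.+-suc r t) eq)) (recip-pair r t eq))
    where
    shuffle : ∀ h x y a b → h - (x + b) + y + (a + b) ≡ h - x + (y + a)
    shuffle = solve-∀ ring

  -- As p is odd, j and p - j have opposite parity. The change of sign compensates 1/(p-j) ≡ -1/j,
  -- so the last r terms repeat the first r instead of cancelling them.
  altHarmonic-reflect : ∀ r t → r ℕ.+ t ≡ 2 ℕ.* m → Div 1 (altHarmonic (2 ℕ.* m) - altHarmonic t - altHarmonic r)
  altHarmonic-reflect zero    t eq = Div-zero (trans (cong (λ u → altHarmonic (2 ℕ.* m) - altHarmonic u - 0ℚ) eq) (cancel (altHarmonic (2 ℕ.* m))))
    where
    cancel : ∀ x → x - x - 0ℚ ≡ 0ℚ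
    cancel = solve-∀ ring
  altHarmonic-reflect (suc r) t eq = Div-≡ (begin
    h - (x + sgn (suc t) * b) - y + sgn r * (a + b)     ≡⟨ cong (λ u → h - (x + u * b) - y + sgn r * (a + b)) (sgn-complement m r (suc t) eq′) ⟩
    h - (x + sgn r * b) - y + sgn r * (a + b)           ≡⟨ shuffle h x y a b (sgn r) ⟩
    h - x - (y + - sgn r * a)                           ∎)
    (Div-+ (altHarmonic-reflect r (suc t) eq′) (Div-* (O-sgn r) (recip-pair r t eq)))
    where
    h = altHarmonic (2 ℕ.* m)
    x = altHarmonic t
    y = altHarmonic r
    a = recip (suc r)
    b = recip (suc t)
    eq′ = trans (ℕ.+-suc r t) eq
    shuffle : ∀ h x y a b s → h - (x + s * b) - y + s * (a + b) ≡ h - x - (y + - s * a)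
    shuffle = solve-∀ ring

  -- Reflection at the midpoint gives 0 for the harmonic sum up to p - 1 and 2A for the alternating
  -- one; by `harmonic-cancel` the latter is H minus the former.
  H≡2A : Div 1 (H - # 2 * A)
  H≡2A = Div-≡ (begin
    altHarmonic (2 ℕ.* m) - A - A + (harmonic (2 ℕ.* m) - H + H)
      ≡⟨ cong (λ u → u - A - A + (harmonic (2 ℕ.* m) - H + H)) (proj₂ (harmonic-cancel m)) ⟩
    H - harmonic (2 ℕ.* m) - A - A + (harmonic (2 ℕ.* m) - H + H)
      ≡⟨ shuffle H (harmonic (2 ℕ.* m)) A ⟩
    H - # 2 * A ∎)
    (Div-+ (altHarmonic-reflect m m eq) (harmonic-reflect m m eq))
    where
    eq : m ℕ.+ m ≡ 2 ℕ.* m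
    eq = cong (m ℕ.+_) (sym (ℕ.+-identityʳ m))
    shuffle : ∀ H h A → H - h - A - A + (h - H + H) ≡ H - # 2 * A
    shuffle = solve-∀ ring

  -- The terms k = 0, 1, N - 1, N modulo p³

  first-term-π : # 8 * ((1ℚ + π) * (# 3 + π)) * term m 1 ≡ # 3 * ((1ℚ + # 3 * π) * (π * Θ₁))
  first-term-π = begin
    # 8 * ((1ℚ + π) * (# 3 + π)) * term m 1
      ≡⟨ poly₁ π (term m 1) ⟩
    # 2 * (# 16 * (1ℚ + ½ * (π - 1ℚ)) * (# 2 + ½ * (π - 1ℚ)) * term m 1)
      ≡⟨ cong (λ u → # 2 * (# 16 * (1ℚ + u) * (# 2 + u) * term m 1)) M≡ ⟨
    # 2 * (# 16 * (1ℚ + M) * (# 2 + M) * term m 1)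
      ≡⟨ cong (# 2 *_) first-term ⟩
    # 2 * (# 3 * (# 2 + # 3 * M) * (π * Θ₁))
      ≡⟨ cong (λ u → # 2 * (# 3 * (# 2 + # 3 * u) * (π * Θ₁))) M≡ ⟩
    # 2 * (# 3 * (# 2 + # 3 * (½ * (π - 1ℚ))) * (π * Θ₁))
      ≡⟨ poly₂ π Θ₁ ⟩
    # 3 * ((1ℚ + # 3 * π) * (π * Θ₁)) ∎
    where
    poly₁ : ∀ π t → # 8 * ((1ℚ + π) * (# 3 + π)) * t ≡ # 2 * (# 16 * (1ℚ + ½ * (π - 1ℚ)) * (# 2 + ½ * (π - 1ℚ)) * t)
    poly₁ = solve-∀ ring
    poly₂ : ∀ π θ → # 2 * (# 3 * (# 2 + # 3 * (½ * (π - 1ℚ))) * (π * θ)) ≡ # 3 * ((1ℚ + # 3 * π) * (π * θ))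
    poly₂ = solve-∀ ring

  -- With p as variable the quotient of neighbours is visibly -(K²-1)(2K-1) / (K(K+2)(2K+3)) modulo
  -- p, which dictates `weight`. The two places where the order in p changes show too: the factor π
  -- - 2K at K = 0 and π + 1 - K at K = 1.
  term-shift-π : ∀ i k → i ℕ.+ k ≡ m → let K = ι k in
    (π - # 2 * K) * (π + # 2 + K) * (π + # 3 + # 2 * K) * term i (suc k)
    ≡ (π + # 2 + # 2 * K) * (π + 1ℚ - K) * (π + 1ℚ - # 2 * K) * term (suc i) k
  term-shift-π i k i+k≡m = begin
    (π - # 2 * K) * (π + # 2 + K) * (π + # 3 + # 2 * K) * term i (suc k)
      ≡⟨ cong (λ u → (u - # 2 * K) * (u + # 2 + K) * (u + # 3 + # 2 * K) * term i (suc k)) π≡I+K ⟩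
    _ ≡⟨ poly₁ I K (term i (suc k)) ⟩
    # 2 * ((1ℚ + # 2 * I) * (# 3 + (# 2 * I + # 3 * K)) * (# 2 + (I + # 2 * K)) * term i (suc k))
      ≡⟨ cong (# 2 *_) (term-shift i k) ⟩
    # 2 * ((# 3 + (# 2 * I + # 4 * K)) * (# 2 + (# 2 * I + K)) * (1ℚ + I) * term (suc i) k)
      ≡⟨ poly₂ I K (term (suc i) k) ⟩
    _ ≡⟨ cong (λ u → (u + # 2 + # 2 * K) * (u + 1ℚ - K) * (u + 1ℚ - # 2 * K) * term (suc i) k) π≡I+K ⟨
    (π + # 2 + # 2 * K) * (π + 1ℚ - K) * (π + 1ℚ - # 2 * K) * term (suc i) k ∎
    where
    I = ι i
    K = ι k
    π≡I+K : π ≡ 1ℚ + # 2 * (I + K)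
    π≡I+K = trans π≡ (cong (λ u → 1ℚ + # 2 * u) (trans (cong ι (sym i+k≡m)) (ι-homo-+ i k)))
    poly₁ : ∀ I K t → (1ℚ + # 2 * (I + K) - # 2 * K) * (1ℚ + # 2 * (I + K) + # 2 + K) * (1ℚ + # 2 * (I + K) + # 3 + # 2 * K) * t
      ≡ # 2 * ((1ℚ + # 2 * I) * (# 3 + (# 2 * I + # 3 * K)) * (# 2 + (I + # 2 * K)) * t)
    poly₁ = solve-∀ ring
    poly₂ : ∀ I K t → # 2 * ((# 3 + (# 2 * I + # 4 * K)) * (# 2 + (# 2 * I + K)) * (1ℚ + I) * t)
      ≡ (1ℚ + # 2 * (I + K) + # 2 + # 2 * K) * (1ℚ + # 2 * (I + K) + 1ℚ - K) * (1ℚ + # 2 * (I + K) + 1ℚ - # 2 * K) * t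
    poly₂ = solve-∀ ring

  OH : O H
  OH = go m m<p
    where
    go : ∀ r → r ℕ.< p → O (harmonic r)
    go zero    _   = O-# 0
    go (suc r) r<p = go r (ℕ.<-trans (ℕ.n<1+n r) r<p) ⊕ O-recip (suc r) (∤-< r<p)

  h t₁ t₂ b₂ : ℚ
  h = ½ * H
  t₁ = Expand.rest eΘ₁
  t₂ = Expand.rest eΘ₂
  b₂ = h + π * t₂
  Oh : O h
  Oh = O½ ⊗ OH
  Ot₁ : O t₁
  Ot₁ = Expand.O-rest eΘ₁
  Ob₂ : O b₂
  Ob₂ = Oh ⊕ Oπ ⊗ Expand.O-rest eΘ₂
  Θ₁≡ : Θ₁ ≡ 1ℚ + π * h + π * (π * t₁)
  Θ₁≡ = Expand.expand eΘ₁

  -- The exact value is 3π (1 + 3π) Θ₁ / ((1 + π)(1 + π/3)), and the 5 is 3 (3 - 1 - 1/3).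
  first-term-mod : Div 3 (# 24 * term m 1 - (# 3 * π + π * (π * (# 5 + # 3 * h))))
  first-term-mod = Div-cancel (Unit-* Unit-1+π Unit-3+π) (mkDiv
    (O-# 15 ⊗ Oh ⊕ O-# 9 ⊗ Ot₁ ⊕ O-# 27 ⊗ Oπ ⊗ Ot₁ ⊖ O-# 23 ⊖ O-# 5 ⊗ Oπ ⊖ O-# 3 ⊗ Oπ ⊗ Oh) (begin
    (1ℚ + π) * (# 3 + π) * (# 24 * term m 1 - X)
      ≡⟨ poly₁ π (term m 1) X ⟩
    # 3 * (# 8 * ((1ℚ + π) * (# 3 + π)) * term m 1) - (1ℚ + π) * (# 3 + π) * X
      ≡⟨ cong (λ u → # 3 * u - (1ℚ + π) * (# 3 + π) * X) (trans first-term-π (cong (λ u → # 3 * ((1ℚ + # 3 * π) * (π * u))) Θ₁≡)) ⟩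
    # 3 * (# 3 * ((1ℚ + # 3 * π) * (π * (1ℚ + π * h + π * (π * t₁))))) - (1ℚ + π) * (# 3 + π) * X
      ≡⟨ poly₂ π h t₁ ⟩
    _ ∎))
    where
    X = # 3 * π + π * (π * (# 5 + # 3 * h))
    poly₁ : ∀ π t x → (1ℚ + π) * (# 3 + π) * (# 24 * t - x) ≡ # 3 * (# 8 * ((1ℚ + π) * (# 3 + π)) * t) - (1ℚ + π) * (# 3 + π) * x
    poly₁ = solve-∀ ring
    poly₂ : ∀ π h t → # 3 * (# 3 * ((1ℚ + # 3 * π) * (π * (1ℚ + π * h + π * (π * t))))) - (1ℚ + π) * (# 3 + π) * (# 3 * π + π * (π * (# 5 + # 3 * h)))
      ≡ π * (π * (π * 1ℚ)) * (# 15 * h + # 9 * t + # 27 * π * t - # 23 - # 5 * π - # 3 * π * h)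
    poly₂ = solve-∀ ring

  -- The central term is reached from k = 1 by the shift at K = 0, whose factor π - 2K = π raises
  -- the order. Modulo higher powers of π, h(N,1) is π/8, t(N) is 3π h(N,1) and 8N is 4, which gives
  -- 3/2.
  central-term-mod : Div 3 (# 8 * (ι (suc m) * term (suc m) 0) - # 3 * ½ * (π * π))
  central-term-mod = Div-cancel (Unit-* Unit-2+π (Unit-* Unit-1+π Unit-1+π)) (mkDiv
    (O-# 3 ⊗ O½ ⊗ (O-# 2 ⊕ Oπ) ⊗ (O-1 ⊖ Oπ ⊕ (O-1 ⊕ O-# 3 ⊗ Oπ) ⊗ (Oh ⊕ Oπ ⊗ Ot₁))) (begin
    (# 2 + π) * ((1ℚ + π) * (1ℚ + π)) * (# 8 * (ι (suc m) * c) - X)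
      ≡⟨ cong (λ u → (# 2 + π) * ((1ℚ + π) * (1ℚ + π)) * (# 8 * (u * c) - X)) (trans (ι-suc m) (cong (λ u → 1ℚ + u) M≡)) ⟩
    (# 2 + π) * ((1ℚ + π) * (1ℚ + π)) * (# 8 * ((1ℚ + ½ * (π - 1ℚ)) * c) - X)
      ≡⟨ poly₁ π c X ⟩
    # 4 * (1ℚ + π) * ((π + # 2 + # 2 * 0ℚ) * (π + 1ℚ - 0ℚ) * (π + 1ℚ - # 2 * 0ℚ) * c) - (# 2 + π) * ((1ℚ + π) * (1ℚ + π)) * X
      ≡⟨ cong (λ u → # 4 * (1ℚ + π) * u - (# 2 + π) * ((1ℚ + π) * (1ℚ + π)) * X) shift ⟨
    # 4 * (1ℚ + π) * ((π - # 2 * 0ℚ) * (π + # 2 + 0ℚ) * (π + # 3 + # 2 * 0ℚ) * term m 1) - (# 2 + π) * ((1ℚ + π) * (1ℚ + π)) * X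
      ≡⟨ poly₂ π (term m 1) X ⟩
    (# 2 + π) * π * ½ * (# 8 * ((1ℚ + π) * (# 3 + π)) * term m 1) - (# 2 + π) * ((1ℚ + π) * (1ℚ + π)) * X
      ≡⟨ cong (λ u → (# 2 + π) * π * ½ * u - (# 2 + π) * ((1ℚ + π) * (1ℚ + π)) * X) (trans first-term-π (cong (λ u → # 3 * ((1ℚ + # 3 * π) * (π * u))) Θ₁≡)) ⟩
    (# 2 + π) * π * ½ * (# 3 * ((1ℚ + # 3 * π) * (π * (1ℚ + π * h + π * (π * t₁))))) - (# 2 + π) * ((1ℚ + π) * (1ℚ + π)) * X
      ≡⟨ poly₃ π h t₁ ⟩
    _ ∎))
    where
    c = term (suc m) 0
    X = # 3 * ½ * (π * π)
    shift : (π - # 2 * 0ℚ) * (π + # 2 + 0ℚ) * (π + # 3 + # 2 * 0ℚ) * term m 1 ≡ (π + # 2 + # 2 * 0ℚ) * (π + 1ℚ - 0ℚ) * (π + 1ℚ - # 2 * 0ℚ) * c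
    shift = subst (λ K → (π - # 2 * K) * (π + # 2 + K) * (π + # 3 + # 2 * K) * term m 1 ≡ (π + # 2 + # 2 * K) * (π + 1ℚ - K) * (π + 1ℚ - # 2 * K) * c)
      (ι-# 0) (term-shift-π m 0 (ℕ.+-identityʳ m))
    poly₁ : ∀ π c X → (# 2 + π) * ((1ℚ + π) * (1ℚ + π)) * (# 8 * ((1ℚ + ½ * (π - 1ℚ)) * c) - X)
      ≡ # 4 * (1ℚ + π) * ((π + # 2 + # 2 * 0ℚ) * (π + 1ℚ - 0ℚ) * (π + 1ℚ - # 2 * 0ℚ) * c) - (# 2 + π) * ((1ℚ + π) * (1ℚ + π)) * X
    poly₁ = solve-∀ ring
    poly₂ : ∀ π t X → # 4 * (1ℚ + π) * ((π - # 2 * 0ℚ) * (π + # 2 + 0ℚ) * (π + # 3 + # 2 * 0ℚ) * t) - (# 2 + π) * ((1ℚ + π) * (1ℚ + π)) * X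
      ≡ (# 2 + π) * π * ½ * (# 8 * ((1ℚ + π) * (# 3 + π)) * t) - (# 2 + π) * ((1ℚ + π) * (1ℚ + π)) * X
    poly₂ = solve-∀ ring
    poly₃ : ∀ π h t → (# 2 + π) * π * ½ * (# 3 * ((1ℚ + # 3 * π) * (π * (1ℚ + π * h + π * (π * t))))) - (# 2 + π) * ((1ℚ + π) * (1ℚ + π)) * (# 3 * ½ * (π * π))
      ≡ π * (π * (π * 1ℚ)) * (# 3 * ½ * (# 2 + π) * (1ℚ - π + (1ℚ + # 3 * π) * (h + π * t)))
    poly₃ = solve-∀ ring

  last-terms-mod : Div 3 (# 24 * diagSum 1 m - # 7 * s * (π * π))
  last-terms-mod = Div-cancel (Unit-* Unit-1+π Unit-3+π) (mkDiv
    (O-sgn m ⊗ (O-# 3 ⊗ (O-# 5 ⊗ Oπ ⊕ O-# 7) ⊗ Ob₂ ⊖ O-# 13 ⊖ O-# 7 ⊗ Oπ)) (begin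
    (1ℚ + π) * (# 3 + π) * (# 24 * D - # 7 * s * (π * π))
      ≡⟨ poly₁ π D s ⟩
    # 3 * (# 8 * ((1ℚ + π) * (# 3 + π)) * D) - (1ℚ + π) * (# 3 + π) * (# 7 * s * (π * π))
      ≡⟨ cong (λ u → # 3 * u - (1ℚ + π) * (# 3 + π) * (# 7 * s * (π * π))) (trans last-terms (cong (λ u → s * (π * (π * ((# 5 * π + # 7) * u)))) (Expand.expand eΘ₂))) ⟩
    # 3 * (s * (π * (π * ((# 5 * π + # 7) * (1ℚ + π * h + π * (π * t₂)))))) - (1ℚ + π) * (# 3 + π) * (# 7 * s * (π * π))
      ≡⟨ poly₂ π s h t₂ ⟩
    _ ∎))
    where
    D = diagSum 1 m
    poly₁ : ∀ π D s → (1ℚ + π) * (# 3 + π) * (# 24 * D - # 7 * s * (π * π))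
      ≡ # 3 * (# 8 * ((1ℚ + π) * (# 3 + π)) * D) - (1ℚ + π) * (# 3 + π) * (# 7 * s * (π * π))
    poly₁ = solve-∀ ring
    poly₂ : ∀ π s h t → # 3 * (s * (π * (π * ((# 5 * π + # 7) * (1ℚ + π * h + π * (π * t)))))) - (1ℚ + π) * (# 3 + π) * (# 7 * s * (π * π))
      ≡ π * (π * (π * 1ℚ)) * (s * (# 3 * (# 5 * π + # 7) * (h + π * t) - # 13 - # 7 * π))
    poly₂ = solve-∀ ring

  -- The middle terms 2 ≤ k ≤ N - 2

  first-term-div : Div 1 (term m 1)
  first-term-div = Div-cancel (Unit-* Unit-8 (Unit-* Unit-1+π Unit-3+π)) (mkDiv
    (O-# 3 ⊗ ((O-1 ⊕ O-# 3 ⊗ Oπ) ⊗ Expand⇒O eΘ₁)) (trans first-term-π (shuffle π Θ₁)))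
    where
    shuffle : ∀ π θ → # 3 * ((1ℚ + # 3 * π) * (π * θ)) ≡ π * 1ℚ * (# 3 * ((1ℚ + # 3 * π) * θ))
    shuffle = solve-∀ ring

  -- (k² - 1) (4 k² - 1) for k = j + 2
  weight : ℕ → ℚ
  weight j = (1ℚ + ι j) * (# 3 + ι j) * (# 3 + # 2 * ι j) * (# 5 + # 2 * ι j)

  ¾ : ℚ
  ¾ = # 3 * (½ * ½)

  ι≡π- : ∀ a b → a ℕ.+ 2 ℕ.* b ≡ p → ι a ≡ π - # 2 * ι b
  ι≡π- a b eq = begin
    ι a                              ≡⟨ shuffle (ι a) (# 2 * ι b) ⟩
    ι a + # 2 * ι b - # 2 * ι b      ≡⟨ cong (_- # 2 * ι b) (ι-linʳ 2 a b) ⟨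
    ι (a ℕ.+ 2 ℕ.* b) - # 2 * ι b    ≡⟨ cong (λ u → ι u - # 2 * ι b) eq ⟩
    π - # 2 * ι b                    ∎
    where
    shuffle : ∀ x y → x ≡ x + y - y
    shuffle = solve-∀ ring

  ι-2+ : ∀ j → ι (2 ℕ.+ j) ≡ # 2 + ι j
  ι-2+ j = trans (ι-homo-+ 2 j) (cong (_+ ι j) (ι-# 2))

  -- Induction along the antidiagonal for k = j + 2, with `suc i` keeping k ≤ N - 2. From k = 1 to k
  -- = 2 the shift supplies a factor π and lifts the order to 2. From there on divisibility by p² is
  -- preserved, and because of it the recurrence for the weighted terms is needed only modulo p,
  -- where it is a mere change of sign. Hence both claims are proved together.
  middle-term : ∀ j i → suc i ℕ.+ j ≡ n →
    Div 2 (term (2 ℕ.+ i) (2 ℕ.+ j)) × Div 3 (sgn j * (weight j * term (2 ℕ.+ i) (2 ℕ.+ j)) - ¾ * (π * π))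
  middle-term zero i eq = d₂ , d₃
    where
    n≡ : n ≡ suc i
    n≡ = trans (sym eq) (ℕ.+-identityʳ (suc i))
    a b h₁ t : ℚ
    a = (π - # 2 * 1ℚ) * (π + # 2 + 1ℚ) * (π + # 3 + # 2 * 1ℚ)
    b = (π + # 2 + # 2 * 1ℚ) * (π + 1ℚ - 1ℚ) * (π + 1ℚ - # 2 * 1ℚ)
    h₁ = term m 1
    t = term (2 ℕ.+ i) 2
    shift : a * t ≡ b * h₁
    shift = begin
      a * t                  ≡⟨ subst (λ K → (π - # 2 * K) * (π + # 2 + K) * (π + # 3 + # 2 * K) * t
                                  ≡ (π + # 2 + # 2 * K) * (π + 1ℚ - K) * (π + 1ℚ - # 2 * K) * term (3 ℕ.+ i) 1)
                                (ι-# 1) (term-shift-π (2 ℕ.+ i) 1 (trans (ℕ.+-comm (2 ℕ.+ i) 1) (cong (2 ℕ.+_) (sym n≡)))) ⟩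
      b * term (3 ℕ.+ i) 1   ≡⟨ cong (λ u → b * term (2 ℕ.+ u) 1) n≡ ⟨
      b * h₁                 ∎
    e₁ : ∀ n → 3 ℕ.+ 2 ℕ.* n ℕ.+ 2 ℕ.* 1 ≡ 1 ℕ.+ 2 ℕ.* (2 ℕ.+ n)
    e₁ = ℕ.solve-∀
    e₂ : ∀ n → 3 ℕ.+ 2 ℕ.* n ℕ.+ 1 ≡ 2 ℕ.* (2 ℕ.+ n)
    e₂ = ℕ.solve-∀
    e₃ : ∀ i → 5 ℕ.+ (1 ℕ.+ 2 ℕ.* i) ≡ 2 ℕ.* (3 ℕ.+ i)
    e₃ = ℕ.solve-∀
    unit-a : Unit a
    unit-a = Unit-* (Unit-*
      (Unit-≡ (trans (ι≡π- (3 ℕ.+ 2 ℕ.* n) 1 (e₁ n)) (cong (λ u → π - # 2 * u) (ι-# 1))) (Unit-< (2 ℕ.+ 2 ℕ.* n) 1 (e₂ n)))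
      (Unit-≡ (c₃ π) Unit-3+π))
      (Unit-≡ (trans (cong (λ u → π + u) (ι-# 5)) (c₅ π)) (Unit-π+ 4 (1 ℕ.+ 2 ℕ.* i) (trans (e₃ i) (cong (λ u → 2 ℕ.* (2 ℕ.+ u)) (sym n≡)))))
      where
      c₃ : ∀ π → # 3 + π ≡ π + # 2 + 1ℚ
      c₃ = solve-∀ ring
      c₅ : ∀ π → π + # 5 ≡ π + # 3 + # 2 * 1ℚ
      c₅ = solve-∀ ring
    d₂ : Div 2 t
    d₂ = Div-cancel unit-a (Div-≡ (trans (shuffle π h₁) (sym shift))
      (Div-* ((Oπ ⊕ O-# 4) ⊗ (Oπ ⊖ O-1)) (Div-π* first-term-div)))
      where
      shuffle : ∀ π h → (π + # 4) * (π - 1ℚ) * (π * h) ≡ (π + # 2 + # 2 * 1ℚ) * (π + 1ℚ - 1ℚ) * (π + 1ℚ - # 2 * 1ℚ) * h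
      shuffle = solve-∀ ring
    v X : ℚ
    v = # 8 * ((1ℚ + π) * (# 3 + π))
    X = ¾ * (π * π)
    -- Origin of `¾`: to leading order a = -30, b = -4π, h(N,1) = π/8 and `weight 0` is 45, and 45 ·
    -- 4 / (30 · 8) = 3/4.
    d₃ : Div 3 (1ℚ * (weight 0 * t) - X)
    d₃ = Div-cancel (Unit-* (Unit-* Unit-8 (Unit-* Unit-1+π Unit-3+π)) unit-a) (mkDiv
      (O-# 135 ⊗ (Oπ ⊕ O-# 4) ⊗ (Oπ ⊖ O-1) ⊗ (O-1 ⊕ O-# 3 ⊗ Oπ) ⊗ (Oh ⊕ Oπ ⊗ Ot₁)
        ⊕ (O-# 249 ⊗ Oπ ⊗ Oπ ⊕ O-# 1446 ⊗ Oπ ⊖ O-# 477 ⊖ O-# 60 ⊗ Oπ ⊗ Oπ ⊗ Oπ ⊖ O-# 6 ⊗ Oπ ⊗ Oπ ⊗ Oπ ⊗ Oπ)) (begin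
      v * a * (1ℚ * (weight 0 * t) - X)
        ≡⟨ cong (λ J → v * a * (1ℚ * ((1ℚ + J) * (# 3 + J) * (# 3 + # 2 * J) * (# 5 + # 2 * J) * t) - X)) (ι-# 0) ⟩
      v * a * (1ℚ * ((1ℚ + 0ℚ) * (# 3 + 0ℚ) * (# 3 + # 2 * 0ℚ) * (# 5 + # 2 * 0ℚ) * t) - X)
        ≡⟨ poly₁ v a t X ⟩
      # 45 * v * (a * t) - v * a * X
        ≡⟨ cong (λ u → # 45 * v * u - v * a * X) shift ⟩
      # 45 * v * (b * h₁) - v * a * X
        ≡⟨ poly₂ v b h₁ (v * a * X) ⟩
      # 45 * b * (v * h₁) - v * a * X
        ≡⟨ cong (λ u → # 45 * b * u - v * a * X) (trans first-term-π (cong (λ u → # 3 * ((1ℚ + # 3 * π) * (π * u))) Θ₁≡)) ⟩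
      # 45 * b * (# 3 * ((1ℚ + # 3 * π) * (π * (1ℚ + π * h + π * (π * t₁))))) - v * a * X
        ≡⟨ poly₃ π h t₁ ⟩
      _ ∎))
      where
      poly₁ : ∀ v a t X → v * a * (1ℚ * ((1ℚ + 0ℚ) * (# 3 + 0ℚ) * (# 3 + # 2 * 0ℚ) * (# 5 + # 2 * 0ℚ) * t) - X) ≡ # 45 * v * (a * t) - v * a * X
      poly₁ = solve-∀ ring
      poly₂ : ∀ v b h x → # 45 * v * (b * h) - x ≡ # 45 * b * (v * h) - x
      poly₂ = solve-∀ ring
      poly₃ : ∀ π h t →
        # 45 * ((π + # 2 + # 2 * 1ℚ) * (π + 1ℚ - 1ℚ) * (π + 1ℚ - # 2 * 1ℚ)) * (# 3 * ((1ℚ + # 3 * π) * (π * (1ℚ + π * h + π * (π * t)))))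
          - # 8 * ((1ℚ + π) * (# 3 + π)) * ((π - # 2 * 1ℚ) * (π + # 2 + 1ℚ) * (π + # 3 + # 2 * 1ℚ)) * (# 3 * (½ * ½) * (π * π))
        ≡ π * (π * (π * 1ℚ)) * (# 135 * (π + # 4) * (π - 1ℚ) * (1ℚ + # 3 * π) * (h + π * t)
          + (# 249 * π * π + # 1446 * π - # 477 - # 60 * π * π * π - # 6 * π * π * π * π))
      poly₃ = solve-∀ ring
  middle-term (suc j) i eq = d₂ , d₃
    where
    n≡ : n ≡ suc (suc i) ℕ.+ j
    n≡ = trans (sym eq) (cong suc (ℕ.+-suc i j))
    J K σ t t′ a b : ℚ
    J = ι j
    K = # 2 + J
    σ = sgn j
    t = term (3 ℕ.+ i) (2 ℕ.+ j)
    t′ = term (2 ℕ.+ i) (3 ℕ.+ j)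
    a = (π - # 2 * K) * (π + # 2 + K) * (π + # 3 + # 2 * K)
    b = (π + # 2 + # 2 * K) * (π + 1ℚ - K) * (π + 1ℚ - # 2 * K)
    IH : Div 2 t × Div 3 (σ * (weight j * t) - ¾ * (π * π))
    IH = middle-term j (suc i) (sym n≡)
    eₘ : ∀ i j → 2 ℕ.+ i ℕ.+ (2 ℕ.+ j) ≡ 2 ℕ.+ (suc (suc i) ℕ.+ j)
    eₘ = ℕ.solve-∀
    shift : a * t′ ≡ b * t
    shift = subst (λ K → (π - # 2 * K) * (π + # 2 + K) * (π + # 3 + # 2 * K) * t′
        ≡ (π + # 2 + # 2 * K) * (π + 1ℚ - K) * (π + 1ℚ - # 2 * K) * t)
      (ι-2+ j) (term-shift-π (2 ℕ.+ i) (2 ℕ.+ j) (trans (eₘ i j) (cong (2 ℕ.+_) (sym n≡))))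
    OJ : O J
    OJ = O-ι j
    OK : O K
    OK = O-# 2 ⊕ OJ
    Ob : O b
    Ob = (Oπ ⊕ O-# 2 ⊕ O-# 2 ⊗ OK) ⊗ (Oπ ⊕ O-1 ⊖ OK) ⊗ (Oπ ⊕ O-1 ⊖ O-# 2 ⊗ OK)
    2m≡ : 2 ℕ.* m ≡ 2 ℕ.* (2 ℕ.+ (suc (suc i) ℕ.+ j))
    2m≡ = cong (λ u → 2 ℕ.* (2 ℕ.+ u)) n≡
    e₁ : ∀ i j → 5 ℕ.+ 2 ℕ.* i ℕ.+ 2 ℕ.* (2 ℕ.+ j) ≡ 1 ℕ.+ 2 ℕ.* (2 ℕ.+ (suc (suc i) ℕ.+ j))
    e₁ = ℕ.solve-∀
    e₂ : ∀ i j → 5 ℕ.+ 2 ℕ.* i ℕ.+ (3 ℕ.+ 2 ℕ.* j) ≡ 2 ℕ.* (2 ℕ.+ (suc (suc i) ℕ.+ j))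
    e₂ = ℕ.solve-∀
    e₃ : ∀ i j → 4 ℕ.+ j ℕ.+ (4 ℕ.+ 2 ℕ.* i ℕ.+ j) ≡ 2 ℕ.* (2 ℕ.+ (suc (suc i) ℕ.+ j))
    e₃ = ℕ.solve-∀
    e₄ : ∀ i j → 7 ℕ.+ 2 ℕ.* j ℕ.+ (1 ℕ.+ 2 ℕ.* i) ≡ 2 ℕ.* (2 ℕ.+ (suc (suc i) ℕ.+ j))
    e₄ = ℕ.solve-∀
    unit-a : Unit a
    unit-a = Unit-* (Unit-*
      (Unit-≡ (trans (ι≡π- (5 ℕ.+ 2 ℕ.* i) (2 ℕ.+ j) (trans (e₁ i j) (cong suc (sym 2m≡)))) (cong (λ u → π - # 2 * u) (ι-2+ j)))
        (Unit-< (4 ℕ.+ 2 ℕ.* i) (3 ℕ.+ 2 ℕ.* j) (trans (e₂ i j) (sym 2m≡))))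
      (Unit-≡ (trans (cong (λ u → π + u) (trans (ι-homo-+ 4 j) (cong (_+ J) (ι-# 4)))) (c₄ π J))
        (Unit-π+ (3 ℕ.+ j) (4 ℕ.+ 2 ℕ.* i ℕ.+ j) (trans (e₃ i j) (sym 2m≡)))))
      (Unit-≡ (trans (cong (λ u → π + u) (trans (ι-linʳ 2 7 j) (cong (_+ # 2 * J) (ι-# 7)))) (c₇ π J))
        (Unit-π+ (6 ℕ.+ 2 ℕ.* j) (1 ℕ.+ 2 ℕ.* i) (trans (e₄ i j) (sym 2m≡))))
      where
      c₄ : ∀ π J → π + (# 4 + J) ≡ π + # 2 + (# 2 + J)
      c₄ = solve-∀ ring
      c₇ : ∀ π J → π + (# 7 + # 2 * J) ≡ π + # 3 + # 2 * (# 2 + J)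
      c₇ = solve-∀ ring
    d₂ : Div 2 t′
    d₂ = Div-cancel unit-a (Div-≡ (sym shift) (Div-* Ob (proj₁ IH)))
    -- The cofactor in K(K+2)(2K+3) b + (K²-1)(2K-1) a = π q. The parts of `a` and `b` free of π
    -- cancel there; the common factor 2K + 1 = 5 + 2J of the two weights is kept outside.
    q : ℚ
    q = K * (K + # 2) * (# 2 * K + # 3) * (π * π + π * (# 4 - K) + ((# 2 + # 2 * K) * (1ℚ - K) + (# 2 + # 2 * K) * (1ℚ - # 2 * K) + (1ℚ - K) * (1ℚ - # 2 * K)))
      + (K - 1ℚ) * (K + 1ℚ) * (# 2 * K - 1ℚ) * (π * π + π * (# 5 + K) + ((# 2 + K) * (# 3 + # 2 * K) - # 2 * K * (# 2 + K) - # 2 * K * (# 3 + # 2 * K)))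
    Oq : O q
    Oq = OK ⊗ (OK ⊕ O-# 2) ⊗ (O-# 2 ⊗ OK ⊕ O-# 3) ⊗ (Oπ ⊗ Oπ ⊕ Oπ ⊗ (O-# 4 ⊖ OK) ⊕ ((O-# 2 ⊕ O-# 2 ⊗ OK) ⊗ (O-1 ⊖ OK) ⊕ (O-# 2 ⊕ O-# 2 ⊗ OK) ⊗ (O-1 ⊖ O-# 2 ⊗ OK) ⊕ (O-1 ⊖ OK) ⊗ (O-1 ⊖ O-# 2 ⊗ OK)))
      ⊕ (OK ⊖ O-1) ⊗ (OK ⊕ O-1) ⊗ (O-# 2 ⊗ OK ⊖ O-1) ⊗ (Oπ ⊗ Oπ ⊕ Oπ ⊗ (O-# 5 ⊕ OK) ⊕ ((O-# 2 ⊕ OK) ⊗ (O-# 3 ⊕ O-# 2 ⊗ OK) ⊖ O-# 2 ⊗ OK ⊗ (O-# 2 ⊕ OK) ⊖ O-# 2 ⊗ OK ⊗ (O-# 3 ⊕ O-# 2 ⊗ OK)))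
    w : ℚ
    w = Div.quotient (proj₁ IH)
    W′ : ℚ → ℚ
    W′ J = (1ℚ + J) * (# 3 + J) * (# 3 + # 2 * J) * (# 5 + # 2 * J)
    difference : Div 3 (- σ * (weight (suc j) * t′) - σ * (weight j * t))
    difference = Div-cancel unit-a (mkDiv (⊝ (O-sgn j ⊗ (O-# 5 ⊕ O-# 2 ⊗ OJ) ⊗ Oq ⊗ Div.integral (proj₁ IH))) (begin
      a * (- σ * (weight (suc j) * t′) - σ * (weight j * t))
        ≡⟨ cong (λ u → a * (- σ * (W′ u * t′) - σ * (weight j * t))) (ι-suc j) ⟩
      a * (- σ * (W′ (1ℚ + J) * t′) - σ * (W′ J * t))
        ≡⟨ poly₁ a σ (W′ (1ℚ + J)) (W′ J) t t′ ⟩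
      - σ * (W′ (1ℚ + J) * (a * t′)) - σ * (W′ J * (a * t))
        ≡⟨ cong (λ u → - σ * (W′ (1ℚ + J) * u) - σ * (W′ J * (a * t))) shift ⟩
      - σ * (W′ (1ℚ + J) * (b * t)) - σ * (W′ J * (a * t))
        ≡⟨ cong (λ u → - σ * (W′ (1ℚ + J) * (b * u)) - σ * (W′ J * (a * u))) (Div.proof (proj₁ IH)) ⟩
      - σ * (W′ (1ℚ + J) * (b * (π * (π * 1ℚ) * w))) - σ * (W′ J * (a * (π * (π * 1ℚ) * w)))
        ≡⟨ poly₂ π J σ w ⟩
      _ ∎))
      where
      poly₁ : ∀ a σ x y t t′ → a * (- σ * (x * t′) - σ * (y * t)) ≡ - σ * (x * (a * t′)) - σ * (y * (a * t))
      poly₁ = solve-∀ ring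
      poly₂ : ∀ π J σ w →
        - σ * ((1ℚ + (1ℚ + J)) * (# 3 + (1ℚ + J)) * (# 3 + # 2 * (1ℚ + J)) * (# 5 + # 2 * (1ℚ + J)) * ((π + # 2 + # 2 * (# 2 + J)) * (π + 1ℚ - (# 2 + J)) * (π + 1ℚ - # 2 * (# 2 + J)) * (π * (π * 1ℚ) * w)))
        - σ * ((1ℚ + J) * (# 3 + J) * (# 3 + # 2 * J) * (# 5 + # 2 * J) * ((π - # 2 * (# 2 + J)) * (π + # 2 + (# 2 + J)) * (π + # 3 + # 2 * (# 2 + J)) * (π * (π * 1ℚ) * w)))
        ≡ π * (π * (π * 1ℚ)) * - (σ * (# 5 + # 2 * J) *
          ((# 2 + J) * (# 2 + J + # 2) * (# 2 * (# 2 + J) + # 3) * (π * π + π * (# 4 - (# 2 + J)) + ((# 2 + # 2 * (# 2 + J)) * (1ℚ - (# 2 + J)) + (# 2 + # 2 * (# 2 + J)) * (1ℚ - # 2 * (# 2 + J)) + (1ℚ - (# 2 + J)) * (1ℚ - # 2 * (# 2 + J))))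
          + (# 2 + J - 1ℚ) * (# 2 + J + 1ℚ) * (# 2 * (# 2 + J) - 1ℚ) * (π * π + π * (# 5 + (# 2 + J)) + ((# 2 + (# 2 + J)) * (# 3 + # 2 * (# 2 + J)) - # 2 * (# 2 + J) * (# 2 + (# 2 + J)) - # 2 * (# 2 + J) * (# 3 + # 2 * (# 2 + J))))) * w)
      poly₂ = solve-∀ ring
    d₃ : Div 3 (- σ * (weight (suc j) * t′) - ¾ * (π * π))
    d₃ = Div-≡ (shuffle (- σ * (weight (suc j) * t′)) (σ * (weight j * t)) (¾ * (π * π))) (Div-+ difference (proj₂ IH))
      where
      shuffle : ∀ x y z → x - y + (y - z) ≡ x - z
      shuffle = solve-∀ ring

  -- Partial fractions: (-1)^k k / ((k² - 1) (4 k² - 1)) = (potential j - potential (j + 1)) / 3 for k = j + 2.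
  potential : ℕ → ℚ
  potential j = ½ * (altHarmonic j + altHarmonic (2 ℕ.+ j)) - sgn j * recip (3 ℕ.+ 2 ℕ.* j)

  -- k / ((k²-1)(4k²-1)) is (1/(k-1) + 1/(k+1)) / 6 - (1/(2k-1) + 1/(2k+1)) / 3. With alternating
  -- signs the second bracket telescopes to a single reciprocal, while the first can only be summed
  -- as `altHarmonic`, averaged over two positions.
  potential-step : ∀ j → weight j * (potential j - potential (suc j)) ≡ # 3 * (sgn j * (# 2 + ι j))
  potential-step j = begin
    weight j * (potential j - potential (suc j))
      ≡⟨ cong (λ u → weight j * (potential j - (½ * (altHarmonic (suc j) + altHarmonic (3 ℕ.+ j)) - - σ * recip u))) (eq j) ⟩
    _ ≡⟨ poly₁ (ι j) σ (altHarmonic j) (recip (1 ℕ.+ j)) (recip (2 ℕ.+ j)) (recip (3 ℕ.+ j)) (recip (3 ℕ.+ 2 ℕ.* j)) (recip (5 ℕ.+ 2 ℕ.* j)) ⟩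
    collected ((1ℚ + J) * recip (1 ℕ.+ j)) ((# 3 + J) * recip (3 ℕ.+ j)) ((# 3 + # 2 * J) * recip (3 ℕ.+ 2 ℕ.* j)) ((# 5 + # 2 * J) * recip (5 ℕ.+ 2 ℕ.* j))
      ≡⟨ cong₂ (λ u v → collected u v ((# 3 + # 2 * J) * recip (3 ℕ.+ 2 ℕ.* j)) ((# 5 + # 2 * J) * recip (5 ℕ.+ 2 ℕ.* j))) one₁ one₃ ⟩
    collected 1ℚ 1ℚ ((# 3 + # 2 * J) * recip (3 ℕ.+ 2 ℕ.* j)) ((# 5 + # 2 * J) * recip (5 ℕ.+ 2 ℕ.* j))
      ≡⟨ cong₂ (collected 1ℚ 1ℚ) (one₂ 3) (one₂ 5) ⟩
    collected 1ℚ 1ℚ 1ℚ 1ℚ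
      ≡⟨ poly₂ J σ ⟩
    # 3 * (σ * (# 2 + J)) ∎
    where
    J σ : ℚ
    J = ι j
    σ = sgn j
    collected : ℚ → ℚ → ℚ → ℚ → ℚ
    collected x₁ x₃ y₃ y₅ = σ * (½ * (x₁ * ((# 3 + J) * (# 3 + # 2 * J) * (# 5 + # 2 * J)) + x₃ * ((1ℚ + J) * (# 3 + # 2 * J) * (# 5 + # 2 * J)))
      - (y₃ * ((1ℚ + J) * (# 3 + J) * (# 5 + # 2 * J)) + y₅ * ((1ℚ + J) * (# 3 + J) * (# 3 + # 2 * J))))
    eq : ∀ j → 3 ℕ.+ 2 ℕ.* suc j ≡ 5 ℕ.+ 2 ℕ.* j
    eq = ℕ.solve-∀
    one₁ : (1ℚ + J) * recip (1 ℕ.+ j) ≡ 1ℚ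
    one₁ = trans (cong (_* recip (1 ℕ.+ j)) (sym (ι-suc j))) (recip-inverse (1 ℕ.+ j))
    one₃ : (# 3 + J) * recip (3 ℕ.+ j) ≡ 1ℚ
    one₃ = trans (cong (_* recip (3 ℕ.+ j)) (sym (trans (ι-homo-+ 3 j) (cong (_+ J) (ι-# 3))))) (recip-inverse (3 ℕ.+ j))
    one₂ : ∀ c .{{_ : ℕ.NonZero c}} → (# c + # 2 * J) * recip (c ℕ.+ 2 ℕ.* j) ≡ 1ℚ
    one₂ c@(suc _) = trans (cong (_* recip (c ℕ.+ 2 ℕ.* j)) (sym (trans (ι-linʳ 2 c j) (cong (_+ # 2 * J) (ι-# c))))) (recip-inverse (c ℕ.+ 2 ℕ.* j))
    poly₁ : ∀ J σ A r₁ r₂ r₃ u₃ u₅ →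
      (1ℚ + J) * (# 3 + J) * (# 3 + # 2 * J) * (# 5 + # 2 * J) *
        (½ * (A + (A + - σ * r₁ + - - σ * r₂)) - σ * u₃
        - (½ * (A + - σ * r₁ + (A + - σ * r₁ + - - σ * r₂ + - - - σ * r₃)) - - σ * u₅))
      ≡ σ * (½ * ((1ℚ + J) * r₁ * ((# 3 + J) * (# 3 + # 2 * J) * (# 5 + # 2 * J)) + (# 3 + J) * r₃ * ((1ℚ + J) * (# 3 + # 2 * J) * (# 5 + # 2 * J)))
        - ((# 3 + # 2 * J) * u₃ * ((1ℚ + J) * (# 3 + J) * (# 5 + # 2 * J)) + (# 5 + # 2 * J) * u₅ * ((1ℚ + J) * (# 3 + J) * (# 3 + # 2 * J))))
    poly₁ = solve-∀ ring
    poly₂ : ∀ J σ → σ * (½ * (1ℚ * ((# 3 + J) * (# 3 + # 2 * J) * (# 5 + # 2 * J)) + 1ℚ * ((1ℚ + J) * (# 3 + # 2 * J) * (# 5 + # 2 * J)))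
      - (1ℚ * ((1ℚ + J) * (# 3 + J) * (# 5 + # 2 * J)) + 1ℚ * ((1ℚ + J) * (# 3 + J) * (# 3 + # 2 * J)))) ≡ # 3 * (σ * (# 2 + J))
    poly₂ = solve-∀ ring

  -- The coefficient ¼ is the ¾ of `middle-term` divided by the 3 of `potential-step`; the sign
  -- moves across because its square is 1.
  middle-summand : ∀ i j → suc i ℕ.+ j ≡ n →
    Div 3 (ι (2 ℕ.+ j) * term (2 ℕ.+ i) (2 ℕ.+ j) - ½ * ½ * (π * π) * (potential j - potential (suc j)))
  middle-summand i j eq = Div-cancel unit (Div-≡ (sym (begin
    weight j * (ι (2 ℕ.+ j) * t - ½ * ½ * (π * π) * Δ)
      ≡⟨ cong (λ u → weight j * (u * t - ½ * ½ * (π * π) * Δ)) (ι-2+ j) ⟩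
    weight j * (K * t - ½ * ½ * (π * π) * Δ)
      ≡⟨ poly₁ (weight j) K t π Δ ⟩
    K * (1ℚ * (weight j * t)) - ½ * ½ * (π * π) * (weight j * Δ)
      ≡⟨ cong₂ (λ u v → K * (u * (weight j * t)) - ½ * ½ * (π * π) * v) (sym (sgn² j)) (potential-step j) ⟩
    K * (σ * σ * (weight j * t)) - ½ * ½ * (π * π) * (# 3 * (σ * K))
      ≡⟨ poly₂ K σ (weight j * t) π ⟩
    σ * K * (σ * (weight j * t) - ¾ * (π * π)) ∎))
    (Div-* (O-sgn j ⊗ (O-# 2 ⊕ O-ι j)) (proj₂ (middle-term j i eq))))
    where
    σ K t Δ : ℚ
    σ = sgn j
    K = # 2 + ι j
    t = term (2 ℕ.+ i) (2 ℕ.+ j)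
    Δ = potential j - potential (suc j)
    2m≡ : 2 ℕ.* (2 ℕ.+ (suc i ℕ.+ j)) ≡ 2 ℕ.* m
    2m≡ = cong (λ u → 2 ℕ.* (2 ℕ.+ u)) eq
    e₁ : ∀ i j → 1 ℕ.+ j ℕ.+ (5 ℕ.+ 2 ℕ.* i ℕ.+ j) ≡ 2 ℕ.* (2 ℕ.+ (suc i ℕ.+ j))
    e₁ = ℕ.solve-∀
    e₂ : ∀ i j → 3 ℕ.+ j ℕ.+ (3 ℕ.+ 2 ℕ.* i ℕ.+ j) ≡ 2 ℕ.* (2 ℕ.+ (suc i ℕ.+ j))
    e₂ = ℕ.solve-∀
    e₃ : ∀ i j → 3 ℕ.+ 2 ℕ.* j ℕ.+ (3 ℕ.+ 2 ℕ.* i) ≡ 2 ℕ.* (2 ℕ.+ (suc i ℕ.+ j))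
    e₃ = ℕ.solve-∀
    e₄ : ∀ i j → 5 ℕ.+ 2 ℕ.* j ℕ.+ (1 ℕ.+ 2 ℕ.* i) ≡ 2 ℕ.* (2 ℕ.+ (suc i ℕ.+ j))
    e₄ = ℕ.solve-∀
    unit : Unit (weight j)
    unit = Unit-* (Unit-* (Unit-*
      (Unit-≡ (ι-suc j) (Unit-< j (5 ℕ.+ 2 ℕ.* i ℕ.+ j) (trans (e₁ i j) 2m≡)))
      (Unit-≡ (trans (ι-homo-+ 3 j) (cong (_+ ι j) (ι-# 3))) (Unit-< (2 ℕ.+ j) (3 ℕ.+ 2 ℕ.* i ℕ.+ j) (trans (e₂ i j) 2m≡))))
      (Unit-≡ (trans (ι-linʳ 2 3 j) (cong (_+ # 2 * ι j) (ι-# 3))) (Unit-< (2 ℕ.+ 2 ℕ.* j) (3 ℕ.+ 2 ℕ.* i) (trans (e₃ i j) 2m≡))))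
      (Unit-≡ (trans (ι-linʳ 2 5 j) (cong (_+ # 2 * ι j) (ι-# 5))) (Unit-< (4 ℕ.+ 2 ℕ.* j) (1 ℕ.+ 2 ℕ.* i) (trans (e₄ i j) 2m≡)))
    poly₁ : ∀ w K t π Δ → w * (K * t - ½ * ½ * (π * π) * Δ) ≡ K * (1ℚ * (w * t)) - ½ * ½ * (π * π) * (w * Δ)
    poly₁ = solve-∀ ring
    poly₂ : ∀ K σ x π → K * (σ * σ * x) - ½ * ½ * (π * π) * (# 3 * (σ * K)) ≡ σ * K * (σ * x - # 3 * (½ * ½) * (π * π))
    poly₂ = solve-∀ ring

  -- `diagSum 1 m` consists of the terms k = N - 1 and k = N, where (N+k)! is divisible by p; the
  -- telescoping has to stop before them.
  middle-sum : ∀ i j → i ℕ.+ j ≡ n →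
    Div 3 (diagSum (suc i) (2 ℕ.+ j) - diagSum 1 m - ½ * ½ * (π * π) * (potential j - potential n))
  middle-sum zero    j eq = Div-zero (trans
    (cong (λ l → diagSum 1 (2 ℕ.+ l) - diagSum 1 m - ½ * ½ * (π * π) * (potential l - potential n)) eq)
    (cancel (diagSum 1 m) π (potential n)))
    where
    cancel : ∀ d π x → d - d - ½ * ½ * (π * π) * (x - x) ≡ 0ℚ
    cancel = solve-∀ ring
  middle-sum (suc i) j eq = Div-≡
    (shuffle (ι (2 ℕ.+ j) * term (2 ℕ.+ i) (2 ℕ.+ j)) (diagSum (suc i) (3 ℕ.+ j)) (diagSum 1 m) (½ * ½ * (π * π)) (potential j) (potential (suc j)) (potential n))
    (Div-+ (middle-summand i j eq) (middle-sum i (suc j) (trans (ℕ.+-suc i j) eq)))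
    where
    shuffle : ∀ a d e c x y z → a - c * (x - y) + (d - e - c * (y - z)) ≡ a + d - e - c * (x - z)
    shuffle = solve-∀ ring

  -- End values of the telescoped sum and the final congruence

  recip-mod : ∀ a b k l .{{_ : ℕ.NonZero k}} → k ℕ.+ l ≡ 2 ℕ.* m → a ℕ.+ b ℕ.* k ≡ p → Div 1 (# a * recip k + # b)
  recip-mod a b k@(suc k-1) l k+l≡2m a+bk≡p = Div-cancel (Unit-< k-1 l k+l≡2m) (mkDiv O-1 (begin
    ι k * (# a * recip k + # b)        ≡⟨ shuffle (ι k) (recip k) (# a) (# b) ⟩
    # a * (ι k * recip k) + # b * ι k  ≡⟨ cong (λ u → # a * u + # b * ι k) (recip-inverse k) ⟩
    # a * 1ℚ + # b * ι k               ≡⟨ cong (_+ # b * ι k) (trans (*-identityʳ (# a)) (sym (ι-# a))) ⟩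
    ι a + # b * ι k                    ≡⟨ ι-linʳ b a k ⟨
    ι (a ℕ.+ b ℕ.* k)                  ≡⟨ cong ι a+bk≡p ⟩
    π                                  ≡⟨ pad π ⟩
    π * 1ℚ * 1ℚ                        ∎))
    where
    shuffle : ∀ k r a b → k * (a * r + b) ≡ a * (k * r) + b * k
    shuffle = solve-∀ ring
    pad : ∀ π → π ≡ π * 1ℚ * 1ℚ
    pad = solve-∀ ring

  -- `potential n` averages the alternating sums up to m - 2 and up to m, so it differs from A by
  -- two terms. Modulo p the reciprocals of n + 1, m and 2n + 3 = p - 2 are -2/3, -2 and -1/2,
  -- contributing -2 + 6 + 3 = 7. The last two terms of the antidiagonal carry the same 7 (-1)^m,
  -- and the two cancel in the total.
  potential-last : Div 1 (# 6 * potential n - # 6 * A - # 7 * s)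
  potential-last = Div-≡ (collect (altHarmonic n) (sgn n) (recip (1 ℕ.+ n)) (recip m) (recip (3 ℕ.+ 2 ℕ.* n)))
    (Div-* (O-sgn n) (Div-- (Div--
      (recip-mod 3 2 (1 ℕ.+ n) (3 ℕ.+ n) (e₁ n) (e₂ n))
      (Div-* (O-# 3) (recip-mod 1 2 m m (e₃ n) refl)))
      (Div-* (O-# 3) (recip-mod 2 1 (3 ℕ.+ 2 ℕ.* n) 1 (e₄ n) (e₅ n)))))
    where
    e₁ : ∀ n → 1 ℕ.+ n ℕ.+ (3 ℕ.+ n) ≡ 2 ℕ.* (2 ℕ.+ n)
    e₁ = ℕ.solve-∀
    e₂ : ∀ n → 3 ℕ.+ 2 ℕ.* (1 ℕ.+ n) ≡ 1 ℕ.+ 2 ℕ.* (2 ℕ.+ n)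
    e₂ = ℕ.solve-∀
    e₃ : ∀ n → 2 ℕ.+ n ℕ.+ (2 ℕ.+ n) ≡ 2 ℕ.* (2 ℕ.+ n)
    e₃ = ℕ.solve-∀
    e₄ : ∀ n → 3 ℕ.+ 2 ℕ.* n ℕ.+ 1 ≡ 2 ℕ.* (2 ℕ.+ n)
    e₄ = ℕ.solve-∀
    e₅ : ∀ n → 2 ℕ.+ 1 ℕ.* (3 ℕ.+ 2 ℕ.* n) ≡ 1 ℕ.+ 2 ℕ.* (2 ℕ.+ n)
    e₅ = ℕ.solve-∀
    collect : ∀ A σ r₁ r₂ u →
      σ * (# 3 * r₁ + # 2 - # 3 * (# 1 * r₂ + # 2) - # 3 * (# 2 * u + # 1))
      ≡ # 6 * (½ * (A + (A + - σ * r₁ + - - σ * r₂)) - σ * u) - # 6 * (A + - σ * r₁ + - - σ * r₂) - # 7 * - - σ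
    collect = solve-∀ ring

  potential-zero : potential 0 ≡ - (+ 7 / 12)
  potential-zero = begin
    ½ * (0ℚ + (0ℚ + - 1ℚ * recip 1 + - - 1ℚ * recip 2)) - 1ℚ * recip 3
      ≡⟨ cong₂ (λ u v → ½ * (0ℚ + (0ℚ + - 1ℚ * u + - - 1ℚ * v)) - 1ℚ * recip 3) (recip-/ 1) (recip-/ 2) ⟩
    ½ * (0ℚ + (0ℚ + - 1ℚ * (+ 1 / 1) + - - 1ℚ * (+ 1 / 2))) - 1ℚ * recip 3
      ≡⟨ cong (λ u → ½ * (0ℚ + (0ℚ + - 1ℚ * (+ 1 / 1) + - - 1ℚ * (+ 1 / 2))) - 1ℚ * u) (recip-/ 3) ⟩
    - (+ 7 / 12) ∎

  -- At order p² the rational constants cancel, 5 - 7/2 - 3/2 = 0, from k = 1, from the lower end of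
  -- the telescoped sum and from the central term. What is left is 3H/2 - 6A, which H ≡ 2A turns
  -- into -3H/2, the coefficient in 3p · 4^m.
  sum-mod : Div 3 (sumTo m summand - # 3 * (π * ι (4 ℕ.^ m)))
  sum-mod = Div-≡ (begin
    # 24 * h₁ - (# 3 * π + π * (π * (# 5 + # 3 * (½ * H))))
      + # 24 * (D₂ - D₁ - ½ * ½ * (π * π) * (- (+ 7 / 12) - E)) + (# 24 * D₁ - # 7 * s * (π * π))
      - (X₀ - # 3 * ½ * (π * π)) - π * (π * (# 6 * E - # 6 * A - # 7 * s)) + # 3 * (π * (π * (H - # 2 * A)))
      - # 3 * (π * (π * (π * c)))
      ≡⟨ collect π h₁ D₁ D₂ X₀ E A H s c (term (suc m) 0) ⟩
    # 24 * (0ℚ * term (suc m) 0 + (1ℚ * h₁ + D₂)) - X₀ - # 3 * (π * (1ℚ + π * (-½ * H) + π * (π * c)))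
      ≡⟨ cong₂ (λ u v → # 24 * (u * term (suc m) 0 + (v * h₁ + D₂)) - X₀ - # 3 * (π * (1ℚ + π * (-½ * H) + π * (π * c)))) (ι-# 0) (ι-# 1) ⟨
    # 24 * diagSum (suc m) 0 - X₀ - # 3 * (π * (1ℚ + π * (-½ * H) + π * (π * c)))
      ≡⟨ cong₂ (λ u v → u - # 3 * (π * v)) (sumTo-summand m) (Expand.expand e4^m) ⟨
    sumTo m summand - # 3 * (π * ι (4 ℕ.^ m)) ∎)
    (Div-- (Div-+ (Div-- (Div-- (Div-+ (Div-+ first-term-mod
      (Div-* (O-# 24) (Div-≡ (cong (λ u → D₂ - D₁ - ½ * ½ * (π * π) * (u - E)) potential-zero) (middle-sum n 0 (ℕ.+-identityʳ n)))))
      last-terms-mod) central-term-mod) (Div-π* (Div-π* potential-last))) (Div-* (O-# 3) (Div-π* (Div-π* H≡2A))))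
      (Div-* (O-# 3) (Div-π* (Div-π* (Div-π* (mkDiv (Expand.O-rest e4^m) (sym (*-identityˡ c))))))))
    where
    h₁ D₁ D₂ X₀ E c : ℚ
    h₁ = term m 1
    D₁ = diagSum 1 m
    D₂ = diagSum (suc n) 2
    X₀ = # 8 * (ι (suc m) * term (suc m) 0)
    E = potential n
    c = Expand.rest e4^m
    collect : ∀ π h₁ D₁ D₂ X₀ E A H s c t →
      # 24 * h₁ - (# 3 * π + π * (π * (# 5 + # 3 * (½ * H))))
      + # 24 * (D₂ - D₁ - ½ * ½ * (π * π) * (- (+ 7 / 12) - E)) + (# 24 * D₁ - # 7 * s * (π * π))
      - (X₀ - # 3 * ½ * (π * π)) - π * (π * (# 6 * E - # 6 * A - # 7 * s)) + # 3 * (π * (π * (H - # 2 * A)))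
      - # 3 * (π * (π * (π * c)))
      ≡ # 24 * (0ℚ * t + (1ℚ * h₁ + D₂)) - X₀ - # 3 * (π * (1ℚ + π * (-½ * H) + π * (π * c)))
    collect = solve-∀ ring

-- The Fermat quotient, the case p = 3, and the theorem

fermatQuotient-rhs : ∀ p .{{_ : ℕ.NonZero p}} →
  fromℕ 3 * fromℕ p + fromℕ 3 * fromℕ (p ℕ.^ 2) * fermatQuotient p 2 ≡ # 3 * (ι p * ι (2 ℕ.^ (p ℕ.∸ 1)))
fermatQuotient-rhs p = begin
  # 3 * fromℕ p + # 3 * fromℕ (p ℕ.^ 2) * Q              ≡⟨ cong₂ (λ u v → # 3 * u + # 3 * v * Q) (sym (ι-fromℕ p)) square ⟩
  # 3 * ι p + # 3 * (ι p * ι p) * Q                      ≡⟨ shuffle (ι p) Q ⟩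
  # 3 * (ι p * (1ℚ + Q * ι p))                           ≡⟨ cong (λ u → # 3 * (ι p * (1ℚ + u))) (/-*-cancel (+ (2 ℕ.^ (p ℕ.∸ 1)) ℤ.- + 1) p) ⟩
  # 3 * (ι p * (1ℚ + (+ (2 ℕ.^ (p ℕ.∸ 1)) ℤ.- + 1) / 1)) ≡⟨ cong (λ u → # 3 * (ι p * u)) (1+[a-1] (2 ℕ.^ (p ℕ.∸ 1)) {{ℕ.m^n≢0 2 (p ℕ.∸ 1)}}) ⟩
  # 3 * (ι p * ι (2 ℕ.^ (p ℕ.∸ 1)))                      ∎
  where
  Q = fermatQuotient p 2
  square : fromℕ (p ℕ.^ 2) ≡ ι p * ι p
  square = begin
    fromℕ (p ℕ.^ 2)      ≡⟨ ι-fromℕ (p ℕ.^ 2) ⟨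
    ι (p ℕ.* (p ℕ.* 1))  ≡⟨ cong (λ u → ι (p ℕ.* u)) (ℕ.*-identityʳ p) ⟩
    ι (p ℕ.* p)          ≡⟨ ι-homo-* p p ⟩
    ι p * ι p            ∎
  shuffle : ∀ π Q → # 3 * π + # 3 * (π * π) * Q ≡ # 3 * (π * (1ℚ + Q * π))
  shuffle = solve-∀ ring
  1+[a-1] : ∀ a .{{_ : ℕ.NonZero a}} → 1ℚ + (+ a ℤ.- + 1) / 1 ≡ ι a
  1+[a-1] (suc a) = trans (cong (λ u → 1ℚ + u) (sym (ι-fromℕ a))) (sym (ι-suc a))

Claim : (p : ℕ) → Prime p → ℕ → Set
Claim p pr k = sumTo k summand
  ≅ fromℕ 3 * fromℕ p + fromℕ 3 * fromℕ (p ^ 2) * fermatQuotient p 2 {{prime⇒nonZero pr}} [mod p ^^ 3 ]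

odd-prime : ∀ {p} → Prime p → 2 ℕ.< p → ∃[ m ] p ≡ 1 ℕ.+ 2 ℕ.* m
odd-prime {p} pr 2<p with p ℕ.% 2 in eq | ℕ.m≡m%n+[m/n]*n p 2 | ℕ.m%n<n p 2
... | 0 | _  | _ with prime⇒irreducible pr (ℕ.m%n≡0⇒n∣m p 2 eq)
...   | inj₂ 2≡p = contradiction 2≡p (ℕ.<⇒≢ 2<p)
odd-prime {p} pr 2<p | 1 | p≡ | _ = p ℕ./ 2 , trans p≡ (cong suc (ℕ.*-comm (p ℕ./ 2) 2))
odd-prime {p} pr 2<p | suc (suc _) | _ | ℕ.s≤s (ℕ.s≤s ())

-- The sum is 45/8 and the right-hand side 36, so the difference is 27 · (-9/8).
claim-3 : (pr : Prime 3) → Claim 3 pr 1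
claim-3 pr = from-yes (coprime? 8 3) , from-yes (coprime? 1 3) , - (+ 9 / 8) , from-yes (coprime? 8 3) , refl

claim-≥5 : ∀ n (pr : Prime (1 ℕ.+ 2 ℕ.* (2 ℕ.+ n))) → Claim (1 ℕ.+ 2 ℕ.* (2 ℕ.+ n)) pr (2 ℕ.+ n)
-- The sum inherits integrality from the congruence, being (L - R) + R; no estimate of its
-- individual terms enters.
claim-≥5 n pr = O⇒Integral (subst O (cancel L R) (Div⇒O sum-mod′ ⊕ OR)) , O⇒Integral OR ,
  Div.quotient sum-mod′ , O⇒Integral (Div.integral sum-mod′) ,
  trans (Div.proof sum-mod′) (cong (_* Div.quotient sum-mod′) (sym (ι-^ 3)))
  where
  open Congruence n pr
  open Evaluation m using (p)
  open Local p pr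
  L = sumTo m summand
  R = fromℕ 3 * fromℕ p + fromℕ 3 * fromℕ (p ℕ.^ 2) * fermatQuotient p 2 {{prime⇒nonZero pr}}
  R≡ : R ≡ # 3 * (π * ι (4 ℕ.^ m))
  R≡ = trans (fermatQuotient-rhs p {{prime⇒nonZero pr}}) (cong (λ u → # 3 * (π * ι u)) (sym (ℕ.^-*-assoc 2 2 m)))
  OR : O R
  OR = subst O (sym R≡) (O-# 3 ⊗ (O-ι p ⊗ O-ι (4 ℕ.^ m)))
  sum-mod′ : Div 3 (L - R)
  sum-mod′ = Div-≡ (cong (λ u → L - u) (sym R≡)) sum-mod
  cancel : ∀ x y → x - y + y ≡ x
  cancel = solve-∀ ring

claim : ∀ p (pr : Prime p) → 2 < p → ∀ m → p ≡ 1 ℕ.+ 2 ℕ.* m → Claim p pr ((p ∸ 1) ℕ./ 2)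
claim _ pr (ℕ.s≤s ()) zero          refl
claim _ pr _          (suc zero)    refl = claim-3 pr
claim _ pr _          (suc (suc n)) refl = subst (Claim (1 ℕ.+ 2 ℕ.* (2 ℕ.+ n)) pr) (sym halve) (claim-≥5 n pr)
  where
  halve : 2 ℕ.* (2 ℕ.+ n) ℕ./ 2 ≡ 2 ℕ.+ n
  halve = trans (ℕ./-congˡ {o = 2} (ℕ.*-comm 2 (2 ℕ.+ n))) (ℕ.m*n/n≡m (2 ℕ.+ n) 2)

theorem1p4 : (p : ℕ) (pr : Prime p) → 2 < p →
    sumTo ((p ∸ 1) ℕ./ 2) summand
    ≅ fromℕ 3 * fromℕ p + fromℕ 3 * fromℕ (p ^ 2) * fermatQuotient p 2 {{prime⇒nonZero pr}}
    [mod p ^^ 3 ]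
theorem1p4 p pr 2<p = claim p pr 2<p (proj₁ (odd-prime pr 2<p)) (proj₂ (odd-prime pr 2<p))
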